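{- Let $n\ge1$ be an integer, and let $C_n(q)$ and $P_n(q)=C_n(q)/(q-1)^2$ be as defined below. (a) $C_n(-1)=r(n)$ and $P_n(-1)=r(n)/4$. (b) With $j=e^{2\pi i/3}$: $C_n(j)=-3\lambda(n)j^n$ and $P_n(j)=\lambda(n)j^{n-1}$. (c) With $\mathbf{i}=\sqrt{ -1}$: $C_n(\mathbf{i})=(-1)^{\lfloor (n+1)/2\rfloor}r'(n)\,\mathbf{i}^n$ and $P_n(\mathbf{i})=(-1)^{\lfloor (n-1)/2\rfloor}\frac{r'(n)}{2}\,\mathbf{i}^{n-1}$. (d) With $-j=e^{\pi i/3}$: $$C_n(-j)=\begin{cases} r(n) & \text{if } n\equiv 0 \pmod 3,\\ \frac{r(n)}{4}\,j & \text{if } n\equiv 1\pmod 3,\\ -\frac{r(n)}{2}\,j^2 & \text{if } n\equiv 2\pmod 3,\end{cases}$$ and $P_n(-j)=C_n(-j)/j=C_n(-j)\,j^2$.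
   Context: For each integer $n\ge1$, the Laurent polynomial $C_n(q)$ is defined by the identity of formal power series in $t$ $$1+\sum_{n\ge1}\frac{C_n(q)}{q^n}t^n=\prod_{i\ge1}\frac{(1-t^i)^2}{1-(q+q^{ -1})t^i+t^{2i}};$$ it is a polynomial in $q$ with integer coefficients divisible by $(q-1)^2$, and $P_n(q)=C_n(q)/(q-1)^2$. $r(n)$ denotes the number of pairs $(x,y)\in\mathbb{Z}^2$ with $x^2+y^2=n$; $r'(n)$ denotes the number of pairs $(x,y)\in\mathbb{Z}^2$ with $x^2+2y^2=n$. $\lambda$ is the multiplicative arithmetic function (i.e. $\lambda(mn)=\lambda(m)\lambda(n)$ for coprime $m,n$, $\lambda(1)=1$) defined on prime powers $p^e$ ($e\ge1$) by $\lambda(3^e)=-2$; $\lambda(p^e)=e+1$ if $p\equiv1\pmod 6$; $\lambda(p^e)=(1+(-1)^e)/2$ if $p\equiv 2,5\pmod 6$. For real $\alpha$, $\lfloor\alpha\rfloor$ is the largest integer $\le\alpha$.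
   Formalization: In (d) the evaluation point is the negative of j; the identification −j = e^{πi/3} is dropped, since j = e^{2πi/3} gives −j = e^{−πi/3} (with q = e^{πi/3} the formula fails at n = 1: C_1 = j², not j). -}

module Defs where

open import Data.Nat as ℕ using (ℕ; zero; suc; _∸_; _≡ᵇ_)
open import Data.Integer as ℤ using (ℤ; +_; -[1+_])
import Data.Rational as ℚ
open import Data.Bool using (if_then_else_)
open import Data.List as List using (List; []; _∷_; _++_; map; foldr; upTo; replicate; filter; length; cartesianProduct)
open import Data.Product using (_×_; _,_; proj₁; proj₂)
open import Data.Nat.Primality using (Prime)
open import Data.Nat.Coprimality using (Coprime)
open import Relation.Binary.PropositionalEquality using (_≡_)
open import Data.Sum using () renaming (_⊎_ to _⊎′_)

-- Polynomials in q over ℤ: coefficient lists, lowest degree first.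

Poly : Set
Poly = List ℤ

padd : Poly → Poly → Poly
padd []       ys       = ys
padd (x ∷ xs) []       = x ∷ xs
padd (x ∷ xs) (y ∷ ys) = (x ℤ.+ y) ∷ padd xs ys

pmul : Poly → Poly → Poly
pmul []       ys = []
pmul (x ∷ xs) ys = padd (map (x ℤ.*_) ys) (+ 0 ∷ pmul xs ys)

pshift : ℕ → Poly → Poly
pshift k p = replicate k (+ 0) ++ p

-- Division by (q - 1): returns (quotient , remainder).
-- If p = a + q p' and p' = (q-1) s' + r', then p = (q-1)(q s' + r') + (a + r').
pdivQm1 : Poly → Poly × ℤ
pdivQm1 []       = [] , + 0
pdivQm1 (a ∷ as) with pdivQm1 as
... | s′ , r′ = (r′ ∷ s′) , (a ℤ.+ r′)

-- Laurent polynomials in q over ℤ: (k , p) represents q^(-k) · p(q).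

Laurent : Set
Laurent = ℕ × Poly

ladd : Laurent → Laurent → Laurent
ladd (k , p) (l , r) = (k ℕ.+ l) , padd (pshift l p) (pshift k r)

lmul : Laurent → Laurent → Laurent
lmul (k , p) (l , r) = (k ℕ.+ l) , pmul p r

lneg : Laurent → Laurent
lneg (k , p) = k , map ℤ.-_ p

lzero lone : Laurent
lzero = 0 , []
lone  = 0 , (+ 1 ∷ [])

lqpow : ℕ → Laurent
lqpow n = 0 , pshift n (+ 1 ∷ [])

lq+q⁻¹ : Laurent
lq+q⁻¹ = 1 , (+ 1 ∷ + 0 ∷ + 1 ∷ [])

lsum : List Laurent → Laurent
lsum = foldr ladd lzero

-- Formal power series in t with Laurent-polynomial coefficients,
-- given by their coefficient function.

Series : Set
Series = ℕ → Laurent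

sone : Series
sone zero    = lone
sone (suc _) = lzero

tpow : ℕ → Series
tpow i n = if n ≡ᵇ i then lone else lzero

sadd : Series → Series → Series
sadd f g n = ladd (f n) (g n)

ssub : Series → Series → Series
ssub f g n = ladd (f n) (lneg (g n))

sscale : Laurent → Series → Series
sscale c f n = lmul c (f n)

smul : Series → Series → Series
smul f g n = lsum (map (λ k → lmul (f k) (g (n ∸ k))) (upTo (suc n)))

-- Inverse of a series f with constant term 1:
-- g 0 = 1, g n = - Σ_{k=1}^{n} f k · g (n - k).
-- sinvRev f n = [g n , g (n-1) , … , g 0].
private
  dot : Series → ℕ → List Laurent → Laurent
  dot f k []       = lzero
  dot f k (x ∷ xs) = ladd (lmul (f k) x) (dot f (suc k) xs)

sinvRev : Series → ℕ → List Laurent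
sinvRev f zero    = lone ∷ []
sinvRev f (suc n) = lneg (dot f 1 (sinvRev f n)) ∷ sinvRev f n

sinv : Series → Series
sinv f n with sinvRev f n
... | []    = lzero
... | x ∷ _ = x

factor : ℕ → Series
factor i = smul (smul num num) (sinv den)
  where
  num = ssub sone (tpow i)
  den = sadd (ssub sone (sscale lq+q⁻¹ (tpow i))) (tpow (i ℕ.+ i))

prodTo : ℕ → Series
prodTo zero    = sone
prodTo (suc N) = smul (prodTo N) (factor (suc N))

-- The coefficient of t^n in the infinite product ∏_{i≥1} factor i
-- (factors with i > n are ≡ 1 mod t^(n+1), so the product up to n suffices);
-- this is C_n(q)/q^n.
coeffProd : ℕ → Laurent
coeffProd n = prodTo n n

-- C_n(q)  (as a Laurent polynomial; it is in fact a polynomial)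
Cpoly : ℕ → Laurent
Cpoly n = lmul (lqpow n) (coeffProd n)

-- P_n(q) = C_n(q) / (q - 1)²  (exact division, by the stated divisibility)
Ppoly : ℕ → Laurent
Ppoly n with Cpoly n
... | k , p = k , proj₁ (pdivQm1 (proj₁ (pdivQm1 p)))

-- Evaluation of Laurent polynomials at a unit x (with inverse xinv)
-- of a (commutative) ring, given by its operations.

record RingOps : Set₁ where
  field
    Carrier : Set
    _⊕_ _⊗_ : Carrier → Carrier → Carrier
    ⊖_      : Carrier → Carrier
    𝟘 𝟙     : Carrier

module _ (R : RingOps) where
  open RingOps R

  natR : ℕ → Carrier
  natR zero    = 𝟘
  natR (suc n) = 𝟙 ⊕ natR n

  intR : ℤ → Carrier
  intR (+ n)    = natR n
  intR -[1+ n ] = ⊖ natR (suc n)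

  powR : Carrier → ℕ → Carrier
  powR x zero    = 𝟙
  powR x (suc n) = x ⊗ powR x n

  evalPoly : Carrier → Poly → Carrier
  evalPoly x []       = 𝟘
  evalPoly x (a ∷ as) = intR a ⊕ (x ⊗ evalPoly x as)

  evalLaurent : (x xinv : Carrier) → Laurent → Carrier
  evalLaurent x xinv (k , p) = powR xinv k ⊗ evalPoly x p

  Cat : (x xinv : Carrier) → ℕ → Carrier
  Cat x xinv n = evalLaurent x xinv (Cpoly n)

  Pat : (x xinv : Carrier) → ℕ → Carrier
  Pat x xinv n = evalLaurent x xinv (Ppoly n)

ℚR : RingOps
ℚR = record { Carrier = ℚ.ℚ ; _⊕_ = ℚ._+_ ; _⊗_ = ℚ._*_ ; ⊖_ = ℚ.-_ ; 𝟘 = ℚ.0ℚ ; 𝟙 = ℚ.1ℚ }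

-- Gaussian rationals: (a , b) = a + b·i
ℚ[i] : Set
ℚ[i] = ℚ.ℚ × ℚ.ℚ

gmul : ℚ[i] → ℚ[i] → ℚ[i]
gmul (a , b) (c , d) = (a ℚ.* c ℚ.- b ℚ.* d) , (a ℚ.* d ℚ.+ b ℚ.* c)

ℚ[i]R : RingOps
ℚ[i]R = record
  { Carrier = ℚ[i]
  ; _⊕_ = λ { (a , b) (c , d) → (a ℚ.+ c) , (b ℚ.+ d) }
  ; _⊗_ = gmul
  ; ⊖_ = λ { (a , b) → ℚ.- a , ℚ.- b }
  ; 𝟘 = ℚ.0ℚ , ℚ.0ℚ
  ; 𝟙 = ℚ.1ℚ , ℚ.0ℚ }

𝐢 𝐢⁻¹ : ℚ[i]
𝐢   = ℚ.0ℚ , ℚ.1ℚ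
𝐢⁻¹ = ℚ.0ℚ , ℚ.- ℚ.1ℚ

-- Eisenstein rationals: (a , b) = a + b·j, where j = e^{2πi/3}, j² = -1 - j
ℚ[j] : Set
ℚ[j] = ℚ.ℚ × ℚ.ℚ

emul : ℚ[j] → ℚ[j] → ℚ[j]
emul (a , b) (c , d) = (a ℚ.* c ℚ.- b ℚ.* d) , (a ℚ.* d ℚ.+ b ℚ.* c ℚ.- b ℚ.* d)

ℚ[j]R : RingOps
ℚ[j]R = record
  { Carrier = ℚ[j]
  ; _⊕_ = λ { (a , b) (c , d) → (a ℚ.+ c) , (b ℚ.+ d) }
  ; _⊗_ = emul
  ; ⊖_ = λ { (a , b) → ℚ.- a , ℚ.- b }
  ; 𝟘 = ℚ.0ℚ , ℚ.0ℚ
  ; 𝟙 = ℚ.1ℚ , ℚ.0ℚ }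

𝐣 𝐣⁻¹ -𝐣 -𝐣⁻¹ : ℚ[j]
𝐣    = ℚ.0ℚ , ℚ.1ℚ
𝐣⁻¹  = ℚ.- ℚ.1ℚ , ℚ.- ℚ.1ℚ    -- j⁻¹ = j² = -1 - j
-𝐣   = ℚ.0ℚ , ℚ.- ℚ.1ℚ
-𝐣⁻¹ = ℚ.1ℚ , ℚ.1ℚ            -- (-j)⁻¹ = -j² = 1 + j

ι : ℚ.ℚ → ℚ.ℚ × ℚ.ℚ
ι a = a , ℚ.0ℚ

-- r(n) = #{(x,y) ∈ ℤ² : x² + y² = n},  r'(n) = #{(x,y) ∈ ℤ² : x² + 2y² = n}.
-- Any solution has |x|, |y| ≤ n, so we count over the box [-n, n]².

box : ℕ → List ℤ
box n = map (λ k → + k ℤ.- + n) (upTo (suc (n ℕ.+ n)))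

countReps : (ℤ → ℤ → ℤ) → ℕ → ℕ
countReps Q n = length (filter (λ xy → Q (proj₁ xy) (proj₂ xy) ℤ.≟ + n)
                               (cartesianProduct (box n) (box n)))

r : ℕ → ℕ
r = countReps (λ x y → x ℤ.* x ℤ.+ y ℤ.* y)

r′ : ℕ → ℕ
r′ = countReps (λ x y → x ℤ.* x ℤ.+ + 2 ℤ.* (y ℤ.* y))

-- λ: the multiplicative arithmetic function with the given values on
-- prime powers (ℤ./ is integer division; 1 + (-1)^e is even).

record IsLambda (λ′ : ℕ → ℤ) : Set where
  field
    one   : λ′ 1 ≡ + 1
    mult  : ∀ m n → Coprime m n → λ′ (m ℕ.* n) ≡ λ′ m ℤ.* λ′ n
    three : ∀ e → 1 ℕ.≤ e → λ′ (3 ℕ.^ e) ≡ ℤ.- (+ 2)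
    p1    : ∀ p e → Prime p → p ℕ.% 6 ≡ 1 → 1 ℕ.≤ e → λ′ (p ℕ.^ e) ≡ + (e ℕ.+ 1)
    p25   : ∀ p e → Prime p → (p ℕ.% 6 ≡ 2 ⊎′ p ℕ.% 6 ≡ 5) → 1 ℕ.≤ e →
            λ′ (p ℕ.^ e) ≡ (+ 1 ℤ.+ (ℤ.-1ℤ ℤ.^ e)) ℤ./ + 2

{-# OPTIONS --safe #-}
module Submission where

-- At a unit q of a ring, C_n(q)/qⁿ is the coefficient of tⁿ in ∏ (1-tⁱ)²/(1-c tⁱ+t²ⁱ) with
-- c = q + q⁻¹, and c is the integer -2, -1, 0, 1 at q = -1, j, i, -j. At q = 1 + ε in the dual
-- numbers c = 2, so that the product is 1; this gives the divisibility of C_n by (q-1)².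
--
-- Put (t)_k = (1-t)⋯(1-tᵏ) and w(M,j) = (t)_M²/((t)_{M-j} (t)_{M+j}). Two finite identities follow
-- by induction on M, the induction step being a telescoping sum over j:
--   ∑_{|j|≤M} (-1)ʲ t^{j²} w(M,j) = ∏_{i≤M} (1-tⁱ)/(1+tⁱ),
--   1 + (2-c) ∑_{1≤j≤M} (-1)ʲ t^{j(j+1)/2} (1+tʲ)/(1-c tʲ+t²ʲ) w(M,j) = ∏_{i≤M} (1-tⁱ)²/(1-c tⁱ+t²ⁱ)
-- and modulo t^{M+1} the weights may be dropped.
-- The first identity makes the product θ(t)² for c = -2 and θ(t)θ(t²) for c = 0. The second one
-- expresses its coefficient at N by the factorisations n s = 2N with n, s of opposite parity. For
-- c = -1 this becomes 3 ∑_{ns=N} χ(n+s) with χ the character mod 3, and -∑_{ns=N} χ(n+s) is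
-- computed from a recursion in the exponent of each prime, which λ satisfies too. For c = 1 the
-- factorisations are compared with those for c = -2: term by term if 3 ∤ N, and through
-- r(N) = r(N/9) if 3 ∣ N.

open import Defs
open import Algebra.Bundles using (CommutativeRing)
import Algebra.Properties.CommutativeSemigroup
import Algebra.Properties.Ring
import Algebra.Solver.Ring
open import Algebra.Solver.Ring.AlmostCommutativeRing using (fromCommutativeRing; _-Raw-AlmostCommutative⟶_)
open import Algebra.Structures using (IsCommutativeRing)
open import Data.Integer as ℤ using (ℤ; +_; -[1+_]; 0ℤ; 1ℤ; -1ℤ; _^_)
import Data.Integer.Properties as ℤP
import Data.Integer.Solver
open import Data.List using (List; []; _∷_; map; applyUpTo; filter; length; cartesianProduct)
open import Data.List.Properties using (filter-++; length-++; map-upTo)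
open import Data.List.Relation.Unary.All using ([]; _∷_)
open import Data.Maybe using (Maybe; just; nothing)
open import Data.Nat as ℕ using (ℕ; zero; suc; _≤_; _<_; _∸_; z≤n; s≤s; _%_; ⌊_/2⌋; NonZero)
import Data.Nat.Properties as ℕP
open import Data.Nat.Coprimality using (Coprime; coprime-divisor; coprime?)
open import Data.Nat.Divisibility using (_∣_; _∤_; divides; _∣?_; ∣m⇒∣m*n; n∣m*n; ∣-trans; ∣m+n∣m⇒∣n; ∣⇒≤)
open import Data.Nat.DivMod using (m≡m%n+[m/n]*n; m%n<n)
open import Data.Nat.Induction using (<-rec)
open import Data.Nat.ListAction using (product)
open import Data.Nat.Primality using (Prime; euclidsLemma; prime⇒nonZero; prime⇒irreducible; ¬prime[1])
open import Data.Nat.Primality.Factorisation using (factorise)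
import Data.Nat.Solver
open import Data.Product using (_×_; _,_; proj₁; proj₂; ∃; ∃₂)
import Data.Rational as ℚ
import Data.Rational.Properties as ℚP
import Data.Rational.Solver
import Data.Rational.Unnormalised as ℚᵘ
import Data.Rational.Unnormalised.Properties as ℚᵘP
open import Data.Sum using (_⊎_; inj₁; inj₂; [_,_]′)
open import Function using (_∘_)
open import Level using (0ℓ)
open import Relation.Binary.PropositionalEquality hiding (setoid)
import Relation.Binary.Reasoning.Setoid
open import Relation.Nullary using (Dec; yes; no; contradiction)
open import Relation.Nullary.Decidable using (toWitness)

-- The identities are stated for finite `M` because the infinite product offers no variable to
-- induct on; with one, each step comes down to polynomial identities for the ring solver. The first
-- is a finite form of Gauss's product for ∑ (-1)ʲ t^(j²). The second is a finite form of the
-- partial fraction expansion known from the crank generating function of partitions, where 2 - c =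
-- (1 - q)(1 - q⁻¹) displays the zeros at q = 1. Factorisations enter because j(j+1)/2 + k j = N
-- says j (j + 2k + 1) = 2N, where k indexes the expansion of (1 + u)/(1 - c u + u²). That a sixth
-- root of unity leads to x² + y² has this reason: the coefficients of that expansion at c = 1 are
-- those at c = -2 times a function `κ` of k mod 3. In the sum over n s = 2N the function becomes
-- κ(n - s), and n - s mod 3 is determined up to sign by N as long as 3 does not divide N. If 3
-- divides N, then `κ` singles out the factorisations with both factors divisible by 3.

module ℤSolver = Data.Integer.Solver.+-*-Solver
module ℕSolver = Data.Nat.Solver.+-*-Solver
module ℚSolver = Data.Rational.Solver.+-*-Solver

-- Defined by recursion and not from decidable equality, so that convolution with `δ (suc m)`
-- reduces to a shift of convolution with `δ m`.
δ : ℕ → ℕ → ℤ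
δ zero    zero    = 1ℤ
δ zero    (suc n) = 0ℤ
δ (suc m) zero    = 0ℤ
δ (suc m) (suc n) = δ m n

δ-refl : ∀ n → δ n n ≡ 1ℤ
δ-refl zero    = refl
δ-refl (suc n) = δ-refl n

δ-≢ : ∀ {m n} → m ≢ n → δ m n ≡ 0ℤ
δ-≢ {zero}  {zero}  ne with () ← ne refl
δ-≢ {zero}  {suc n} ne = refl
δ-≢ {suc m} {zero}  ne = refl
δ-≢ {suc m} {suc n} ne = δ-≢ (ne ∘ cong suc)

δ-≡ : ∀ {m n} → m ≡ n → δ m n ≡ 1ℤ
δ-≡ {m} refl = δ-refl m

δ-iff : ∀ {m n m′ n′} → (m ≡ n → m′ ≡ n′) → (m′ ≡ n′ → m ≡ n) → δ m n ≡ δ m′ n′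
δ-iff {m} {n} to from with m ℕ.≟ n
... | yes p = trans (δ-≡ p) (sym (δ-≡ (to p)))
... | no ¬p = trans (δ-≢ ¬p) (sym (δ-≢ (¬p ∘ from)))

δ-*-cong : ∀ {m n x y} → (m ≡ n → x ≡ y) → δ m n ℤ.* x ≡ δ m n ℤ.* y
δ-*-cong {m} {n} {x} {y} h with m ℕ.≟ n
... | yes p = cong (δ m n ℤ.*_) (h p)
... | no ¬p rewrite δ-≢ ¬p = refl

-- Cauchy products of integer sequences and their inverses

module Convolution where
  open import Data.Integer using (_+_; _*_; -_)
  open ℤSolver

  conv : (ℕ → ℤ) → (ℕ → ℤ) → ℕ → ℤ
  conv f g zero    = f 0 * g 0
  conv f g (suc n) = f 0 * g (suc n) + conv (f ∘ suc) g n

  conv-local : ∀ {f f′ g g′} n → (∀ i → i ≤ n → f i ≡ f′ i) → (∀ i → i ≤ n → g i ≡ g′ i) →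
               conv f g n ≡ conv f′ g′ n
  conv-local zero    p q = cong₂ _*_ (p 0 z≤n) (q 0 z≤n)
  conv-local (suc n) p q = cong₂ _+_ (cong₂ _*_ (p 0 z≤n) (q (suc n) ℕP.≤-refl))
    (conv-local n (λ i i≤n → p (suc i) (s≤s i≤n)) (λ i i≤n → q i (ℕP.m≤n⇒m≤1+n i≤n)))

  conv-cong : ∀ {f f′ g g′} → (∀ i → f i ≡ f′ i) → (∀ i → g i ≡ g′ i) → ∀ n → conv f g n ≡ conv f′ g′ n
  conv-cong p q n = conv-local n (λ i _ → p i) (λ i _ → q i)

  conv-sucʳ : ∀ f g n → conv f g (suc n) ≡ conv f (g ∘ suc) n + f (suc n) * g 0
  conv-sucʳ f g zero    = refl
  conv-sucʳ f g (suc n) = trans (cong (_+_ (f 0 * g (suc (suc n)))) (conv-sucʳ (f ∘ suc) g n))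
                                (sym (ℤP.+-assoc (f 0 * g (suc (suc n))) _ _))

  conv-comm : ∀ f g n → conv f g n ≡ conv g f n
  conv-comm f g zero    = ℤP.*-comm (f 0) (g 0)
  conv-comm f g (suc n) = trans (cong₂ _+_ (ℤP.*-comm (f 0) (g (suc n))) (conv-comm (f ∘ suc) g n))
                         (trans (ℤP.+-comm (g (suc n) * f 0) _) (sym (conv-sucʳ g f n)))

  conv-scaleˡ : ∀ a f g n → conv (λ i → a * f i) g n ≡ a * conv f g n
  conv-scaleˡ a f g zero    = ℤP.*-assoc a (f 0) (g 0)
  conv-scaleˡ a f g (suc n) = trans (cong₂ _+_ (ℤP.*-assoc a (f 0) (g (suc n))) (conv-scaleˡ a (f ∘ suc) g n))
                                    (sym (ℤP.*-distribˡ-+ a _ _))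

  conv-distribʳ : ∀ f f′ g n → conv (λ i → f i + f′ i) g n ≡ conv f g n + conv f′ g n
  conv-distribʳ f f′ g zero    = ℤP.*-distribʳ-+ (g 0) (f 0) (f′ 0)
  conv-distribʳ f f′ g (suc n) = trans
    (cong (_+_ ((f 0 + f′ 0) * g (suc n))) (conv-distribʳ (f ∘ suc) (f′ ∘ suc) g n))
    (solve 5 (λ a b c u v → (a :+ b) :* c :+ (u :+ v) := (a :* c :+ u) :+ (b :* c :+ v)) refl
       (f 0) (f′ 0) (g (suc n)) _ _)

  conv-zeroˡ : ∀ g n → conv (λ _ → 0ℤ) g n ≡ 0ℤ
  conv-zeroˡ g zero    = refl
  conv-zeroˡ g (suc n) = trans (ℤP.+-identityˡ _) (conv-zeroˡ g n)

  conv-assoc : ∀ f g h n → conv (conv f g) h n ≡ conv f (conv g h) n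
  conv-assoc f g h zero    = ℤP.*-assoc (f 0) (g 0) (h 0)
  conv-assoc f g h (suc n) = begin
    f 0 * g 0 * h (suc n) + conv (λ i → f 0 * g (suc i) + conv (f ∘ suc) g i) h n
      ≡⟨ cong (_+_ (f 0 * g 0 * h (suc n))) (conv-distribʳ (λ i → f 0 * g (suc i)) (conv (f ∘ suc) g) h n) ⟩
    f 0 * g 0 * h (suc n) + (conv (λ i → f 0 * g (suc i)) h n + conv (conv (f ∘ suc) g) h n)
      ≡⟨ cong₂ (λ u v → f 0 * g 0 * h (suc n) + (u + v)) (conv-scaleˡ (f 0) (g ∘ suc) h n)
           (conv-assoc (f ∘ suc) g h n) ⟩
    f 0 * g 0 * h (suc n) + (f 0 * conv (g ∘ suc) h n + conv (f ∘ suc) (conv g h) n)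
      ≡⟨ solve 5 (λ a b c u v → a :* b :* c :+ (a :* u :+ v) := a :* (b :* c :+ u) :+ v) refl
           (f 0) (g 0) (h (suc n)) _ _ ⟩
    f 0 * (g 0 * h (suc n) + conv (g ∘ suc) h n) + conv (f ∘ suc) (conv g h) n ∎
    where open ≡-Reasoning

  conv-identityˡ : ∀ g n → conv (δ 0) g n ≡ g n
  conv-identityˡ g zero    = ℤP.*-identityˡ (g 0)
  conv-identityˡ g (suc n) = trans (cong₂ _+_ (ℤP.*-identityˡ (g (suc n))) (conv-zeroˡ g n)) (ℤP.+-identityʳ _)

  -- `dotℤ`, `invRev` and `inverse` follow the recursion of `sinv` step by step, so that evaluation
  -- can be pushed through it list entry by list entry.
  dotℤ : (ℕ → ℤ) → ℕ → List ℤ → ℤ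
  dotℤ f k []       = 0ℤ
  dotℤ f k (x ∷ xs) = f k * x + dotℤ f (suc k) xs

  invRev : (ℕ → ℤ) → ℕ → List ℤ
  invRev f zero    = 1ℤ ∷ []
  invRev f (suc n) = - dotℤ f 1 (invRev f n) ∷ invRev f n

  headℤ : List ℤ → ℤ
  headℤ []      = 0ℤ
  headℤ (x ∷ _) = x

  inverse : (ℕ → ℤ) → ℕ → ℤ
  inverse f n = headℤ (invRev f n)

  dotℤ-suc : ∀ f k xs → dotℤ (f ∘ suc) k xs ≡ dotℤ f (suc k) xs
  dotℤ-suc f k []       = refl
  dotℤ-suc f k (x ∷ xs) = cong (_+_ (f (suc k) * x)) (dotℤ-suc f (suc k) xs)

  -- The list `invRev f n` holds the coefficients from degree `n` down to 0 while `dotℤ` runs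
  -- through `h` upwards, which is the pairing of a Cauchy product.
  dotℤ-invRev : ∀ f h n → dotℤ h 0 (invRev f n) ≡ conv h (inverse f) n
  dotℤ-invRev f h zero    = ℤP.+-identityʳ _
  dotℤ-invRev f h (suc n) = cong (_+_ (h 0 * inverse f (suc n)))
    (trans (sym (dotℤ-suc h 0 (invRev f n))) (dotℤ-invRev f (h ∘ suc) n))

  conv-inverse : ∀ f → f 0 ≡ 1ℤ → ∀ n → conv f (inverse f) n ≡ δ 0 n
  conv-inverse f f0 zero    = trans (ℤP.*-identityʳ (f 0)) f0
  conv-inverse f f0 (suc n) = begin
    f 0 * - dotℤ f 1 (invRev f n) + conv (f ∘ suc) (inverse f) n
      ≡⟨ cong₂ (λ u v → u * - v + conv (f ∘ suc) (inverse f) n) f0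
           (trans (sym (dotℤ-suc f 0 (invRev f n))) (dotℤ-invRev f (f ∘ suc) n)) ⟩
    1ℤ * - C + C ≡⟨ solve 1 (λ c → con 1ℤ :* :- c :+ c := con 0ℤ) refl C ⟩
    0ℤ ∎
    where open ≡-Reasoning
          C = conv (f ∘ suc) (inverse f) n

-- The ring of formal power series over ℤ

module PowerSeries where
  open Convolution

  -- Without η, and with operations given by copatterns, ring expressions in
  -- series never unfold during unification.
  record PS : Set where
    no-eta-equality
    field coeff : ℕ → ℤ
  open PS public

  infix 4 _≋_
  record _≋_ (f g : PS) : Set where
    constructor mk≋
    field at : ∀ n → coeff f n ≡ coeff g n
  open _≋_ public

  constₛ : ℤ → PS
  coeff (constₛ a) n = a ℤ.* δ 0 n

  _+ₛ_ _*ₛ_ : PS → PS → PS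
  coeff (f +ₛ g) n = coeff f n ℤ.+ coeff g n
  coeff (f *ₛ g) = conv (coeff f) (coeff g)

  -ₛ_ invₛ : PS → PS
  coeff (-ₛ f) n = ℤ.- coeff f n
  coeff (invₛ f) = inverse (coeff f)

  psRing : CommutativeRing 0ℓ 0ℓ
  psRing = record
    { Carrier = PS ; _≈_ = _≋_ ; _+_ = _+ₛ_ ; _*_ = _*ₛ_ ; -_ = -ₛ_ ; 0# = constₛ 0ℤ ; 1# = constₛ 1ℤ
    ; isCommutativeRing = record
      { isRing = record
        { +-isAbelianGroup = record
          { isGroup = record
            { isMonoid = record
              { isSemigroup = record
                { isMagma = record
                  { isEquivalence = record
                    { refl = mk≋ λ _ → refl
                    ; sym = λ p → mk≋ λ n → sym (at p n)
                    ; trans = λ p q → mk≋ λ n → trans (at p n) (at q n) }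
                  ; ∙-cong = λ p q → mk≋ λ n → cong₂ ℤ._+_ (at p n) (at q n) }
                ; assoc = λ f g h → mk≋ λ n → ℤP.+-assoc (coeff f n) (coeff g n) (coeff h n) }
              ; identity = (λ f → mk≋ λ n → ℤP.+-identityˡ (coeff f n)) , (λ f → mk≋ λ n → ℤP.+-identityʳ (coeff f n)) }
            ; inverse = (λ f → mk≋ λ n → ℤP.+-inverseˡ (coeff f n)) , (λ f → mk≋ λ n → ℤP.+-inverseʳ (coeff f n))
            ; ⁻¹-cong = λ p → mk≋ λ n → cong ℤ.-_ (at p n) }
          ; comm = λ f g → mk≋ λ n → ℤP.+-comm (coeff f n) (coeff g n) }
        ; *-cong = λ p q → mk≋ λ n → conv-cong (at p) (at q) n
        ; *-assoc = λ f g h → mk≋ λ n → conv-assoc (coeff f) (coeff g) (coeff h) n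
        ; *-identity = idˡ , λ f → mk≋ λ n → trans (conv-comm (coeff f) _ n) (at (idˡ f) n)
        ; distrib = (λ f g h → mk≋ λ n → trans (conv-comm (coeff f) _ n)
          (trans (conv-distribʳ (coeff g) (coeff h) (coeff f) n)
                         (cong₂ ℤ._+_ (conv-comm (coeff g) _ n) (conv-comm (coeff h) _ n))))
                  , λ f g h → mk≋ λ n → conv-distribʳ (coeff g) (coeff h) (coeff f) n }
      ; *-comm = λ f g → mk≋ λ n → conv-comm (coeff f) (coeff g) n } }
    where
    idˡ : ∀ f → (constₛ 1ℤ *ₛ f) ≋ f
    idˡ f = mk≋ λ n → trans (conv-cong (λ i → ℤP.*-identityˡ (δ 0 i)) (λ _ → refl) n) (conv-identityˡ (coeff f) n)

  open CommutativeRing psRing public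
    using (_+_; _*_; -_; _-_; 0#; 1#; +-cong; *-cong; -‿cong; setoid; *-assoc; *-comm; +-comm; +-assoc
          ; *-identityˡ; *-identityʳ; +-identityˡ; +-identityʳ; zeroˡ; zeroʳ; distribˡ; distribʳ; *-congˡ; *-congʳ;
            +-congˡ; +-congʳ; -‿inverseʳ)
    renaming (refl to ≋-refl; sym to ≋-sym; trans to ≋-trans; reflexive to ≋-reflexive)

  constₛ-+ : ∀ a b → constₛ (a ℤ.+ b) ≋ constₛ a + constₛ b
  constₛ-+ a b = mk≋ λ n → ℤP.*-distribʳ-+ (δ 0 n) a b

  constₛ-* : ∀ a b → constₛ (a ℤ.* b) ≋ constₛ a * constₛ b
  constₛ-* a b = mk≋ λ n → sym (trans (conv-scaleˡ a (δ 0) _ n)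
    (trans (cong (a ℤ.*_) (conv-identityˡ _ n)) (sym (ℤP.*-assoc a b (δ 0 n)))))

  constₛ-neg : ∀ a → constₛ (ℤ.- a) ≋ - constₛ a
  constₛ-neg a = mk≋ λ n → sym (ℤP.neg-distribˡ-* a (δ 0 n))

  const-hom : CommutativeRing.rawRing ℤP.+-*-commutativeRing -Raw-AlmostCommutative⟶ fromCommutativeRing psRing
  const-hom = record
    { ⟦_⟧ = constₛ ; +-homo = constₛ-+ ; *-homo = constₛ-* ; -‿homo = constₛ-neg ; 0-homo = ≋-refl ; 1-homo = ≋-refl }

  constₛ-≟ : ∀ a b → Maybe (constₛ a ≋ constₛ b)
  constₛ-≟ a b with a ℤ.≟ b
  ... | yes refl = just ≋-refl
  ... | no _     = nothing

  module PSSolver = Algebra.Solver.Ring (CommutativeRing.rawRing ℤP.+-*-commutativeRing) (fromCommutativeRing psRing)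
                                        const-hom constₛ-≟

-- Finite sums

module FiniteSum (R : CommutativeRing 0ℓ 0ℓ) where
  open CommutativeRing R renaming (refl to ≈-refl; sym to ≈-sym; trans to ≈-trans)
  open import Algebra.Properties.CommutativeSemigroup (CommutativeRing.+-commutativeSemigroup R) using (interchange)

  ∑ : ℕ → (ℕ → Carrier) → Carrier
  ∑ zero    f = 0#
  ∑ (suc K) f = ∑ K f + f K

  ∑-cong-< : ∀ K {f g} → (∀ i → i < K → f i ≈ g i) → ∑ K f ≈ ∑ K g
  ∑-cong-< zero    p = ≈-refl
  ∑-cong-< (suc K) p = +-cong (∑-cong-< K (λ i i<K → p i (ℕP.m≤n⇒m≤1+n i<K))) (p K ℕP.≤-refl)

  ∑-cong : ∀ K {f g} → (∀ i → f i ≈ g i) → ∑ K f ≈ ∑ K g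
  ∑-cong K p = ∑-cong-< K (λ i _ → p i)

  ∑-zero : ∀ K {f} → (∀ i → i < K → f i ≈ 0#) → ∑ K f ≈ 0#
  ∑-zero zero    p = ≈-refl
  ∑-zero (suc K) p = ≈-trans (+-cong (∑-zero K (λ i i<K → p i (ℕP.m≤n⇒m≤1+n i<K))) (p K ℕP.≤-refl)) (+-identityˡ 0#)

  ∑-distrib-+ : ∀ K f g → ∑ K (λ i → f i + g i) ≈ ∑ K f + ∑ K g
  ∑-distrib-+ zero    f g = ≈-sym (+-identityˡ 0#)
  ∑-distrib-+ (suc K) f g = ≈-trans (+-congʳ (∑-distrib-+ K f g)) (interchange _ _ _ _)

  *-distribˡ-∑ : ∀ K a f → a * ∑ K f ≈ ∑ K (λ i → a * f i)
  *-distribˡ-∑ zero    a f = zeroʳ a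
  *-distribˡ-∑ (suc K) a f = ≈-trans (distribˡ a _ _) (+-congʳ (*-distribˡ-∑ K a f))

  *-distribʳ-∑ : ∀ K a f → ∑ K f * a ≈ ∑ K (λ i → f i * a)
  *-distribʳ-∑ K a f = ≈-trans (*-comm _ a) (≈-trans (*-distribˡ-∑ K a f) (∑-cong K (λ i → *-comm a (f i))))

  ∑-swap : ∀ K L (f : ℕ → ℕ → Carrier) → ∑ K (λ i → ∑ L (f i)) ≈ ∑ L (λ j → ∑ K (λ i → f i j))
  ∑-swap zero    L f = ≈-sym (∑-zero L (λ _ _ → ≈-refl))
  ∑-swap (suc K) L f = ≈-trans (+-congʳ (∑-swap K L f)) (≈-sym (∑-distrib-+ L (λ j → ∑ K (λ i → f i j)) (f K)))

  ∑-concat : ∀ K L f → ∑ (L ℕ.+ K) f ≈ ∑ K f + ∑ L (λ i → f (i ℕ.+ K))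
  ∑-concat K zero    f = ≈-sym (+-identityʳ _)
  ∑-concat K (suc L) f = ≈-trans (+-congʳ (∑-concat K L f)) (+-assoc _ _ _)

  ∑-head : ∀ K f → ∑ (suc K) f ≈ f 0 + ∑ K (f ∘ suc)
  ∑-head zero    f = +-comm 0# (f 0)
  ∑-head (suc K) f = ≈-trans (+-congʳ (∑-head K f)) (+-assoc _ _ _)

  ∑-extend : ∀ {K K′ f} → K ≤ K′ → (∀ i → K ≤ i → f i ≈ 0#) → ∑ K′ f ≈ ∑ K f
  ∑-extend {K} {K′} {f} K≤K′ p with ℕP.m≤n⇒∃[o]m+o≡n K≤K′
  ... | L , refl rewrite ℕP.+-comm K L =
    ≈-trans (∑-concat K L f) (≈-trans (+-congˡ (∑-zero L (λ i _ → p (i ℕ.+ K) (ℕP.m≤n+m K i)))) (+-identityʳ _))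

  -- The range is cut into blocks of length `suc p`; in each block only the first index is a
  -- multiple.
  ∑-multiples : ∀ K p f → (∀ i → suc p ∤ i → f i ≈ 0#) → ∑ (K ℕ.* suc p) f ≈ ∑ K (λ i → f (i ℕ.* suc p))
  ∑-multiples zero    p f h = ≈-refl
  ∑-multiples (suc K) p f h = ≈-trans (∑-concat (K ℕ.* suc p) (suc p) f) (+-cong (∑-multiples K p f h)
    (≈-trans (∑-head p _) (≈-trans (+-congˡ (∑-zero p (λ i i<p → h _ (nd i i<p)))) (+-identityʳ _))))
    where
    nd : ∀ i → i < p → suc p ∤ suc i ℕ.+ K ℕ.* suc p
    nd i i<p d = ℕP.<⇒≱ (s≤s i<p) (∣⇒≤ (∣m+n∣m⇒∣n (subst (suc p ∣_) (ℕP.+-comm (suc i) (K ℕ.* suc p)) d) (n∣m*n K)))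

-- Congruence of series modulo a power of t

module Truncation where
  open Convolution
  open PowerSeries

  infix 4 _≋[_]_
  record _≋[_]_ (f : PS) (N : ℕ) (g : PS) : Set where
    constructor mk
    field agree : ∀ n → n ≤ N → coeff f n ≡ coeff g n
  open _≋[_]_ public

  full : ∀ {f g N} → f ≋ g → f ≋[ N ] g
  full p = mk λ n _ → at p n

  tr-refl : ∀ {f N} → f ≋[ N ] f
  tr-refl = mk λ _ _ → refl
  tr-sym : ∀ {f g N} → f ≋[ N ] g → g ≋[ N ] f
  tr-sym p = mk λ n n≤N → sym (agree p n n≤N)
  tr-trans : ∀ {f g h N} → f ≋[ N ] g → g ≋[ N ] h → f ≋[ N ] h
  tr-trans p q = mk λ n n≤N → trans (agree p n n≤N) (agree q n n≤N)
  tr-weaken : ∀ {f g M N} → M ≤ N → f ≋[ N ] g → f ≋[ M ] g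
  tr-weaken M≤N p = mk λ n n≤M → agree p n (ℕP.≤-trans n≤M M≤N)
  tr-+ : ∀ {f f′ g g′ N} → f ≋[ N ] f′ → g ≋[ N ] g′ → f + g ≋[ N ] f′ + g′
  tr-+ p q = mk λ n n≤N → cong₂ ℤ._+_ (agree p n n≤N) (agree q n n≤N)
  tr-neg : ∀ {f f′ N} → f ≋[ N ] f′ → - f ≋[ N ] - f′
  tr-neg p = mk λ n n≤N → cong ℤ.-_ (agree p n n≤N)
  tr-* : ∀ {f f′ g g′ N} → f ≋[ N ] f′ → g ≋[ N ] g′ → f * g ≋[ N ] f′ * g′
  tr-* p q = mk λ n n≤N → conv-local n (λ i i≤n → agree p i (ℕP.≤-trans i≤n n≤N))
    (λ i i≤n → agree q i (ℕP.≤-trans i≤n n≤N))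

  open FiniteSum psRing
  tr-∑ : ∀ K {f g N} → (∀ i → i < K → f i ≋[ N ] g i) → ∑ K f ≋[ N ] ∑ K g
  tr-∑ zero    p = tr-refl
  tr-∑ (suc K) p = tr-+ (tr-∑ K (λ i i<K → p i (ℕP.m≤n⇒m≤1+n i<K))) (p K ℕP.≤-refl)

  mono : ℕ → PS
  coeff (mono m) = δ m

  mono-0 : mono 0 ≋ 1#
  mono-0 = mk≋ λ n → sym (ℤP.*-identityˡ _)

  mono-+ : ∀ m n → mono (m ℕ.+ n) ≋ mono m * mono n
  mono-+ m n = mk≋ (sym ∘ go m)
    where
    go : ∀ m i → conv (δ m) (δ n) i ≡ δ (m ℕ.+ n) i
    go zero    i       = conv-identityˡ (δ n) i
    go (suc m) zero    = refl
    go (suc m) (suc i) = trans (ℤP.+-identityˡ _) (go m i)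

  -- A factor t^m raises the accuracy by `m`. This allows a weight that is 1 only up to degree N - j
  -- to be dropped next to a power t^m with m ≥ j.
  tr-mono* : ∀ m {f g d N} → f ≋[ d ] g → N ≤ m ℕ.+ d → mono m * f ≋[ N ] mono m * g
  tr-mono* m {f} {g} {d} p N≤ = mk λ n n≤N → go m n (ℕP.≤-trans n≤N N≤)
    where
    go : ∀ m n → n ≤ m ℕ.+ d → conv (δ m) (coeff f) n ≡ conv (δ m) (coeff g) n
    go zero    n       n≤ = trans (conv-identityˡ _ n) (trans (agree p n n≤) (sym (conv-identityˡ _ n)))
    go (suc m) zero    _        = refl
    go (suc m) (suc n) (s≤s n≤) = cong (ℤ._+_ 0ℤ) (go m n n≤)

  tr-mono-0 : ∀ {m N} → N < m → mono m ≋[ N ] 0#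
  tr-mono-0 {m} N<m = mk λ n n≤N → trans (δ-≢ {m} {n} (λ { refl → ℕP.<⇒≱ N<m n≤N })) (sym (ℤP.*-zeroˡ (δ 0 n)))

  coeff-∑ : ∀ K f n → coeff (∑ K f) n ≡ FiniteSum.∑ ℤP.+-*-commutativeRing K (λ i → coeff (f i) n)
  coeff-∑ zero    f n = ℤP.*-zeroˡ (δ 0 n)
  coeff-∑ (suc K) f n = cong (ℤ._+ coeff (f K) n) (coeff-∑ K f n)

  coeff-const* : ∀ a f n → coeff (constₛ a * f) n ≡ a ℤ.* coeff f n
  coeff-const* a f n = trans (conv-scaleˡ a (δ 0) (coeff f) n) (cong (a ℤ.*_) (conv-identityˡ (coeff f) n))

  UnitConst : PS → Set
  UnitConst f = coeff f 0 ≡ 1ℤ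

  *-invₛ : ∀ f → UnitConst f → f * invₛ f ≋ 1#
  *-invₛ f f0 = mk≋ λ n → trans (conv-inverse (coeff f) f0 n) (sym (ℤP.*-identityˡ (δ 0 n)))

  UnitConst-* : ∀ f g → UnitConst f → UnitConst g → UnitConst (f * g)
  UnitConst-* _ _ p q = cong₂ ℤ._*_ p q

  *-cancelˡ : ∀ u {f g} → UnitConst u → u * f ≋ u * g → f ≋ g
  *-cancelˡ u {f} {g} u0 p = ≋-trans (≋-sym (lem f)) (≋-trans (*-congˡ {invₛ u} p) (lem g))
    where
    open PSSolver
    lem : ∀ f → invₛ u * (u * f) ≋ f
    lem f = ≋-trans (solve 3 (λ v u f → v :* (u :* f) := (u :* v) :* f) ≋-refl (invₛ u) u f)
              (≋-trans (*-congʳ (*-invₛ u u0)) (*-identityˡ f))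

  ∏ : ℕ → (ℕ → PS) → PS
  ∏ zero    f = 1#
  ∏ (suc m) f = ∏ m f * f (suc m)

  ∏-unit : ∀ m f → (∀ i → UnitConst (f (suc i))) → UnitConst (∏ m f)
  ∏-unit zero    f u = refl
  ∏-unit (suc m) f u = UnitConst-* (∏ m f) (f (suc m)) (∏-unit m f u) (u m)

sgn : ℕ → ℤ
sgn zero    = 1ℤ
sgn (suc n) = ℤ.- sgn n

tri : ℕ → ℕ
tri zero    = 0
tri (suc n) = suc n ℕ.+ tri n

n≤n*n : ∀ n → n ≤ n ℕ.* n
n≤n*n zero    = z≤n
n≤n*n (suc n) = ℕP.m≤m+n (suc n) (n ℕ.* suc n)

square-suc : ∀ n → suc n ℕ.* suc n ≡ n ℕ.* n ℕ.+ n ℕ.+ suc n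
square-suc = solve 1 (λ n → (con 1 :+ n) :* (con 1 :+ n) := n :* n :+ n :+ (con 1 :+ n)) refl
  where open ℕSolver

-- Two finite identities by telescoping

module TelescopingIdentities where
  open PowerSeries
  open Truncation
  open FiniteSum psRing
  open PSSolver
  open Relation.Binary.Reasoning.Setoid setoid

  :1 : ∀ {n} → Polynomial n
  :1 = con 1ℤ

  -- `q m` stands for the m-th power of a series without constant term. It is kept abstract so that
  -- both t and t² can be put in.
  module FiniteIdentities
    (q : ℕ → PS) (q-0 : q 0 ≋ 1#) (q-+ : ∀ m n → q (m ℕ.+ n) ≋ q m * q n) (q-const : ∀ m → coeff (q (suc m)) 0 ≡ 0ℤ)
    where

    s : ℕ → PS
    s zero    = 1#
    s (suc n) = - s n

    ε : ℕ → PS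
    ε zero    = 1#
    ε (suc _) = 1# + 1#

    unit-1-q : ∀ m → UnitConst (1# - q (suc m))
    unit-1-q m rewrite q-const m = refl

    poch : ℕ → PS
    poch zero    = 1#
    poch (suc m) = poch m * (1# - q (suc m))

    poch-unit : ∀ m → UnitConst (poch m)
    poch-unit zero    = refl
    poch-unit (suc m) = UnitConst-* (poch m) (1# - q (suc m)) (poch-unit m) (unit-1-q m)

    ipoch : ℕ → PS
    ipoch m = invₛ (poch m)

    ipoch-suc : ∀ m → ipoch m ≋ (1# - q (suc m)) * ipoch (suc m)
    ipoch-suc m = *-cancelˡ (poch m) (poch-unit m) (begin
      poch m * ipoch m ≈⟨ *-invₛ (poch m) (poch-unit m) ⟩
      1# ≈⟨ ≋-sym (*-invₛ (poch (suc m)) (poch-unit (suc m))) ⟩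
      poch m * (1# - q (suc m)) * ipoch (suc m) ≈⟨ *-assoc (poch m) _ _ ⟩
      poch m * ((1# - q (suc m)) * ipoch (suc m)) ∎)

    -- The weight 1/((q)_{M-j} (q)_{M+j}) with M = d + j.
    b : ℕ → ℕ → PS
    b d j = ipoch d * ipoch (d ℕ.+ j ℕ.+ j)

    -- Compares M with M + 1 for fixed `j`: both M - j and M + j grow by one.
    b-suc : ∀ d j → b d j ≋ (1# - q (suc d)) * ((1# - q (suc d ℕ.+ j ℕ.+ j)) * b (suc d) j)
    b-suc d j = begin
      ipoch d * ipoch (d ℕ.+ j ℕ.+ j) ≈⟨ *-cong (ipoch-suc d) (ipoch-suc (d ℕ.+ j ℕ.+ j)) ⟩
      (1# - q (suc d)) * ipoch (suc d) * ((1# - q (suc d ℕ.+ j ℕ.+ j)) * ipoch (suc d ℕ.+ j ℕ.+ j))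
        ≈⟨ solve 4 (λ a b c d → a :* b :* (c :* d) := a :* (c :* (b :* d))) ≋-refl _ _ _ _ ⟩
      (1# - q (suc d)) * ((1# - q (suc d ℕ.+ j ℕ.+ j)) * b (suc d) j) ∎

    b-suc-0 : ∀ d → b d 0 ≋ (1# - q (suc d)) * ((1# - q (suc d)) * b (suc d) 0)
    b-suc-0 d = ≋-trans (b-suc d 0) (*-congˡ (*-congʳ (+-congˡ
      (-‿cong (≋-reflexive (cong q (trans (ℕP.+-identityʳ _) (ℕP.+-identityʳ _))))))))

    -- Both weights belong to M = d + j + 1 and are neighbours in `j`, so each of the two Pochhammer
    -- products changes by a single factor.
    b-shift : ∀ d j → (1# - q (suc d)) * b (suc d) j ≋ (1# - q (d ℕ.+ suc j ℕ.+ suc j)) * b d (suc j)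
    b-shift d j = begin
      (1# - q (suc d)) * (ipoch (suc d) * ipoch (suc d ℕ.+ j ℕ.+ j)) ≈⟨ ≋-sym (*-assoc _ _ _) ⟩
      (1# - q (suc d)) * ipoch (suc d) * ipoch (suc d ℕ.+ j ℕ.+ j) ≈⟨ *-congʳ (≋-sym (ipoch-suc d)) ⟩
      ipoch d * ipoch (suc d ℕ.+ j ℕ.+ j) ≈⟨ *-congˡ (ipoch-suc _) ⟩
      ipoch d * ((1# - q (suc (suc d ℕ.+ j ℕ.+ j))) * ipoch (suc (suc d ℕ.+ j ℕ.+ j)))
        ≈⟨ solve 3 (λ a b c → a :* (b :* c) := b :* (a :* c)) ≋-refl _ _ _ ⟩
      (1# - q (suc (suc d ℕ.+ j ℕ.+ j))) * (ipoch d * ipoch (suc (suc d ℕ.+ j ℕ.+ j)))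
        ≡⟨ cong (λ n → (1# - q n) * (ipoch d * ipoch n)) (index d j) ⟩
      (1# - q (d ℕ.+ suc j ℕ.+ suc j)) * b d (suc j) ∎
      where
      index : ∀ d j → suc (suc d ℕ.+ j ℕ.+ j) ≡ d ℕ.+ suc j ℕ.+ suc j
      index d j = sym (trans (ℕP.+-suc (d ℕ.+ suc j) j) (cong (λ n → suc (n ℕ.+ j)) (ℕP.+-suc d j)))

    -- The terms of index j and -j of the two-sided sum agree; `ε j` counts them together.
    X-term : ℕ → PS
    X-term j = ε j * s j * q (j ℕ.* j)

    X : ℕ → PS
    X M = ∑ (suc M) (λ j → X-term j * b (M ∸ j) j)

    q-2 : ∀ {m} a b → m ≡ a ℕ.+ b → q m ≋ q a * q b
    q-2 a b refl = q-+ a b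

    q-py : ∀ d j → q (suc (d ℕ.+ j)) ≋ q (suc d) * q j
    q-py d j = q-+ (suc d) j

    q-pyy : ∀ d j → q (suc d ℕ.+ j ℕ.+ j) ≋ q (suc d) * q j * q j
    q-pyy d j = ≋-trans (q-+ (suc d ℕ.+ j) j) (*-congʳ (q-+ (suc d) j))

    private
      two : PS
      two = 1# + 1#

    -- ∑_{j≤K} X-term j ((1 - q^{2M}) b(M,j) - b(M-1,j)) telescopes.
    X-partial : ∀ {m} d K → m ≡ d ℕ.+ K → let Q = q (suc m) in
      ∑ (suc K) (λ j → (1# - Q * Q) * (X-term j * b (suc m ∸ j) j) - X-term j * b (m ∸ j) j)
      ≋ two * (s K * q (K ℕ.* K ℕ.+ K) * Q * ((1# - q (suc d)) * b (suc d) K))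
    X-partial d zero e with refl ← trans e (ℕP.+-identityʳ d) = begin
      0# + ((1# - Q * Q) * (1# * 1# * q 0 * b (suc d) 0) - 1# * 1# * q 0 * b d 0)
        ≈⟨ +-congˡ (+-cong (*-congˡ (*-congʳ (*-congˡ q-0))) (-‿cong (*-cong (*-congˡ q-0) (b-suc-0 d)))) ⟩
      0# + ((1# - Q * Q) * (1# * 1# * 1# * b (suc d) 0) - 1# * 1# * 1# * ((1# - Q) * ((1# - Q) * b (suc d) 0)))
        ≈⟨ solve 2 (λ Q B → con 0ℤ :+ ((:1 :- Q :* Q) :* (:1 :* :1 :* :1 :* B) :- :1 :* :1 :* :1 :*
             ((:1 :- Q) :* ((:1 :- Q) :* B)))
              := (:1 :+ :1) :* (:1 :* :1 :* Q :* ((:1 :- Q) :* B))) ≋-refl Q (b (suc d) 0) ⟩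
      two * (1# * 1# * Q * ((1# - Q) * b (suc d) 0)) ≈⟨ *-congˡ (*-congʳ (*-congʳ (*-congˡ (≋-sym q-0)))) ⟩
      two * (1# * q 0 * Q * ((1# - Q) * b (suc d) 0)) ∎
      where
      Q = q (suc d)
    X-partial d (suc K) refl = begin
      ∑ (suc K) (λ j → (1# - Q * Q) * (X-term j * b (suc (d ℕ.+ suc K) ∸ j) j) - X-term j * b (d ℕ.+ suc K ∸ j) j) +
        last
        ≈⟨ +-cong ih last-eq ⟩
      two * (s K * W * (p * y) * ((1# - p * y * y) * B))
        + ((1# - (p * y) * (p * y)) * (two * (- s K) * (W * y) * B) - two * (- s K) * (W * y) *
          ((1# - p) * ((1# - p * y * y) * B)))
        ≈⟨ solve 5 (λ s W p y B → (:1 :+ :1) :* (s :* W :* (p :* y) :* ((:1 :- p :* y :* y) :* B))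
                :+ ((:1 :- (p :* y) :* (p :* y)) :* ((:1 :+ :1) :* (:- s) :* (W :* y) :* B) :- (:1 :+ :1) :* (:- s) :*
                  (W :* y) :* ((:1 :- p) :* ((:1 :- p :* y :* y) :* B)))
                := (:1 :+ :1) :* ((:- s) :* (W :* y :* y) :* (p :* y) :* ((:1 :- p) :* B))) ≋-refl (s K) W p y B ⟩
      two * ((- s K) * (W * y * y) * (p * y) * ((1# - p) * B))
        ≈⟨ *-congˡ (*-congʳ (*-cong (*-congˡ (≋-sym W″)) (≋-sym Q-eq))) ⟩
      two * (- s K * q (suc K ℕ.* suc K ℕ.+ suc K) * Q * ((1# - q (suc d)) * b (suc d) (suc K))) ∎
      where
      p = q (suc d)
      y = q (suc K)
      Q = q (suc (d ℕ.+ suc K))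
      W = q (K ℕ.* K ℕ.+ K)
      B = b (suc d) (suc K)
      last = (1# - Q * Q) * (X-term (suc K) * b (suc (d ℕ.+ suc K) ∸ suc K) (suc K)) - X-term (suc K) * b
        (d ℕ.+ suc K ∸ suc K) (suc K)
      Q-eq : Q ≋ p * y
      Q-eq = q-py d (suc K)
      W′ : q (suc K ℕ.* suc K) ≋ W * y
      W′ = q-2 (K ℕ.* K ℕ.+ K) (suc K) (square-suc K)
      W″ : q (suc K ℕ.* suc K ℕ.+ suc K) ≋ W * y * y
      W″ = ≋-trans (q-+ (suc K ℕ.* suc K) (suc K)) (*-congʳ W′)
      -- The closed form for K ends in the weight of index K; `b-shift` rewrites it by the weight
      -- `B` of index K + 1, so that everything becomes a multiple of `B`.
      ih : ∑ (suc K) (λ j → (1# - Q * Q) * (X-term j * b (suc (d ℕ.+ suc K) ∸ j) j) - X-term j * b (d ℕ.+ suc K ∸ j) j)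
           ≋ two * (s K * W * (p * y) * ((1# - p * y * y) * B))
      ih = ≋-trans (X-partial (suc d) K (ℕP.+-suc d K))
           (*-congˡ (*-cong (*-congˡ Q-eq) (≋-trans (b-shift (suc d) K)
             (*-congʳ (+-congˡ (-‿cong (q-pyy d (suc K))))))))
      last-eq : last ≋ (1# - (p * y) * (p * y)) * (two * (- s K) * (W * y) * B) - two * (- s K) * (W * y) *
        ((1# - p) * ((1# - p * y * y) * B))
      last-eq rewrite ℕP.m+n∸n≡m (suc d) (suc K) | ℕP.m+n∸n≡m d (suc K) =
        +-cong (*-cong (+-congˡ (-‿cong (*-cong Q-eq Q-eq))) (*-congʳ (*-congˡ W′)))
               (-‿cong (*-cong (*-congˡ W′) (≋-trans (b-suc d (suc K))
                 (*-congˡ (*-congʳ (+-congˡ (-‿cong (q-pyy d (suc K)))))))))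

    -- The sum for M = m + 1 has one summand more than the sum for m. That extra summand is `l`, and
    -- the hypothesis says that it cancels what telescoping leaves of the others.
    step : ∀ K D f g l → ∑ K (λ j → D * f j - g j) + D * l ≋ 0# → D * (∑ K f + l) ≋ ∑ K g
    step K D f g l h = begin
      D * (∑ K f + l) ≈⟨ solve 4 (λ D F G l → D :* (F :+ l) := (D :* F :- G) :+ D :* l :+ G) ≋-refl D (∑ K f) (∑ K g)
        l ⟩
      (D * ∑ K f - ∑ K g) + D * l + ∑ K g ≈⟨ +-congʳ (+-congʳ (≋-sym (sub K))) ⟩
      ∑ K (λ j → D * f j - g j) + D * l + ∑ K g ≈⟨ +-congʳ h ⟩
      0# + ∑ K g ≈⟨ +-identityˡ _ ⟩
      ∑ K g ∎
      where
      sub : ∀ K → ∑ K (λ j → D * f j - g j) ≋ D * ∑ K f - ∑ K g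
      sub zero    = solve 1 (λ D → con 0ℤ := D :* con 0ℤ :- con 0ℤ) ≋-refl D
      sub (suc K) = ≋-trans (+-congʳ (sub K))
        (solve 5 (λ D F G f g → (D :* F :- G) :+ (D :* f :- g) := D :* (F :+ f) :- (G :+ g)) ≋-refl D _ _ _ _)

    X-step : ∀ m → let Q = q (suc m) in (1# - Q * Q) * X (suc m) ≋ X m
    X-step m = step (suc m) (1# - Q * Q) (λ j → X-term j * b (suc m ∸ j) j) (λ j → X-term j * b (m ∸ j) j) _ (begin
      ∑ (suc m) (λ j → (1# - Q * Q) * (X-term j * b (suc m ∸ j) j) - X-term j * b (m ∸ j) j)
        + (1# - Q * Q) * (two * (- s m) * q (suc m ℕ.* suc m) * b (m ∸ m) (suc m))
        -- At K = m the closed form has d = 0, and `b-shift` produces 1 - q^(2M), the very factor in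
        -- front of the new summand; the signs are opposite.
        ≈⟨ +-cong (≋-trans (X-partial 0 m refl) (*-congˡ
             (*-congˡ (≋-trans (b-shift 0 m) (*-congʳ (+-congˡ (-‿cong (q-+ (suc m) (suc m)))))))))
                  (*-congˡ (*-cong (*-congˡ W′) (≋-reflexive (cong (λ d → b d (suc m)) (ℕP.n∸n≡0 m))))) ⟩
      two * (s m * W * Q * ((1# - Q * Q) * B)) + (1# - Q * Q) * (two * (- s m) * (W * Q) * B)
        ≈⟨ solve 4 (λ s W Q B → (:1 :+ :1) :* (s :* W :* Q :* ((:1 :- Q :* Q) :* B)) :+ (:1 :- Q :* Q) :*
             ((:1 :+ :1) :* (:- s) :* (W :* Q) :* B) := con 0ℤ)
             ≋-refl (s m) W Q B ⟩
      0# ∎)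
      where
      Q = q (suc m)
      W = q (m ℕ.* m ℕ.+ m)
      B = b 0 (suc m)
      W′ : q (suc m ℕ.* suc m) ≋ W * Q
      W′ = q-2 (m ℕ.* m ℕ.+ m) (suc m) (square-suc m)

    one-inv : invₛ 1# ≋ 1#
    one-inv = ≋-trans (≋-sym (*-identityˡ _)) (*-invₛ 1# refl)

    b-00 : b 0 0 ≋ 1#
    b-00 = ≋-trans (*-cong one-inv one-inv) (*-identityˡ 1#)

    unwind : (Z D : ℕ → PS) → Z 0 ≋ 1# → (∀ m → D (suc m) * Z (suc m) ≋ Z m) → ∀ m → ∏ m D * Z m ≋ 1#
    unwind Z D z0 h zero    = ≋-trans (*-identityˡ _) z0
    unwind Z D z0 h (suc m) = ≋-trans (*-assoc _ _ _) (≋-trans (*-congˡ (h m)) (unwind Z D z0 h m))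

    -- After multiplication by (q)_m² this is the finite form of Gauss's identity ∑ (-1)ʲ q^(j²) = ∏
    -- (1 - qⁱ)/(1 + qⁱ).
    X-product : ∀ m → ∏ m (λ i → 1# - q i * q i) * X m ≋ 1#
    X-product = unwind X (λ i → 1# - q i * q i)
      (≋-trans (+-identityˡ _) (≋-trans (*-cong (≋-trans (*-congʳ (*-identityˡ 1#)) (≋-trans (*-identityˡ _) q-0))
        b-00) (*-identityˡ 1#))) X-step

    module Appell (c : PS) where
      D : ℕ → PS
      D j = 1# - c * q j + q j * q j

      D-unit : ∀ i → UnitConst (D (suc i))
      D-unit i rewrite q-const i | ℤP.*-zeroʳ (coeff c 0) = refl

      D-inv : ∀ i → D (suc i) * invₛ (D (suc i)) ≋ 1#
      D-inv i = *-invₛ (D (suc i)) (D-unit i)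

      -- The terms of the partial fraction expansion of ∏ (1 - qⁱ)²/(1 - c qⁱ + q²ⁱ). For c = x +
      -- x⁻¹ the factor `two - c` is (1 - x)(1 - x⁻¹).
      Y-term : ℕ → PS
      Y-term zero    = 1#
      Y-term (suc j) = (two - c) * (s (suc j) * q (tri (suc j)) * ((1# + q (suc j)) * invₛ (D (suc j))))

      Y : ℕ → PS
      Y M = ∑ (suc M) (λ j → Y-term j * b (M ∸ j) j)

      -- Multiplied by 1 - q^M, the partial sums of Y-term j (D_M b(M,j) - b(M-1,j)) telescope.
      Y-partial : ∀ {m} d K → m ≡ d ℕ.+ K → let Q = q (suc m) in
        (1# - Q) * ∑ (suc K) (λ j → D (suc m) * (Y-term j * b (suc m ∸ j) j) - Y-term j * b (m ∸ j) j)
        ≋ (two - c) * (Q * s K * q (tri K) * ((1# - q (suc d)) * b (suc d) K))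
      Y-partial d zero e with refl ← trans e (ℕP.+-identityʳ d) = begin
        (1# - Q) * (0# + (D (suc d) * (1# * b (suc d) 0) - 1# * b d 0))
          ≈⟨ *-congˡ (+-congˡ (+-congˡ (-‿cong (*-congˡ (b-suc-0 d))))) ⟩
        (1# - Q) * (0# + (D (suc d) * (1# * b (suc d) 0) - 1# * ((1# - Q) * ((1# - Q) * b (suc d) 0))))
          ≈⟨ solve 3 (λ c Q B → (:1 :- Q) :* (con 0ℤ :+
               ((:1 :- c :* Q :+ Q :* Q) :* (:1 :* B) :- :1 :* ((:1 :- Q) :* ((:1 :- Q) :* B))))
               := (:1 :+ :1 :- c) :* (Q :* :1 :* :1 :* ((:1 :- Q) :* B))) ≋-refl c Q (b (suc d) 0) ⟩
        (two - c) * (Q * 1# * 1# * ((1# - Q) * b (suc d) 0)) ≈⟨ *-congˡ (*-congʳ (*-congˡ (≋-sym q-0))) ⟩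
        (two - c) * (Q * 1# * q 0 * ((1# - Q) * b (suc d) 0)) ∎
        where
        Q = q (suc d)
      Y-partial d (suc K) refl = begin
        (1# - Q) * (∑ (suc K) (λ j → D (suc (d ℕ.+ suc K)) * (Y-term j * b (suc (d ℕ.+ suc K) ∸ j) j) - Y-term j * b
          (d ℕ.+ suc K ∸ j) j) + last)
          ≈⟨ ≋-trans (distribˡ _ _ _) (+-cong ih (*-cong (+-congˡ (-‿cong Q-eq)) last-eq)) ⟩
        (two - c) * (p * y * s K * W * ((1# - p * y * y) * B)) + (1# - p * y) *
          ((two - c) * (- s K) * (y * W) * (1# + y) * p * B)
          ≈⟨ solve 6 (λ c s W p y B → (:1 :+ :1 :- c) :* (p :* y :* s :* W :* ((:1 :- p :* y :* y) :* B))
               :+ (:1 :- p :* y) :* ((:1 :+ :1 :- c) :* (:- s) :* (y :* W) :* (:1 :+ y) :* p :* B)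
               := (:1 :+ :1 :- c) :* (p :* y :* (:- s) :* (y :* W) :* ((:1 :- p) :* B))) ≋-refl c (s K) W p y B ⟩
        (two - c) * (p * y * (- s K) * (y * W) * ((1# - p) * B))
          ≈⟨ *-congˡ (*-congʳ (*-cong (*-congʳ (≋-sym Q-eq)) (≋-sym (q-+ (suc K) (tri K))))) ⟩
        (two - c) * (Q * s (suc K) * q (tri (suc K)) * ((1# - q (suc d)) * b (suc d) (suc K))) ∎
        where
        p = q (suc d)
        y = q (suc K)
        Q = q (suc (d ℕ.+ suc K))
        W = q (tri K)
        B = b (suc d) (suc K)
        I = invₛ (D (suc K))
        last = D (suc (d ℕ.+ suc K)) * (Y-term (suc K) * b (suc (d ℕ.+ suc K) ∸ suc K) (suc K)) - Y-term (suc K) * b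
          (d ℕ.+ suc K ∸ suc K) (suc K)
        Q-eq : Q ≋ p * y
        Q-eq = q-py d (suc K)
        ih : (1# - Q) * ∑ (suc K) (λ j → D (suc (d ℕ.+ suc K)) * (Y-term j * b (suc (d ℕ.+ suc K) ∸ j) j) - Y-term j *
          b (d ℕ.+ suc K ∸ j) j)
             ≋ (two - c) * (p * y * s K * W * ((1# - p * y * y) * B))
        ih = ≋-trans (Y-partial (suc d) K (ℕP.+-suc d K))
             (*-congˡ (*-cong (*-congʳ (*-congʳ Q-eq)) (≋-trans (b-shift (suc d) K)
               (*-congʳ (+-congˡ (-‿cong (q-pyy d (suc K))))))))
        -- D_M - (1 - p)(1 - p y²) = p D_{K+1} cancels the inverse in Y-term.
        last-eq : last ≋ (two - c) * (- s K) * (y * W) * (1# + y) * p * B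
        last-eq rewrite ℕP.m+n∸n≡m (suc d) (suc K) | ℕP.m+n∸n≡m d (suc K) = begin
          (1# - c * Q + Q * Q) * ((two - c) * (- s K * q (tri (suc K)) * ((1# + y) * I)) * B) - (two - c) *
            (- s K * q (tri (suc K)) * ((1# + y) * I)) * b d (suc K)
            ≈⟨ +-cong (*-cong (+-cong (+-congˡ (-‿cong (*-congˡ Q-eq))) (*-cong Q-eq Q-eq))
                 (*-congʳ (*-congˡ (*-congʳ (*-congˡ (q-+ (suc K) (tri K)))))))
                 (-‿cong (*-cong (*-congˡ (*-congʳ (*-congˡ (q-+ (suc K) (tri K)))))
                    (≋-trans (b-suc d (suc K)) (*-congˡ (*-congʳ (+-congˡ (-‿cong (q-pyy d (suc K))))))))) ⟩
          (1# - c * (p * y) + p * y * (p * y)) * ((two - c) * (- s K * (y * W) * ((1# + y) * I)) * B)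
            - (two - c) * (- s K * (y * W) * ((1# + y) * I)) * ((1# - p) * ((1# - p * y * y) * B))
            ≈⟨ solve 7 (λ c s W p y B I → (:1 :- c :* (p :* y) :+ p :* y :* (p :* y)) :*
                 ((:1 :+ :1 :- c) :* ((:- s) :* (y :* W) :* ((:1 :+ y) :* I)) :* B)
                 :- (:1 :+ :1 :- c) :* ((:- s) :* (y :* W) :* ((:1 :+ y) :* I)) :*
                   ((:1 :- p) :* ((:1 :- p :* y :* y) :* B))
                 := (:1 :+ :1 :- c) :* (:- s) :* (y :* W) :* (:1 :+ y) :* p :* B :* ((:1 :- c :* y :+ y :* y) :* I))
                   ≋-refl c (s K) W p y B I ⟩
          (two - c) * (- s K) * (y * W) * (1# + y) * p * B * (D (suc K) * I) ≈⟨ *-congˡ (D-inv K) ⟩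
          (two - c) * (- s K) * (y * W) * (1# + y) * p * B * 1# ≈⟨ *-identityʳ _ ⟩
          (two - c) * (- s K) * (y * W) * (1# + y) * p * B ∎

      -- `Y-partial` holds only after multiplication by 1 - q^M; this factor has constant term 1 and
      -- is cancelled here.
      Y-step : ∀ m → D (suc m) * Y (suc m) ≋ Y m
      Y-step m = step (suc m) (D (suc m)) (λ j → Y-term j * b (suc m ∸ j) j) (λ j → Y-term j * b (m ∸ j) j) _
        (*-cancelˡ (1# - Q) (unit-1-q m) (begin
          (1# - Q) * (∑ (suc m) (λ j → D (suc m) * (Y-term j * b (suc m ∸ j) j) - Y-term j * b (m ∸ j) j) + D (suc m)
            * (Y-term (suc m) * b (m ∸ m) (suc m)))
            ≈⟨ ≋-trans (distribˡ _ _ _) (+-cong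
                (≋-trans (Y-partial 0 m refl) (*-congˡ (*-congˡ
                  (≋-trans (b-shift 0 m) (*-congʳ (+-congˡ (-‿cong (q-+ (suc m) (suc m)))))))))
                (*-congˡ (*-congˡ (*-cong (*-congˡ (*-congʳ (*-congˡ (q-+ (suc m) (tri m)))))
                  (≋-reflexive (cong (λ d → b d (suc m)) (ℕP.n∸n≡0 m))))))) ⟩
          (two - c) * (Q * s m * W * ((1# - Q * Q) * B)) + (1# - Q) *
            (D (suc m) * ((two - c) * (- s m * (Q * W) * ((1# + Q) * I)) * B))
            -- The new summand is -D I times the telescoped sum, and D I = 1.
            ≈⟨ solve 7 (λ c s W Q B I D → (:1 :+ :1 :- c) :* (Q :* s :* W :* ((:1 :- Q :* Q) :* B)) :+ (:1 :- Q) :*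
                 (D :* ((:1 :+ :1 :- c) :* ((:- s) :* (Q :* W) :* ((:1 :+ Q) :* I)) :* B))
                 := (:1 :+ :1 :- c) :* (Q :* s :* W :* ((:1 :- Q :* Q) :* B)) :* (:1 :- D :* I)) ≋-refl c (s m) W Q B
                   I (D (suc m)) ⟩
          (two - c) * (Q * s m * W * ((1# - Q * Q) * B)) * (1# - D (suc m) * I)
            ≈⟨ *-congˡ (≋-trans (+-congˡ (-‿cong (D-inv m))) (-‿inverseʳ 1#)) ⟩
          (two - c) * (Q * s m * W * ((1# - Q * Q) * B)) * 0# ≈⟨ ≋-trans (zeroʳ _) (≋-sym (zeroʳ _)) ⟩
          (1# - Q) * 0# ∎))
        where
        Q = q (suc m)
        W = q (tri m)
        B = b 0 (suc m)
        I = invₛ (D (suc m))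

      Y-product : ∀ m → ∏ m D * Y m ≋ 1#
      Y-product = unwind Y D (≋-trans (+-identityˡ _) (≋-trans (*-identityˡ _) b-00)) Y-step

    -- Dropping the weights

    module Limit
      (q-small : ∀ {m N} → N < m → q m ≋[ N ] 0#)
      (q-shift : ∀ m {f g d N} → f ≋[ d ] g → N ≤ m ℕ.+ d → q m * f ≋[ N ] q m * g)
      where

      -- Every further factor 1 - qⁱ has i > d, so it is 1 up to degree d.
      poch-stable : ∀ d k → poch (k ℕ.+ d) ≋[ d ] poch d
      poch-stable d zero    = tr-refl
      poch-stable d (suc k) = tr-trans
        (tr-* (poch-stable d k) (tr-+ (tr-refl {1#}) (tr-neg (q-small {suc (k ℕ.+ d)} {d} (s≤s (ℕP.m≤n+m d k))))))
        (full (solve 1 (λ x → x :* (con 1ℤ :- con 0ℤ) := x) ≋-refl (poch d)))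

      -- With M = d + j, the quotients (q)_M/(q)_(M-j) and (q)_(M+j)/(q)_M consist of factors 1 - qⁱ
      -- with i > d.
      b-limit : ∀ d j → poch (d ℕ.+ j) * poch (d ℕ.+ j) * b d j ≋[ d ] 1#
      b-limit d j = tr-trans (full (solve 3 (λ p i i′ → p :* p :* (i :* i′) := (p :* i) :* (p :* i′)) ≋-refl _ _ _))
        (tr-trans (tr-* left right) (full (*-identityˡ 1#)))
        where
        left : poch (d ℕ.+ j) * ipoch d ≋[ d ] 1#
        left = tr-trans (tr-* (subst (λ n → poch n ≋[ d ] poch d) (ℕP.+-comm j d) (poch-stable d j)) tr-refl)
          (full (*-invₛ (poch d) (poch-unit d)))
        right : poch (d ℕ.+ j) * ipoch (d ℕ.+ j ℕ.+ j) ≋[ d ] 1#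
        right = tr-trans (tr-* (tr-sym (subst (λ n → poch n ≋[ d ] poch (d ℕ.+ j)) (ℕP.+-comm j (d ℕ.+ j))
          (tr-weaken (ℕP.m≤m+n d j) (poch-stable (d ℕ.+ j) j)))) tr-refl)
                  (full (*-invₛ (poch (d ℕ.+ j ℕ.+ j)) (poch-unit (d ℕ.+ j ℕ.+ j))))

      -- The weight is 1 only up to degree N - j; the missing `j` degrees are supplied by `q m`. In
      -- the two sums `m` is j² and j(j+1)/2, both at least j.
      absorb : ∀ {N j m} u → j ≤ N → j ≤ m → poch N * poch N * (u * q m * b (N ∸ j) j) ≋[ N ] u * q m
      absorb {N} {j} {m} u j≤N j≤m = tr-trans
        (full (solve 4 (λ p u q b → p :* p :* (u :* q :* b) := u :* (q :* (p :* p :* b))) ≋-refl (poch N) u (q m)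
          (b (N ∸ j) j)))
        (tr-trans (tr-* (tr-refl {u}) (q-shift m weight bound)) (full (*-congˡ (*-identityʳ _))))
        where
        weight : poch N * poch N * b (N ∸ j) j ≋[ N ∸ j ] 1#
        weight = subst (λ n → poch n * poch n * b (N ∸ j) j ≋[ N ∸ j ] 1#) (ℕP.m∸n+n≡m j≤N) (b-limit (N ∸ j) j)
        bound : N ≤ m ℕ.+ (N ∸ j)
        bound = ℕP.≤-trans (ℕP.≤-reflexive (sym (ℕP.m+[n∸m]≡n j≤N))) (ℕP.+-monoˡ-≤ (N ∸ j) j≤m)

      X-limit : ∀ N → poch N * poch N * X N ≋[ N ] ∑ (suc N) X-term
      X-limit N = tr-trans (full (*-distribˡ-∑ (suc N) (poch N * poch N) _))
        (tr-∑ (suc N) λ j j<1+N → absorb (ε j * s j) (ℕP.≤-pred j<1+N) (n≤n*n j))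

      Y-limit : ∀ c N → let open Appell c in poch N * poch N * Y N ≋[ N ] ∑ (suc N) Y-term
      Y-limit c N = tr-trans (full (*-distribˡ-∑ (suc N) (poch N * poch N) _)) (tr-∑ (suc N) term)
        where
        open Appell c
        term : ∀ j → j < suc N → poch N * poch N * (Y-term j * b (N ∸ j) j) ≋[ N ] Y-term j
        -- The term of index 0 is the bare 1; `q 0` is inserted to give it the form that `absorb`
        -- expects.
        term zero    j<1+N = tr-trans (full (*-congˡ (*-congʳ (≋-sym (≋-trans (*-identityˡ _) q-0)))))
          (tr-trans (absorb {m = 0} 1# (ℕP.≤-pred j<1+N) z≤n) (full (≋-trans (*-identityˡ _) q-0)))
        term (suc j) j<1+N = tr-trans (full (*-congˡ (*-congʳ reorder)))
          (tr-trans (absorb ((two - c) * (s (suc j) * ((1# + q (suc j)) * invₛ (D (suc j))))) (ℕP.≤-pred j<1+N)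
            (ℕP.m≤m+n (suc j) (tri j)))
                    (full (≋-sym reorder)))
          where
          reorder : Y-term (suc j) ≋ (two - c) * (s (suc j) * ((1# + q (suc j)) * invₛ (D (suc j)))) * q (tri (suc j))
          reorder = solve 5 (λ k s q y i → k :* (s :* q :* (y :* i)) := k :* (s :* (y :* i)) :* q) ≋-refl _ _ _ _ _

-- (1 + u) / (1 - c u + u²) = ∑ v c k u^k
v : ℤ → ℕ → ℤ
v c 0             = 1ℤ
v c 1             = 1ℤ ℤ.+ c
v c (suc (suc k)) = c ℤ.* v c (suc k) ℤ.- v c k

εℤ : ℕ → ℤ
εℤ zero    = + 1
εℤ (suc _) = + 2

-- The product as a power series in t for an integer c

module ProductExpansion where
  open PowerSeries
  open Truncation
  open TelescopingIdentities
  open FiniteSum psRing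
  open PSSolver
  open Relation.Binary.Reasoning.Setoid setoid
  module ℤ∑ = FiniteSum ℤP.+-*-commutativeRing

  mono-const : ∀ m → coeff (mono (suc m)) 0 ≡ 0ℤ
  mono-const m = refl

  double : ℕ → PS
  double m = mono (m ℕ.+ m)

  double-+ : ∀ m n → double (m ℕ.+ n) ≋ double m * double n
  double-+ m n = ≋-trans (≋-reflexive (cong mono (interchange m n m n))) (mono-+ (m ℕ.+ m) (n ℕ.+ n))
    where open import Algebra.Properties.CommutativeSemigroup ℕP.+-commutativeSemigroup using (interchange)

  double-const : ∀ m → coeff (double (suc m)) 0 ≡ 0ℤ
  double-const m = refl

  double-small : ∀ {m N} → N < m → double m ≋[ N ] 0#
  double-small {m} N<m = tr-mono-0 (ℕP.≤-trans N<m (ℕP.m≤m+n m m))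

  double-shift : ∀ m {f g d N} → f ≋[ d ] g → N ≤ m ℕ.+ d → double m * f ≋[ N ] double m * g
  double-shift m {d = d} p N≤ = tr-mono* (m ℕ.+ m) p (ℕP.≤-trans N≤ (ℕP.+-monoˡ-≤ d (ℕP.m≤m+n m m)))

  module T   = FiniteIdentities mono mono-0 mono-+ mono-const
  module T²  = FiniteIdentities double mono-0 double-+ double-const
  module TL  = T.Limit tr-mono-0 tr-mono*
  module T²L = T².Limit double-small double-shift

  -- Keeps the shape of the denominator in `factor`, so that evaluation maps one to the other;
  -- `den≋D` passes to the shape used for telescoping.
  den : ℤ → ℕ → PS
  den c i = (1# - constₛ c * mono i) + mono (i ℕ.+ i)

  factorₛ : ℤ → ℕ → PS
  factorₛ c i = ((1# - mono i) * (1# - mono i)) * invₛ (den c i)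

  prodₛ : ℤ → ℕ → PS
  prodₛ c zero    = 1#
  prodₛ c (suc N) = prodₛ c N * factorₛ c (suc N)

  den≋D : ∀ c i → den c i ≋ T.Appell.D (constₛ c) i
  den≋D c i = +-congˡ (mono-+ i i)

  den-unit : ∀ c i → UnitConst (den c (suc i))
  den-unit c i = trans (at (den≋D c (suc i)) 0) (T.Appell.D-unit (constₛ c) i)

  prodₛ-den : ∀ c N → prodₛ c N * ∏ N (den c) ≋ T.poch N * T.poch N
  prodₛ-den c zero    = ≋-refl
  prodₛ-den c (suc N) = begin
    prodₛ c N * (u * u * invₛ d) * (∏ N (den c) * d)
      ≈⟨ solve 5 (λ A u i P d → A :* (u :* u :* i) :* (P :* d) := A :* P :* (u :* u) :* (d :* i)) ≋-refl _ u (invₛ d)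
           _ d ⟩
    prodₛ c N * ∏ N (den c) * (u * u) * (d * invₛ d) ≈⟨ *-cong (*-congʳ (prodₛ-den c N)) (*-invₛ d (den-unit c N)) ⟩
    T.poch N * T.poch N * (u * u) * 1# ≈⟨ solve 2 (λ p u → p :* p :* (u :* u) :* con 1ℤ := p :* u :* (p :* u)) ≋-refl
      _ u ⟩
    T.poch N * u * (T.poch N * u) ∎
    where
    u = 1# - mono (suc N)
    d = den c (suc N)

  ∏-cong : ∀ N {f g} → (∀ i → f i ≋ g i) → ∏ N f ≋ ∏ N g
  ∏-cong zero    p = ≋-refl
  ∏-cong (suc N) p = *-cong (∏-cong N p) (p (suc N))

  ∏-* : ∀ N f g → ∏ N (λ i → f i * g i) ≋ ∏ N f * ∏ N g
  ∏-* zero    f g = ≋-sym (*-identityˡ 1#)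
  ∏-* (suc N) f g = ≋-trans (*-congʳ (∏-* N f g)) (solve 4 (λ a b c d → a :* b :* (c :* d) := a :* c :* (b :* d))
    ≋-refl _ _ _ _)

  -- The denominators have constant term 1, so the product is determined by its value after clearing
  -- them.
  prodₛ-unique : ∀ c N Z → Z * ∏ N (den c) ≋ T.poch N * T.poch N → prodₛ c N ≋ Z
  prodₛ-unique c N Z h = *-cancelˡ (∏ N (den c)) (∏-unit N (den c) (den-unit c))
    (≋-trans (*-comm _ _) (≋-trans (prodₛ-den c N) (≋-trans (≋-sym h) (*-comm _ _))))

  prodₛ-Appell : ∀ c N → prodₛ c N ≋[ N ] ∑ (suc N) (T.Appell.Y-term (constₛ c))
  prodₛ-Appell c N = tr-trans (full (prodₛ-unique c N (T.poch N * T.poch N * Y N) (begin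
      T.poch N * T.poch N * Y N * ∏ N (den c) ≈⟨ *-congˡ (∏-cong N (den≋D c)) ⟩
      T.poch N * T.poch N * Y N * ∏ N D ≈⟨ solve 3 (λ p y d → p :* p :* y :* d := p :* p :* (d :* y)) ≋-refl _ _ _ ⟩
      T.poch N * T.poch N * (∏ N D * Y N) ≈⟨ *-congˡ (Y-product N) ⟩
      T.poch N * T.poch N * 1# ≈⟨ *-identityʳ _ ⟩
      T.poch N * T.poch N ∎))) (TL.Y-limit (constₛ c) N)
    where open T.Appell (constₛ c)

  module Gauss
    (q : ℕ → PS) (q-0 : q 0 ≋ 1#) (q-+ : ∀ m n → q (m ℕ.+ n) ≋ q m * q n) (q-const : ∀ m → coeff (q (suc m)) 0 ≡ 0ℤ)
    where
    module F = FiniteIdentities q q-0 q-+ q-const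

    1+q-unit : ∀ i → UnitConst (1# + q (suc i))
    1+q-unit i rewrite q-const i = refl

    θ : ℕ → PS
    θ N = F.poch N * F.poch N * F.X N

    poch-∏ : ∀ N → ∏ N (λ i → 1# - q i) ≋ F.poch N
    poch-∏ zero    = ≋-refl
    poch-∏ (suc N) = *-congʳ (poch-∏ N)

    -- (q)_N ∏ (1 + qⁱ) equals ∏ (1 - q²ⁱ), and `F.X N` is the inverse of that product.
    θ-quotient : ∀ N → θ N * ∏ N (λ i → 1# + q i) ≋ F.poch N
    θ-quotient N = begin
      F.poch N * F.poch N * F.X N * P ≈⟨ solve 3 (λ p x r → p :* p :* x :* r := p :* ((p :* r) :* x)) ≋-refl _ _ _ ⟩
      F.poch N * ((F.poch N * P) * F.X N) ≈⟨ *-congˡ (*-congʳ (begin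
        F.poch N * P ≈⟨ *-congʳ (≋-sym (poch-∏ N)) ⟩
        ∏ N (λ i → 1# - q i) * P ≈⟨ ≋-sym (∏-* N (λ i → 1# - q i) (λ i → 1# + q i)) ⟩
        ∏ N (λ i → (1# - q i) * (1# + q i))
          ≈⟨ ∏-cong N (λ i → solve 1 (λ x → (con 1ℤ :- x) :* (con 1ℤ :+ x) := con 1ℤ :- x :* x) ≋-refl (q i)) ⟩
        ∏ N (λ i → 1# - q i * q i) ∎)) ⟩
      F.poch N * (∏ N (λ i → 1# - q i * q i) * F.X N) ≈⟨ *-congˡ (F.X-product N) ⟩
      F.poch N * 1# ≈⟨ *-identityʳ _ ⟩
      F.poch N ∎
      where P = ∏ N (λ i → 1# + q i)

  module G  = Gauss mono mono-0 mono-+ mono-const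
  module G² = Gauss double mono-0 double-+ double-const

  -- For c = -2 the denominators are the squares (1 + tⁱ)².
  prodₛ-−2 : ∀ N → prodₛ (ℤ.- (+ 2)) N ≋ G.θ N * G.θ N
  prodₛ-−2 N = prodₛ-unique _ N _ (begin
    G.θ N * G.θ N * ∏ N (den (ℤ.- (+ 2))) ≈⟨ *-congˡ (∏-cong N sq) ⟩
    G.θ N * G.θ N * ∏ N (λ i → (1# + mono i) * (1# + mono i)) ≈⟨ *-congˡ (∏-* N _ _) ⟩
    G.θ N * G.θ N * (P * P) ≈⟨ solve 2 (λ t p → t :* t :* (p :* p) := (t :* p) :* (t :* p)) ≋-refl _ _ ⟩
    (G.θ N * P) * (G.θ N * P) ≈⟨ *-cong (G.θ-quotient N) (G.θ-quotient N) ⟩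
    T.poch N * T.poch N ∎)
    where
    P = ∏ N (λ i → 1# + mono i)
    sq : ∀ i → den (ℤ.- (+ 2)) i ≋ (1# + mono i) * (1# + mono i)
    sq i = ≋-trans (den≋D _ i) (solve 1 (λ x → con 1ℤ :- con (ℤ.- (+ 2)) :* x :+ x :* x := (con 1ℤ :+ x) :*
      (con 1ℤ :+ x)) ≋-refl (mono i))

  -- For c = 0 the denominators 1 + t²ⁱ are those of the theta series in t². The additional factor
  -- `P` clears the denominators of θ(t); it reappears on the other side because (t²;t²)_N = (t)_N
  -- `P`.
  prodₛ-0 : ∀ N → prodₛ 0ℤ N ≋ G.θ N * G².θ N
  prodₛ-0 N = prodₛ-unique _ N _ (*-cancelˡ P (∏-unit N _ G.1+q-unit) (begin
    P * (G.θ N * G².θ N * ∏ N (den 0ℤ)) ≈⟨ *-congˡ (*-congˡ (∏-cong N no-middle)) ⟩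
    P * (G.θ N * G².θ N * P²) ≈⟨ solve 4 (λ p t t′ p′ → p :* (t :* t′ :* p′) := (t :* p) :* (t′ :* p′)) ≋-refl _ _ _ _ ⟩
    (G.θ N * P) * (G².θ N * P²) ≈⟨ *-cong (G.θ-quotient N) (G².θ-quotient N) ⟩
    T.poch N * T².poch N ≈⟨ *-congˡ (begin
      T².poch N ≈⟨ ≋-sym (G².poch-∏ N) ⟩
      ∏ N (λ i → 1# - double i) ≈⟨ ∏-cong N (λ i → ≋-trans (+-congˡ (-‿cong (mono-+ i i)))
             (solve 1 (λ x → con 1ℤ :- x :* x := (con 1ℤ :- x) :* (con 1ℤ :+ x)) ≋-refl (mono i))) ⟩
      ∏ N (λ i → (1# - mono i) * (1# + mono i)) ≈⟨ ∏-* N _ _ ⟩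
      ∏ N (λ i → 1# - mono i) * P ≈⟨ *-congʳ (G.poch-∏ N) ⟩
      T.poch N * P ∎) ⟩
    T.poch N * (T.poch N * P) ≈⟨ solve 2 (λ a p → a :* (a :* p) := p :* (a :* a)) ≋-refl _ _ ⟩
    P * (T.poch N * T.poch N) ∎))
    where
    P = ∏ N (λ i → 1# + mono i)
    P² = ∏ N (λ i → 1# + double i)
    no-middle : ∀ i → den 0ℤ i ≋ 1# + double i
    no-middle i = solve 2 (λ x y → con 1ℤ :- con 0ℤ :* x :+ y := con 1ℤ :+ y) ≋-refl (mono i) (double i)

  weight : ℕ → ℤ
  weight j = εℤ j ℤ.* sgn j

  s≋ : ∀ j → T.s j ≋ constₛ (sgn j)
  s≋ zero    = ≋-refl
  s≋ (suc j) = ≋-trans (-‿cong (s≋ j)) (≋-sym (constₛ-neg (sgn j)))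

  X-term-coeff : ∀ j → T.ε j * T.s j ≋ constₛ (weight j)
  X-term-coeff zero    = *-identityˡ 1#
  X-term-coeff (suc j) = ≋-trans (*-cong (≋-sym (constₛ-+ 1ℤ 1ℤ)) (s≋ (suc j))) (≋-sym (constₛ-* (+ 2) (sgn (suc j))))

  coeff-∑-mono : ∀ K (a : ℕ → ℤ) (e : ℕ → ℕ) n →
    coeff (∑ K (λ l → constₛ (a l) * mono (e l))) n ≡ ℤ∑.∑ K (λ l → a l ℤ.* δ (e l) n)
  coeff-∑-mono K a e n = trans (coeff-∑ K (λ l → constₛ (a l) * mono (e l)) n)
    (ℤ∑.∑-cong K (λ l → coeff-const* (a l) (mono (e l)) n))

  mono-* : ∀ a b m n → (a * mono m) * (b * mono n) ≋ a * b * mono (m ℕ.+ n)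
  mono-* a b m n = ≋-trans (solve 4 (λ a b c d → a :* b :* (c :* d) := a :* c :* (b :* d)) ≋-refl a (mono m) b (mono n))
                           (*-congˡ (≋-sym (mono-+ m n)))

  -- The coefficient of tⁿ in a product of two folded theta series; `Q j l` is the total exponent of
  -- the pair of terms j, l.
  thetaSum : (ℕ → ℕ → ℕ) → ℕ → ℤ
  thetaSum Q n = ℤ∑.∑ (suc n) (λ j → ℤ∑.∑ (suc n) (λ l → weight j ℤ.* weight l ℤ.* δ (Q j l) n))

  coeff-θθ : ∀ N (e e′ : ℕ → ℕ) → coeff (∑ (suc N) (λ j → T.ε j * T.s j * mono (e j)) * ∑ (suc N)
    (λ j → T.ε j * T.s j * mono (e′ j))) N
             ≡ thetaSum (λ j l → e j ℕ.+ e′ l) N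
  coeff-θθ N e e′ = trans (at (begin
      ∑ (suc N) f * ∑ (suc N) g ≈⟨ *-distribʳ-∑ (suc N) (∑ (suc N) g) f ⟩
      ∑ (suc N) (λ j → f j * ∑ (suc N) g) ≈⟨ ∑-cong (suc N) (λ j → begin
        f j * ∑ (suc N) g ≈⟨ *-distribˡ-∑ (suc N) (f j) g ⟩
        ∑ (suc N) (λ l → f j * g l) ≈⟨ ∑-cong (suc N) (λ l → ≋-trans (mono-* _ _ (e j) (e′ l))
             (*-congʳ (≋-trans (*-cong (X-term-coeff j) (X-term-coeff l)) (≋-sym (constₛ-* (weight j) (weight l)))))) ⟩
        row j ∎) ⟩
      ∑ (suc N) row ∎) N)
    (trans (coeff-∑ (suc N) row N) (ℤ∑.∑-cong (suc N) λ j → coeff-∑-mono (suc N) (λ l → weight j ℤ.* weight l)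
      (λ l → e j ℕ.+ e′ l) N))
    where
    f g row : ℕ → PS
    f j = T.ε j * T.s j * mono (e j)
    g l = T.ε l * T.s l * mono (e′ l)
    row j = ∑ (suc N) (λ l → constₛ (weight j ℤ.* weight l) * mono (e j ℕ.+ e′ l))

  coeff-−2 : ∀ N → coeff (prodₛ (ℤ.- (+ 2)) N) N ≡ thetaSum (λ j l → j ℕ.* j ℕ.+ l ℕ.* l) N
  coeff-−2 N = trans (at (prodₛ-−2 N) N) (trans (agree (tr-* (TL.X-limit N) (TL.X-limit N)) N ℕP.≤-refl)
    (coeff-θθ N _ _))

  coeff-0 : ∀ N → coeff (prodₛ 0ℤ N) N ≡ thetaSum (λ j l → j ℕ.* j ℕ.+ (l ℕ.* l ℕ.+ l ℕ.* l)) N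
  coeff-0 N = trans (at (prodₛ-0 N) N) (trans (agree (tr-* (TL.X-limit N) (T²L.X-limit N)) N ℕP.≤-refl)
    (coeff-θθ N _ _))

  module _ (c : ℤ) where
    open T.Appell (constₛ c)

    V : ℕ → PS
    V k = constₛ (v c k)

    -- A partial sum of the expansion of (1 + u)/(1 - c u + u²) at u = t^j: by the three-term
    -- recurrence of `v` everything cancels except 1 + u and two boundary terms.
    D-∑ : ∀ j K → D j * ∑ (suc K) (λ k → V k * mono (k ℕ.* j))
                  ≋ 1# + mono j - V (suc K) * mono (suc K ℕ.* j) + V K * mono (suc (suc K) ℕ.* j)
    D-∑ j zero = begin
      D j * (0# + 1# * mono 0) ≈⟨ *-congˡ (+-congˡ (*-congˡ mono-0)) ⟩
      D j * (0# + 1# * 1#)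
        ≈⟨ solve 2 (λ c u → (con 1ℤ :- c :* u :+ u :* u) :* (con 0ℤ :+ con 1ℤ :* con 1ℤ) := con 1ℤ :+ u :-
             (con 1ℤ :+ c) :* u :+ con 1ℤ :* (u :* u)) ≋-refl (constₛ c) (mono j) ⟩
      1# + mono j - (1# + constₛ c) * mono j + 1# * (mono j * mono j)
        ≈⟨ +-cong (+-congˡ (-‿cong (*-cong (≋-sym (constₛ-+ 1ℤ c)) (≋-reflexive (cong mono (sym (ℕP.+-identityʳ j)))))))
                  (*-congˡ (≋-trans (≋-sym (mono-+ j j))
                    (≋-reflexive (cong (λ i → mono (j ℕ.+ i)) (sym (ℕP.+-identityʳ j)))))) ⟩
      1# + mono j - V 1 * mono (1 ℕ.* j) + V 0 * mono (2 ℕ.* j) ∎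
    D-∑ j (suc K) = begin
      D j * (∑ (suc K) (λ k → V k * mono (k ℕ.* j)) + b * w) ≈⟨ ≋-trans (distribˡ _ _ _) (+-congʳ (D-∑ j K)) ⟩
      (1# + u - b * w + a * mono (suc (suc K) ℕ.* j)) + D j * (b * w) ≈⟨ +-congʳ (+-congˡ (*-congˡ (mono-+ j _))) ⟩
      (1# + u - b * w + a * (u * w)) + D j * (b * w)
        ≈⟨ solve 5 (λ c u a b w → (con 1ℤ :+ u :- b :* w :+ a :* (u :* w)) :+ (con 1ℤ :- c :* u :+ u :* u) :* (b :* w)
             := con 1ℤ :+ u :- (c :* b :- a) :* (u :* w) :+ b :* (u :* (u :* w))) ≋-refl (constₛ c) u a b w ⟩
      1# + u - (constₛ c * b - a) * (u * w) + b * (u * (u * w))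
        ≈⟨ +-cong (+-congˡ (-‿cong (*-cong (≋-sym rec) (≋-sym (mono-+ j _)))))
             (*-congˡ (≋-sym (≋-trans (mono-+ j _) (*-congˡ (mono-+ j _))))) ⟩
      1# + u - V (suc (suc K)) * mono (suc (suc K) ℕ.* j) + b * mono (suc (suc (suc K)) ℕ.* j) ∎
      where
      u = mono j
      w = mono (suc K ℕ.* j)
      a = V K
      b = V (suc K)
      rec : V (suc (suc K)) ≋ constₛ c * b - a
      rec = ≋-trans (constₛ-+ (c ℤ.* v c (suc K)) (ℤ.- v c K)) (+-cong (constₛ-* c _) (constₛ-neg _))

    expand-term : ∀ j N → (1# + mono (suc j)) * invₛ (D (suc j)) ≋[ N ] ∑ (suc N) (λ k → V k * mono (k ℕ.* suc j))
    expand-term j N = tr-trans (tr-* (tr-sym small) (tr-refl {invₛ (D (suc j))})) (full (begin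
      D (suc j) * S * invₛ (D (suc j)) ≈⟨ solve 3 (λ d s i → d :* s :* i := s :* (d :* i)) ≋-refl _ _ _ ⟩
      S * (D (suc j) * invₛ (D (suc j))) ≈⟨ *-congˡ (D-inv j) ⟩
      S * 1# ≈⟨ *-identityʳ S ⟩
      S ∎))
      where
      S = ∑ (suc N) (λ k → V k * mono (k ℕ.* suc j))
      bound : suc N ≤ suc N ℕ.* suc j
      bound = ℕP.m≤m*n (suc N) (suc j)
      -- Both boundary terms have exponents of at least (N + 1)(j + 1) > N.
      small : D (suc j) * S ≋[ N ] 1# + mono (suc j)
      small = tr-trans (full (D-∑ (suc j) N)) (tr-trans (tr-+ (tr-+ tr-refl (tr-neg (tr-* tr-refl (tr-mono-0 bound))))
                (tr-* tr-refl (tr-mono-0 (ℕP.≤-trans bound (ℕP.m≤n+m _ (suc j))))))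
                (full (solve 3 (λ x a b → x :- a :* con 0ℤ :+ b :* con 0ℤ := x) ≋-refl (1# + mono (suc j)) (V (suc N))
                  (V N))))

    lambert : ℕ → ℤ
    lambert N = ℤ∑.∑ N (λ j → ℤ∑.∑ (suc N) (λ k → sgn (suc j) ℤ.* v c k ℤ.* δ (tri (suc j) ℕ.+ k ℕ.* suc j) N))

    -- The index is positive, so the leading 1 of the expansion contributes nothing and the factor 2
    -- - c comes out of all the rest; at c = 2 the coefficient vanishes.
    coeff-Appell : ∀ N → coeff (prodₛ c (suc N)) (suc N) ≡ (+ 2 ℤ.- c) ℤ.* lambert (suc N)
    coeff-Appell N′ = trans (agree (prodₛ-Appell c N) N ℕP.≤-refl)
      (trans (at (∑-head N Y-term) N) (trans (cong (ℤ._+ coeff (∑ N (Y-term ∘ suc)) N) (ℤP.*-zeroʳ 1ℤ))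
        (trans (ℤP.+-identityˡ _)
      (trans (coeff-∑ N _ N) (trans (ℤ∑.∑-cong N term) (sym (ℤ∑.*-distribˡ-∑ N (+ 2 ℤ.- c) _)))))))
      where
      N = suc N′
      term : ∀ j → coeff (Y-term (suc j)) N ≡ (+ 2 ℤ.- c) ℤ.* ℤ∑.∑ (suc N)
        (λ k → sgn (suc j) ℤ.* v c k ℤ.* δ (tri (suc j) ℕ.+ k ℕ.* suc j) N)
      term j = trans (agree (tr-* (tr-refl {1# + 1# - constₛ c})
        (tr-* (tr-refl {T.s (suc j) * mono (tri (suc j))}) (expand-term j N))) N ℕP.≤-refl)
        (trans (at (begin
          (1# + 1# - constₛ c) * (T.s (suc j) * mono (tri (suc j)) * ∑ (suc N) (λ k → V k * mono (k ℕ.* suc j)))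
            ≈⟨ *-cong two-c (*-distribˡ-∑ (suc N) _ _) ⟩
          constₛ (+ 2 ℤ.- c) * ∑ (suc N) (λ k → T.s (suc j) * mono (tri (suc j)) * (V k * mono (k ℕ.* suc j)))
            ≈⟨ *-congˡ (∑-cong (suc N) (λ k → ≋-trans (mono-* (T.s (suc j)) (V k) (tri (suc j)) (k ℕ.* suc j))
                 (*-congʳ (≋-trans (*-congʳ (s≋ (suc j))) (≋-sym (constₛ-* (sgn (suc j)) (v c k))))))) ⟩
          constₛ (+ 2 ℤ.- c) * ∑ (suc N) (λ k → constₛ (sgn (suc j) ℤ.* v c k) * mono (tri (suc j) ℕ.+ k ℕ.* suc j))
            ∎) N)
        (trans (coeff-const* (+ 2 ℤ.- c) (∑ (suc N) (λ k → constₛ (sgn (suc j) ℤ.* v c k) * mono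
          (tri (suc j) ℕ.+ k ℕ.* suc j))) N)
          (cong ((+ 2 ℤ.- c) ℤ.*_) (coeff-∑-mono (suc N) (λ k → sgn (suc j) ℤ.* v c k)
            (λ k → tri (suc j) ℕ.+ k ℕ.* suc j) N))))
        where
        two-c : 1# + 1# - constₛ c ≋ constₛ (+ 2 ℤ.- c)
        two-c = ≋-sym (≋-trans (constₛ-+ (+ 2) (ℤ.- c)) (+-cong (constₛ-+ 1ℤ 1ℤ) (constₛ-neg c)))

dotL : Series → ℕ → List Laurent → Laurent
dotL f k []       = lzero
dotL f k (x ∷ xs) = ladd (lmul (f k) x) (dotL f (suc k) xs)

-- Defs.dot is private, so its name is recovered by unification, after
-- abstracting the starting index 1 and the list.
mutual
  sinvRev-suc : ∀ f n → sinvRev f (suc n) ≡ lneg (dotL f 1 (sinvRev f n)) ∷ sinvRev f n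
  sinvRev-suc f n with 1 | sinvRev f n
  ... | k | xs = cong (λ z → lneg z ∷ xs) (dot≡dotL f k xs)

  dot≡dotL : ∀ f k xs → _ ≡ dotL f k xs
  dot≡dotL f k []       = refl
  dot≡dotL f k (x ∷ xs) = cong (ladd (lmul (f k) x)) (dot≡dotL f (suc k) xs)

-- The image of ℤ in a commutative ring

module IntegerImage (R : RingOps)
  (isCR : IsCommutativeRing _≡_ (RingOps._⊕_ R) (RingOps._⊗_ R) (RingOps.⊖_ R) (RingOps.𝟘 R) (RingOps.𝟙 R)) where
  open RingOps R using (Carrier)

  ring : CommutativeRing 0ℓ 0ℓ
  ring = record { isCommutativeRing = isCR }

  open CommutativeRing ring public
    using (_+_; _*_; -_; +-identityˡ; +-identityʳ; *-identityˡ; *-identityʳ; +-assoc; +-comm; *-assoc; *-comm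
          ; distribˡ; distribʳ; zeroˡ; zeroʳ; -‿inverseʳ; -‿inverseˡ; _-_; 0#; 1#)
  open import Algebra.Properties.Ring (CommutativeRing.ring ring) using (-‿distribˡ-*; -0#≈0#; -‿+-comm; -‿involutive)

  ⟦_⟧ : ℤ → Carrier
  ⟦ z ⟧ = intR R z

  natR-+ : ∀ m n → natR R (m ℕ.+ n) ≡ natR R m + natR R n
  natR-+ zero    n = sym (+-identityˡ _)
  natR-+ (suc m) n = trans (cong (_+_ 1#) (natR-+ m n)) (sym (+-assoc _ _ _))

  ⟦neg⟧ : ∀ a → ⟦ ℤ.- a ⟧ ≡ - ⟦ a ⟧
  ⟦neg⟧ (+ zero)  = sym -0#≈0#
  ⟦neg⟧ (+ suc n) = refl
  ⟦neg⟧ -[1+ n ]  = sym (-‿involutive _)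

  ⟦⊖⟧ : ∀ m n → ⟦ m ℤ.⊖ n ⟧ ≡ natR R m - natR R n
  ⟦⊖⟧ m       zero    = sym (trans (cong (_+_ (natR R m)) -0#≈0#) (+-identityʳ _))
  ⟦⊖⟧ zero    (suc n) = sym (+-identityˡ _)
  ⟦⊖⟧ (suc m) (suc n) = trans (cong ⟦_⟧ (ℤP.[1+m]⊖[1+n]≡m⊖n m n)) (trans (⟦⊖⟧ m n) (sym cancel))
    where
    open ≡-Reasoning
    a = natR R m
    b = natR R n
    cancel : (1# + a) - (1# + b) ≡ a - b
    cancel = begin
      (1# + a) + - (1# + b)     ≡⟨ cong₂ _+_ (+-comm 1# a) (sym (-‿+-comm 1# b)) ⟩
      (a + 1#) + (- 1# + - b)   ≡⟨ +-assoc a 1# _ ⟩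
      a + (1# + (- 1# + - b))   ≡⟨ cong (_+_ a) (sym (+-assoc 1# (- 1#) (- b))) ⟩
      a + ((1# + - 1#) + - b)   ≡⟨ cong (λ u → a + (u + - b)) (-‿inverseʳ 1#) ⟩
      a + (0# + - b)            ≡⟨ cong (_+_ a) (+-identityˡ _) ⟩
      a - b ∎

  ⟦+⟧ : ∀ a b → ⟦ a ℤ.+ b ⟧ ≡ ⟦ a ⟧ + ⟦ b ⟧
  ⟦+⟧ (+ m)    (+ n)    = natR-+ m n
  ⟦+⟧ (+ m)    -[1+ n ] = ⟦⊖⟧ m (suc n)
  ⟦+⟧ -[1+ m ] (+ n)    = trans (⟦⊖⟧ n (suc m)) (+-comm _ _)
  ⟦+⟧ -[1+ m ] -[1+ n ] = trans (cong -_ (trans (cong (natR R ∘ suc) (sym (ℕP.+-suc m n))) (natR-+ (suc m) (suc n))))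
    (sym (-‿+-comm _ _))

  ⟦*⟧ : ∀ a b → ⟦ a ℤ.* b ⟧ ≡ ⟦ a ⟧ * ⟦ b ⟧
  ⟦*⟧ (+ m)    b = go m
    where
    open ≡-Reasoning
    go : ∀ m → ⟦ + m ℤ.* b ⟧ ≡ natR R m * ⟦ b ⟧
    go zero    = trans (cong ⟦_⟧ (ℤP.*-zeroˡ b)) (sym (zeroˡ _))
    go (suc m) = begin
      ⟦ + suc m ℤ.* b ⟧          ≡⟨ cong ⟦_⟧ (ℤP.suc-* (+ m) b) ⟩
      ⟦ b ℤ.+ + m ℤ.* b ⟧        ≡⟨ ⟦+⟧ b (+ m ℤ.* b) ⟩
      ⟦ b ⟧ + ⟦ + m ℤ.* b ⟧      ≡⟨ cong₂ _+_ (sym (*-identityˡ _)) (go m) ⟩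
      1# * ⟦ b ⟧ + natR R m * ⟦ b ⟧ ≡⟨ sym (distribʳ _ _ _) ⟩
      natR R (suc m) * ⟦ b ⟧ ∎
  ⟦*⟧ -[1+ m ] b = trans (cong ⟦_⟧ (sym (ℤP.neg-distribˡ-* (+ suc m) b))) (trans (⟦neg⟧ (+ suc m ℤ.* b))
                     (trans (cong -_ (⟦*⟧ (+ suc m) b)) (-‿distribˡ-* _ _)))

  hom : CommutativeRing.rawRing ℤP.+-*-commutativeRing -Raw-AlmostCommutative⟶ fromCommutativeRing ring
  hom = record { ⟦_⟧ = ⟦_⟧ ; +-homo = ⟦+⟧ ; *-homo = ⟦*⟧ ; -‿homo = ⟦neg⟧ ; 0-homo = refl ; 1-homo = +-identityʳ 1# }

  ⟦⟧-≟ : ∀ a b → Maybe (⟦ a ⟧ ≡ ⟦ b ⟧)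
  ⟦⟧-≟ a b with a ℤ.≟ b
  ... | yes e = just (cong ⟦_⟧ e)
  ... | no _  = nothing

  module RSolver = Algebra.Solver.Ring (CommutativeRing.rawRing ℤP.+-*-commutativeRing) (fromCommutativeRing ring) hom ⟦⟧-≟

  -- The solver reads `con 1ℤ` as `⟦ 1ℤ ⟧`, which unfolds to `1# + 0#`; goals that contain `1#` are
  -- rewritten by this before they are solved.
  ⟦1⟧ : ⟦ 1ℤ ⟧ ≡ 1#
  ⟦1⟧ = +-identityʳ 1#

-- Evaluation of Laurent polynomials at a unit x

module Evaluation (R : RingOps)
  (isCR : IsCommutativeRing _≡_ (RingOps._⊕_ R) (RingOps._⊗_ R) (RingOps.⊖_ R) (RingOps.𝟘 R) (RingOps.𝟙 R))
  (x x⁻¹ : RingOps.Carrier R) (x*x⁻¹ : RingOps._⊗_ R x⁻¹ x ≡ RingOps.𝟙 R) where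
  open RingOps R using (Carrier)
  open IntegerImage R isCR
  open RSolver using (solve; con; _:+_; _:*_; _:-_; :-_; _:=_)
  open ≡-Reasoning
  open PowerSeries using (PS; coeff; constₛ; invₛ)
  open Truncation using (mono)
  open Convolution
  open ProductExpansion using (prodₛ; factorₛ)

  evP : Poly → Carrier
  evP = evalPoly R x
  evL : Laurent → Carrier
  evL = evalLaurent R x x⁻¹
  pow : ℕ → Carrier
  pow = powR R x
  pow⁻¹ : ℕ → Carrier
  pow⁻¹ = powR R x⁻¹

  pow⁻¹-+ : ∀ k l → pow⁻¹ (k ℕ.+ l) ≡ pow⁻¹ k * pow⁻¹ l
  pow⁻¹-+ zero    l = sym (*-identityˡ _)
  pow⁻¹-+ (suc k) l = trans (cong (_*_ x⁻¹) (pow⁻¹-+ k l)) (sym (*-assoc _ _ _))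

  pow⁻¹*pow : ∀ k → pow⁻¹ k * pow k ≡ 1#
  pow⁻¹*pow zero    = *-identityˡ _
  pow⁻¹*pow (suc k) = begin
    x⁻¹ * pow⁻¹ k * (x * pow k)   ≡⟨ solve 4 (λ a b c d → a :* b :* (c :* d) := a :* c :* (b :* d)) refl x⁻¹ (pow⁻¹ k)
      x (pow k) ⟩
    x⁻¹ * x * (pow⁻¹ k * pow k)   ≡⟨ cong₂ _*_ x*x⁻¹ (pow⁻¹*pow k) ⟩
    1# * 1#                       ≡⟨ *-identityˡ _ ⟩
    1# ∎

  evP-padd : ∀ p r → evP (padd p r) ≡ evP p + evP r
  evP-padd []      r       = sym (+-identityˡ _)
  evP-padd (a ∷ p) []      = sym (+-identityʳ _)
  evP-padd (a ∷ p) (b ∷ r) = trans (cong₂ (λ u w → u + x * w) (⟦+⟧ a b) (evP-padd p r))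
    (solve 5 (λ a b x u w → (a :+ b) :+ x :* (u :+ w) := (a :+ x :* u) :+ (b :+ x :* w)) refl ⟦ a ⟧ ⟦ b ⟧ x (evP p)
      (evP r))

  evP-scale : ∀ a p → evP (map (a ℤ.*_) p) ≡ ⟦ a ⟧ * evP p
  evP-scale a []      = sym (zeroʳ _)
  evP-scale a (b ∷ p) = trans (cong₂ (λ u w → u + x * w) (⟦*⟧ a b) (evP-scale a p))
    (solve 4 (λ a b x u → a :* b :+ x :* (a :* u) := a :* (b :+ x :* u)) refl ⟦ a ⟧ ⟦ b ⟧ x (evP p))

  evP-pmul : ∀ p r → evP (pmul p r) ≡ evP p * evP r
  evP-pmul []      r = sym (zeroˡ _)
  evP-pmul (a ∷ p) r = trans (evP-padd (map (a ℤ.*_) r) (0ℤ ∷ pmul p r))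
    (trans (cong₂ (λ u w → u + (0# + x * w)) (evP-scale a r) (evP-pmul p r))
    (trans (cong (_+_ (⟦ a ⟧ * evP r)) (+-identityˡ _))
    (solve 4 (λ a x u w → a :* w :+ x :* (u :* w) := (a :+ x :* u) :* w) refl ⟦ a ⟧ x (evP p) (evP r))))

  evP-neg : ∀ p → evP (map ℤ.-_ p) ≡ - evP p
  evP-neg []      = solve 0 (con 0ℤ := :- con 0ℤ) refl
  evP-neg (a ∷ p) = trans (cong₂ (λ u w → u + x * w) (⟦neg⟧ a) (evP-neg p))
    (solve 3 (λ a x u → :- a :+ x :* (:- u) := :- (a :+ x :* u)) refl ⟦ a ⟧ x (evP p))

  evP-shift : ∀ k p → evP (pshift k p) ≡ pow k * evP p
  evP-shift zero    p = sym (*-identityˡ _)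
  evP-shift (suc k) p = trans (+-identityˡ _) (trans (cong (_*_ x) (evP-shift k p)) (sym (*-assoc _ _ _)))

  -- The common denominator is reached by shifting each numerator by the exponent of the other;
  -- evaluation cancels the shifts against powers of x⁻¹.
  evL-ladd : ∀ l m → evL (ladd l m) ≡ evL l + evL m
  evL-ladd (k , p) (l , r) = begin
    pow⁻¹ (k ℕ.+ l) * evP (padd (pshift l p) (pshift k r))
      ≡⟨ cong₂ _*_ (pow⁻¹-+ k l) (trans (evP-padd (pshift l p) _) (cong₂ _+_ (evP-shift l p) (evP-shift k r))) ⟩
    pow⁻¹ k * pow⁻¹ l * (pow l * evP p + pow k * evP r)
      ≡⟨ solve 6 (λ ki li k l p r → ki :* li :* (l :* p :+ k :* r) := (li :* l) :* (ki :* p) :+ (ki :* k) :*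
           (li :* r)) refl
           (pow⁻¹ k) (pow⁻¹ l) (pow k) (pow l) (evP p) (evP r) ⟩
    (pow⁻¹ l * pow l) * (pow⁻¹ k * evP p) + (pow⁻¹ k * pow k) * (pow⁻¹ l * evP r)
      ≡⟨ cong₂ (λ u w → u * (pow⁻¹ k * evP p) + w * (pow⁻¹ l * evP r)) (pow⁻¹*pow l) (pow⁻¹*pow k) ⟩
    1# * (pow⁻¹ k * evP p) + 1# * (pow⁻¹ l * evP r) ≡⟨ cong₂ _+_ (*-identityˡ _) (*-identityˡ _) ⟩
    pow⁻¹ k * evP p + pow⁻¹ l * evP r ∎

  evL-lmul : ∀ l m → evL (lmul l m) ≡ evL l * evL m
  evL-lmul (k , p) (l , r) = trans (cong₂ _*_ (pow⁻¹-+ k l) (evP-pmul p r))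
    (solve 4 (λ a b c d → a :* b :* (c :* d) := a :* c :* (b :* d)) refl (pow⁻¹ k) (pow⁻¹ l) (evP p) (evP r))

  evL-lneg : ∀ l → evL (lneg l) ≡ - evL l
  evL-lneg (k , p) = trans (cong (_*_ (pow⁻¹ k)) (evP-neg p))
    (solve 2 (λ a b → a :* (:- b) := :- (a :* b)) refl (pow⁻¹ k) (evP p))

  evL-lqpow : ∀ n → evL (lqpow n) ≡ pow n
  evL-lqpow n = trans (*-identityˡ _) (trans (evP-shift n _) (trans (cong (_*_ (pow n))
    (trans (cong₂ _+_ ⟦1⟧ (zeroʳ x)) (+-identityʳ _))) (*-identityʳ _)))

  infix 4 _↦_
  -- The product is built from q + q⁻¹ alone. When x + x⁻¹ is an integer, all its coefficients
  -- therefore take integer values at `x`, even if `x` is not an integer.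
  record _↦_ (l : Laurent) (z : ℤ) : Set where
    constructor mk
    field value : evL l ≡ ⟦ z ⟧
  open _↦_

  ladd-↦ : ∀ {l m a b} → l ↦ a → m ↦ b → ladd l m ↦ a ℤ.+ b
  ladd-↦ {l} {m} {a} {b} (mk p) (mk q) = mk (trans (evL-ladd l m) (trans (cong₂ _+_ p q) (sym (⟦+⟧ a b))))

  lmul-↦ : ∀ {l m a b} → l ↦ a → m ↦ b → lmul l m ↦ a ℤ.* b
  lmul-↦ {l} {m} {a} {b} (mk p) (mk q) = mk (trans (evL-lmul l m) (trans (cong₂ _*_ p q) (sym (⟦*⟧ a b))))

  lneg-↦ : ∀ {l a} → l ↦ a → lneg l ↦ ℤ.- a
  lneg-↦ {l} {a} (mk p) = mk (trans (evL-lneg l) (trans (cong -_ p) (sym (⟦neg⟧ a))))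

  lzero-↦ : lzero ↦ 0ℤ
  lzero-↦ = mk (zeroʳ _)

  lone-↦ : lone ↦ 1ℤ
  lone-↦ = mk (trans (*-identityˡ _) (trans (cong (_+_ ⟦ 1ℤ ⟧) (zeroʳ x)) (+-identityʳ _)))

  infix 4 _≈↦_
  record _≈↦_ (f : Series) (g : PS) : Set where
    constructor mk↦
    field at↦ : ∀ n → f n ↦ coeff g n
  open _≈↦_

  module S = PowerSeries

  ↦-≡ : ∀ {l a b} → a ≡ b → l ↦ a → l ↦ b
  ↦-≡ refl p = p

  sone-↦ : sone ≈↦ S.1#
  sone-↦ = mk↦ λ { zero → lone-↦ ; (suc n) → lzero-↦ }

  tpow-↦ : ∀ i → tpow i ≈↦ mono i
  tpow-↦ i = mk↦ (go i)
    where
    go : ∀ i n → tpow i n ↦ δ i n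
    go zero    zero    = lone-↦
    go zero    (suc n) = lzero-↦
    go (suc i) zero    = lzero-↦
    go (suc i) (suc n) = go i n

  sadd-↦ : ∀ {f g F G} → f ≈↦ F → g ≈↦ G → sadd f g ≈↦ F S.+ G
  sadd-↦ p q = mk↦ λ n → ladd-↦ (at↦ p n) (at↦ q n)

  ssub-↦ : ∀ {f g F G} → f ≈↦ F → g ≈↦ G → ssub f g ≈↦ F S.- G
  ssub-↦ p q = mk↦ λ n → ladd-↦ (at↦ p n) (lneg-↦ (at↦ q n))

  smul-↦ : ∀ {f g F G} → f ≈↦ F → g ≈↦ G → smul f g ≈↦ F S.* G
  smul-↦ {f} {g} {F} {G} p q = mk↦ λ n →
    subst (λ ls → lsum ls ↦ coeff (F S.* G) n) (sym (map-upTo (λ k → lmul (f k) (g (n ∸ k))) (suc n)))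
      (go f (coeff F) (at↦ p) n)
    where
    go : ∀ f F → (∀ n → f n ↦ F n) → ∀ n → lsum (applyUpTo (λ k → lmul (f k) (g (n ∸ k))) (suc n)) ↦ conv F (coeff G) n
    go f F p zero    = ↦-≡ (ℤP.+-identityʳ _) (ladd-↦ (lmul-↦ (p 0) (at↦ q 0)) lzero-↦)
    go f F p (suc n) = ladd-↦ (lmul-↦ (p 0) (at↦ q (suc n))) (go (f ∘ suc) (F ∘ suc) (p ∘ suc) n)

  data _↦*_ : List Laurent → List ℤ → Set where
    []  : [] ↦* []
    _∷_ : ∀ {l a ls as} → l ↦ a → ls ↦* as → (l ∷ ls) ↦* (a ∷ as)

  dot-↦ : ∀ {f F} → f ≈↦ F → ∀ k {ls as} → ls ↦* as → dotL f k ls ↦ dotℤ (coeff F) k as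
  dot-↦ p k []       = lzero-↦
  dot-↦ p k (q ∷ qs) = ladd-↦ (lmul-↦ (at↦ p k) q) (dot-↦ p (suc k) qs)

  sinvRev-↦ : ∀ {f F} → f ≈↦ F → ∀ n → sinvRev f n ↦* invRev (coeff F) n
  sinvRev-↦ p zero    = lone-↦ ∷ []
  sinvRev-↦ {f} {F} p (suc n) = subst (_↦* invRev (coeff F) (suc n)) (sym (sinvRev-suc f n))
    (lneg-↦ (dot-↦ p 1 (sinvRev-↦ p n)) ∷ sinvRev-↦ p n)

  sinv-↦ : ∀ {f F} → f ≈↦ F → sinv f ≈↦ invₛ F
  sinv-↦ {f} {F} p = mk↦ go
    where
    go : ∀ n → sinv f n ↦ coeff (invₛ F) n
    go n with sinvRev f n | invRev (coeff F) n | sinvRev-↦ p n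
    ... | _ | _ | []    = lzero-↦
    ... | _ | _ | q ∷ _ = q

  module AtPoint (c : ℤ) (x+x⁻¹ : x + x⁻¹ ≡ ⟦ c ⟧) where

    lq+q⁻¹-↦ : lq+q⁻¹ ↦ c
    lq+q⁻¹-↦ = mk (begin
      x⁻¹ * 1# * (⟦ 1ℤ ⟧ + x * (0# + x * (⟦ 1ℤ ⟧ + x * 0#)))
        ≡⟨ cong₂ (λ u w → x⁻¹ * u * (⟦ 1ℤ ⟧ + x * (0# + x * (⟦ 1ℤ ⟧ + w)))) (sym ⟦1⟧) (zeroʳ x) ⟩
      x⁻¹ * ⟦ 1ℤ ⟧ * (⟦ 1ℤ ⟧ + x * (0# + x * (⟦ 1ℤ ⟧ + 0#)))
        ≡⟨ solve 2 (λ x y → y :* con 1ℤ :* (con 1ℤ :+ x :* (con 0ℤ :+ x :* (con 1ℤ :+ con 0ℤ))) := (y :* x) :* x :+ y)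
             refl x x⁻¹ ⟩
      (x⁻¹ * x) * x + x⁻¹ ≡⟨ cong (λ u → u * x + x⁻¹) x*x⁻¹ ⟩
      1# * x + x⁻¹        ≡⟨ cong (_+ x⁻¹) (*-identityˡ x) ⟩
      x + x⁻¹             ≡⟨ x+x⁻¹ ⟩
      ⟦ c ⟧ ∎)

    factor-↦ : ∀ i → factor i ≈↦ factorₛ c i
    factor-↦ i = smul-↦ (smul-↦ num-↦ num-↦) (sinv-↦ (sadd-↦ (ssub-↦ sone-↦ scale-↦) (tpow-↦ (i ℕ.+ i))))
      where
      num-↦ : ssub sone (tpow i) ≈↦ S.1# S.- mono i
      num-↦ = ssub-↦ sone-↦ (tpow-↦ i)
      scale-↦ : sscale lq+q⁻¹ (tpow i) ≈↦ constₛ c S.* mono i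
      scale-↦ = mk↦ λ n → ↦-≡ (sym (Truncation.coeff-const* c (mono i) n)) (lmul-↦ lq+q⁻¹-↦ (at↦ (tpow-↦ i) n))

    prodTo-↦ : ∀ N → prodTo N ≈↦ prodₛ c N
    prodTo-↦ zero    = sone-↦
    prodTo-↦ (suc N) = smul-↦ (prodTo-↦ N) (factor-↦ (suc N))

    Cat-value : ∀ n → Cat R x x⁻¹ n ≡ pow n * ⟦ coeff (prodₛ c n) n ⟧
    Cat-value n = trans (evL-lmul (lqpow n) (coeffProd n)) (cong₂ _*_ (evL-lqpow n) (value (at↦ (prodTo-↦ n) n)))

  pdivQm1-correct : ∀ p → evP p ≡ (x - 1#) * evP (proj₁ (pdivQm1 p)) + ⟦ proj₂ (pdivQm1 p) ⟧
  pdivQm1-correct []       = sym (trans (+-identityʳ _) (zeroʳ _))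
  pdivQm1-correct (a ∷ as) with pdivQm1 as | pdivQm1-correct as
  ... | s′ , r′ | ih = begin
    ⟦ a ⟧ + x * evP as ≡⟨ cong (λ u → ⟦ a ⟧ + x * u) ih ⟩
    ⟦ a ⟧ + x * ((x - 1#) * evP s′ + ⟦ r′ ⟧) ≡⟨ cong (λ u → ⟦ a ⟧ + x * ((x - u) * evP s′ + ⟦ r′ ⟧)) (sym ⟦1⟧) ⟩
    ⟦ a ⟧ + x * ((x - ⟦ 1ℤ ⟧) * evP s′ + ⟦ r′ ⟧)
      ≡⟨ solve 4 (λ a x s r → a :+ x :* ((x :- con 1ℤ) :* s :+ r) := (x :- con 1ℤ) :* (r :+ x :* s) :+ (a :+ r)) refl
           ⟦ a ⟧ x (evP s′) ⟦ r′ ⟧ ⟩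
    (x - ⟦ 1ℤ ⟧) * (⟦ r′ ⟧ + x * evP s′) + (⟦ a ⟧ + ⟦ r′ ⟧)
      ≡⟨ cong₂ (λ u w → (x - u) * (⟦ r′ ⟧ + x * evP s′) + w) ⟦1⟧ (sym (⟦+⟧ a r′)) ⟩
    (x - 1#) * (⟦ r′ ⟧ + x * evP s′) + ⟦ a ℤ.+ r′ ⟧ ∎

  DoubleRoot : Poly → Set
  DoubleRoot p = proj₂ (pdivQm1 p) ≡ 0ℤ × proj₂ (pdivQm1 (proj₁ (pdivQm1 p))) ≡ 0ℤ

  -- The divisions act on the numerator; the power of q⁻¹ in front of it passes through.
  Pat-value : ∀ n → DoubleRoot (proj₂ (Cpoly n)) → (x - 1#) * (x - 1#) * Pat R x x⁻¹ n ≡ Cat R x x⁻¹ n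
  Pat-value n (r₁ , r₂) = begin
    (x - 1#) * (x - 1#) * (pow⁻¹ k * evP s₂)
      ≡⟨ solve 3 (λ y k s → y :* y :* (k :* s) := k :* (y :* (y :* s))) refl (x - 1#) (pow⁻¹ k) (evP s₂) ⟩
    pow⁻¹ k * ((x - 1#) * ((x - 1#) * evP s₂)) ≡⟨ cong (λ u → pow⁻¹ k * ((x - 1#) * u)) (exact s₁ r₂) ⟩
    pow⁻¹ k * ((x - 1#) * evP s₁)              ≡⟨ cong (_*_ (pow⁻¹ k)) (exact p r₁) ⟩
    pow⁻¹ k * evP p ∎
    where
    k = proj₁ (Cpoly n)
    p = proj₂ (Cpoly n)
    s₁ = proj₁ (pdivQm1 p)
    s₂ = proj₁ (pdivQm1 s₁)
    exact : ∀ p → proj₂ (pdivQm1 p) ≡ 0ℤ → (x - 1#) * evP (proj₁ (pdivQm1 p)) ≡ evP p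
    exact p e = trans (sym (+-identityʳ _)) (trans (cong (λ z → (x - 1#) * evP (proj₁ (pdivQm1 p)) + ⟦ z ⟧) (sym e))
      (sym (pdivQm1-correct p)))

-- Rings of pairs: Gaussian and Eisenstein rationals, dual numbers

module PairRing {A : Set} {_+_ _*_ : A → A → A} { -_ : A → A} {0# 1# : A}
  (isCR : IsCommutativeRing _≡_ _+_ _*_ -_ 0# 1#) where
  module A = IsCommutativeRing isCR

  -- Addition is componentwise in all three rings, so only the laws of multiplication have to be
  -- supplied for each.
  isCommutativeRing : (_⊗_ : A × A → A × A → A × A) (𝟙 : A × A) →
    let _⊕_ : A × A → A × A → A × A
        p ⊕ q = proj₁ p + proj₁ q , proj₂ p + proj₂ q
    in
    (∀ p q r → (p ⊗ q) ⊗ r ≡ p ⊗ (q ⊗ r)) → (∀ p q → p ⊗ q ≡ q ⊗ p) → (∀ p → 𝟙 ⊗ p ≡ p) →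
    (∀ p q r → p ⊗ (q ⊕ r) ≡ (p ⊗ q) ⊕ (p ⊗ r)) →
    IsCommutativeRing _≡_ _⊕_ _⊗_ (λ p → - proj₁ p , - proj₂ p) (0# , 0#) 𝟙
  isCommutativeRing _⊗_ 𝟙 assoc comm idˡ distribˡ = record
    { isRing = record
      { +-isAbelianGroup = record
        { isGroup = record
          { isMonoid = record
            { isSemigroup = record
              { isMagma = record { isEquivalence = isEquivalence ; ∙-cong = cong₂ (λ u w → proj₁ u + proj₁ w , proj₂ u + proj₂ w) }
              ; assoc = λ p q r → cong₂ _,_ (A.+-assoc _ _ _) (A.+-assoc _ _ _) }
            ; identity = (λ p → cong₂ _,_ (A.+-identityˡ _) (A.+-identityˡ _)) , λ p → cong₂ _,_ (A.+-identityʳ _)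
              (A.+-identityʳ _) }
          ; inverse = (λ p → cong₂ _,_ (A.-‿inverseˡ _) (A.-‿inverseˡ _)) , λ p → cong₂ _,_ (A.-‿inverseʳ _)
            (A.-‿inverseʳ _)
          ; ⁻¹-cong = cong (λ p → - proj₁ p , - proj₂ p) }
        ; comm = λ p q → cong₂ _,_ (A.+-comm _ _) (A.+-comm _ _) }
      ; *-cong = cong₂ _⊗_
      ; *-assoc = assoc
      ; *-identity = idˡ , λ p → trans (comm p 𝟙) (idˡ p)
      ; distrib = distribˡ , λ p q r → trans (comm _ p)
        (trans (distribˡ p q r) (cong₂ (λ u w → proj₁ u + proj₁ w , proj₂ u + proj₂ w) (comm p q) (comm p r))) }
    ; *-comm = comm }

ℚ-isCR : IsCommutativeRing _≡_ ℚ._+_ ℚ._*_ ℚ.-_ ℚ.0ℚ ℚ.1ℚ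
ℚ-isCR = ℚP.+-*-isCommutativeRing

ℚ[i]-isCR : IsCommutativeRing _≡_ (RingOps._⊕_ ℚ[i]R) gmul (RingOps.⊖_ ℚ[i]R) (ℚ.0ℚ , ℚ.0ℚ) (ℚ.1ℚ , ℚ.0ℚ)
ℚ[i]-isCR = PairRing.isCommutativeRing ℚ-isCR gmul (ℚ.1ℚ , ℚ.0ℚ)
  (λ { (a , b) (c , d) (e , f) → cong₂ _,_
    (solve 6 (λ a b c d e f → (a :* c :- b :* d) :* e :- (a :* d :+ b :* c) :* f := a :* (c :* e :- d :* f) :- b :*
      (c :* f :+ d :* e)) refl a b c d e f)
    (solve 6 (λ a b c d e f → (a :* c :- b :* d) :* f :+ (a :* d :+ b :* c) :* e := a :* (c :* f :+ d :* e) :+ b :*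
      (c :* e :- d :* f)) refl a b c d e f) })
  (λ { (a , b) (c , d) → cong₂ _,_
    (solve 4 (λ a b c d → a :* c :- b :* d := c :* a :- d :* b) refl a b c d)
    (solve 4 (λ a b c d → a :* d :+ b :* c := c :* b :+ d :* a) refl a b c d) })
  (λ { (a , b) → cong₂ _,_
    (solve 2 (λ a b → con ℚ.1ℚ :* a :- con ℚ.0ℚ :* b := a) refl a b)
    (solve 2 (λ a b → con ℚ.1ℚ :* b :+ con ℚ.0ℚ :* a := b) refl a b) })
  (λ { (a , b) (c , d) (e , f) → cong₂ _,_
    (solve 6 (λ a b c d e f → a :* (c :+ e) :- b :* (d :+ f) := (a :* c :- b :* d) :+ (a :* e :- b :* f)) refl a b c d
      e f)
    (solve 6 (λ a b c d e f → a :* (d :+ f) :+ b :* (c :+ e) := (a :* d :+ b :* c) :+ (a :* f :+ b :* e)) refl a b c d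
      e f) })
  where open ℚSolver

ℚ[j]-isCR : IsCommutativeRing _≡_ (RingOps._⊕_ ℚ[j]R) emul (RingOps.⊖_ ℚ[j]R) (ℚ.0ℚ , ℚ.0ℚ) (ℚ.1ℚ , ℚ.0ℚ)
ℚ[j]-isCR = PairRing.isCommutativeRing ℚ-isCR emul (ℚ.1ℚ , ℚ.0ℚ)
  (λ { (a , b) (c , d) (e , f) → cong₂ _,_
    (solve 6 (λ a b c d e f → (a :* c :- b :* d) :* e :- (a :* d :+ b :* c :- b :* d) :* f
                := a :* (c :* e :- d :* f) :- b :* (c :* f :+ d :* e :- d :* f)) refl a b c d e f)
    (solve 6 (λ a b c d e f → (a :* c :- b :* d) :* f :+ (a :* d :+ b :* c :- b :* d) :* e :-
      (a :* d :+ b :* c :- b :* d) :* f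
                := a :* (c :* f :+ d :* e :- d :* f) :+ b :* (c :* e :- d :* f) :- b :* (c :* f :+ d :* e :- d :* f))
                  refl a b c d e f) })
  (λ { (a , b) (c , d) → cong₂ _,_
    (solve 4 (λ a b c d → a :* c :- b :* d := c :* a :- d :* b) refl a b c d)
    (solve 4 (λ a b c d → a :* d :+ b :* c :- b :* d := c :* b :+ d :* a :- d :* b) refl a b c d) })
  (λ { (a , b) → cong₂ _,_
    (solve 2 (λ a b → con ℚ.1ℚ :* a :- con ℚ.0ℚ :* b := a) refl a b)
    (solve 2 (λ a b → con ℚ.1ℚ :* b :+ con ℚ.0ℚ :* a :- con ℚ.0ℚ :* b := b) refl a b) })
  (λ { (a , b) (c , d) (e , f) → cong₂ _,_
    (solve 6 (λ a b c d e f → a :* (c :+ e) :- b :* (d :+ f) := (a :* c :- b :* d) :+ (a :* e :- b :* f)) refl a b c d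
      e f)
    (solve 6 (λ a b c d e f → a :* (d :+ f) :+ b :* (c :+ e) :- b :* (d :+ f)
                := (a :* d :+ b :* c :- b :* d) :+ (a :* f :+ b :* e :- b :* f)) refl a b c d e f) })
  where open ℚSolver

-- Dual numbers a + b ε over ℤ: evaluation at q = 1 + ε detects the double root at 1,
-- since q + q⁻¹ = 2 makes every factor of the product equal to 1.
dmul : ℤ × ℤ → ℤ × ℤ → ℤ × ℤ
dmul (a , b) (c , d) = a ℤ.* c , a ℤ.* d ℤ.+ b ℤ.* c

dualR : RingOps
dualR = record
  { Carrier = ℤ × ℤ
  ; _⊕_ = λ { (a , b) (c , d) → a ℤ.+ c , b ℤ.+ d }
  ; _⊗_ = dmul
  ; ⊖_ = λ { (a , b) → ℤ.- a , ℤ.- b }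
  ; 𝟘 = 0ℤ , 0ℤ
  ; 𝟙 = 1ℤ , 0ℤ }

dual-isCR : IsCommutativeRing _≡_ (RingOps._⊕_ dualR) dmul (RingOps.⊖_ dualR) (0ℤ , 0ℤ) (1ℤ , 0ℤ)
dual-isCR = PairRing.isCommutativeRing ℤP.+-*-isCommutativeRing dmul (1ℤ , 0ℤ)
  (λ { (a , b) (c , d) (e , f) → cong₂ _,_ (ℤP.*-assoc a c e)
    (solve 6 (λ a b c d e f → (a :* c) :* f :+ (a :* d :+ b :* c) :* e := a :* (c :* f :+ d :* e) :+ b :* (c :* e))
      refl a b c d e f) })
  (λ { (a , b) (c , d) → cong₂ _,_ (ℤP.*-comm a c) (solve 4 (λ a b c d → a :* d :+ b :* c := c :* b :+ d :* a) refl a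
    b c d) })
  (λ { (a , b) → cong₂ _,_ (ℤP.*-identityˡ a) (solve 2 (λ a b → con 1ℤ :* b :+ con 0ℤ :* a := b) refl a b) })
  (λ { (a , b) (c , d) (e , f) → cong₂ _,_ (ℤP.*-distribˡ-+ a c e)
    (solve 6 (λ a b c d e f → a :* (d :+ f) :+ b :* (c :+ e) := (a :* d :+ b :* c) :+ (a :* f :+ b :* e)) refl a b c d
      e f) })
  where open ℤSolver

-- The double root of C_n at q = 1

module Divisibility where
  1+ε 1-ε : ℤ × ℤ
  1+ε = 1ℤ , 1ℤ
  1-ε = 1ℤ , ℤ.- 1ℤ

  open Evaluation dualR dual-isCR 1+ε 1-ε refl
  open AtPoint (+ 2) refl
  open IntegerImage dualR dual-isCR using (⟦_⟧; _*_; *-identityˡ; *-assoc; zeroʳ)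
  open ≡-Reasoning
  open PowerSeries using (coeff)
  open ProductExpansion using (prodₛ; coeff-Appell; lambert)

  natR-dual : ∀ n → natR dualR n ≡ (+ n , 0ℤ)
  natR-dual zero    = refl
  natR-dual (suc n) rewrite natR-dual n = refl

  ⟦⟧-dual : ∀ z → ⟦ z ⟧ ≡ (z , 0ℤ)
  ⟦⟧-dual (+ n)    = natR-dual n
  ⟦⟧-dual -[1+ n ] = cong (λ p → ℤ.- proj₁ p , ℤ.- proj₂ p) (natR-dual (suc n))

  -- At 1 + ε the value of C_n has the factor 2 - c = 0. The division by q - 1 sees the numerator
  -- `p` only, so the power of q⁻¹ is undone by `pow k`.
  Cpoly-root : ∀ n → evP (proj₂ (Cpoly (suc n))) ≡ (0ℤ , 0ℤ)
  Cpoly-root n = begin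
    evP p                       ≡⟨ sym (*-identityˡ (evP p)) ⟩
    (1ℤ , 0ℤ) * evP p           ≡⟨ cong (_* evP p) (sym (pow*pow⁻¹ k)) ⟩
    pow k * pow⁻¹ k * evP p     ≡⟨ *-assoc (pow k) (pow⁻¹ k) (evP p) ⟩
    pow k * (pow⁻¹ k * evP p)   ≡⟨ cong (pow k *_) (Cat-value (suc n)) ⟩
    pow k * (pow (suc n) * ⟦ coeff (prodₛ (+ 2) (suc n)) (suc n) ⟧)
      ≡⟨ cong (λ z → pow k * (pow (suc n) * ⟦ z ⟧)) (trans (coeff-Appell (+ 2) n)
           (ℤP.*-zeroˡ (lambert (+ 2) (suc n)))) ⟩
    pow k * (pow (suc n) * (0ℤ , 0ℤ)) ≡⟨ trans (cong (pow k *_) (zeroʳ (pow (suc n)))) (zeroʳ (pow k)) ⟩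
    (0ℤ , 0ℤ) ∎
    where
    k = proj₁ (Cpoly (suc n))
    p = proj₂ (Cpoly (suc n))
    pow*pow⁻¹ : ∀ k → pow k * pow⁻¹ k ≡ (1ℤ , 0ℤ)
    pow*pow⁻¹ k = trans (IntegerImage.*-comm dualR dual-isCR (pow k) (pow⁻¹ k)) (pow⁻¹*pow k)

  open IntegerImage dualR dual-isCR using () renaming (_+_ to _⊞_)
  -- The pair `(0ℤ , 1ℤ)` is ε = x - 1. The components on the right are thus the remainder and the
  -- value of the quotient at q = 1, and the latter is the remainder of the next division.
  divide : ∀ p → evP p ≡ dmul (0ℤ , 1ℤ) (evP (proj₁ (pdivQm1 p))) ⊞ (proj₂ (pdivQm1 p) , 0ℤ)
  divide p = trans (pdivQm1-correct p) (cong (λ u → dmul (0ℤ , 1ℤ) (evP (proj₁ (pdivQm1 p))) ⊞ u)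
    (⟦⟧-dual (proj₂ (pdivQm1 p))))

  Cpoly-doubleRoot : ∀ n → DoubleRoot (proj₂ (Cpoly (suc n)))
  Cpoly-doubleRoot n = r₁ , r₂
    where
    p = proj₂ (Cpoly (suc n))
    s₁ = proj₁ (pdivQm1 p)
    eq : (0ℤ , 0ℤ) ≡ _
    eq = trans (sym (Cpoly-root n)) (divide p)
    r₁ : proj₂ (pdivQm1 p) ≡ 0ℤ
    r₁ = trans (sym (ℤP.+-identityˡ _)) (sym (cong proj₁ eq))
    s₁-root : proj₁ (evP s₁) ≡ 0ℤ
    s₁-root = trans (sym (trans (ℤP.+-identityʳ _) (trans (ℤP.+-identityˡ _) (ℤP.*-identityˡ _)))) (sym (cong proj₂ eq))
    r₂ : proj₂ (pdivQm1 s₁) ≡ 0ℤ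
    r₂ = trans (sym (ℤP.+-identityˡ _)) (trans (sym (cong proj₁ (divide s₁))) s₁-root)

-- Sums over factorisations

module DivisorPairs where
  open import Data.Integer using (_+_; _*_)
  open FiniteSum ℤP.+-*-commutativeRing
  open ≡-Reasoning
  open ProductExpansion using (lambert)

  pairTerm : ℕ → (ℕ → ℕ → ℤ) → ℕ → ℕ → ℤ
  pairTerm M f n s = δ (n ℕ.* s) M * f n s

  -- Sums f over all n s = M only for M ≥ 1: the range is truncated at M.
  PSum : ℕ → (ℕ → ℕ → ℤ) → ℤ
  PSum M f = ∑ (suc M) (λ n → ∑ (suc M) (pairTerm M f n))

  δ*-zero : ∀ {m n} x → m ≢ n → δ m n * x ≡ 0ℤ
  δ*-zero x ne = trans (cong (_* x) (δ-≢ ne)) (ℤP.*-zeroˡ x)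

  product-bounds : ∀ n s M → n ℕ.* s ≡ suc M → n ≤ suc M × s ≤ suc M
  product-bounds zero    s       M ()
  product-bounds (suc n) zero    M e = contradiction (trans (sym (ℕP.*-zeroʳ n)) e) λ ()
  product-bounds (suc n) (suc s) M e = subst (suc n ≤_) e (ℕP.m≤m*n (suc n) (suc s)) , subst (suc s ≤_) e
    (ℕP.m≤n*m (suc s) (suc n))

  PSum-bounds : ∀ {M K L} f → suc (suc M) ≤ K → suc (suc M) ≤ L → ∑ K (λ n → ∑ L (pairTerm (suc M) f n)) ≡ PSum
    (suc M) f
  PSum-bounds {M} {K} {L} f M<K M<L = trans
    (∑-extend M<K (λ n M<n → ∑-zero L (λ s _ → δ*-zero {n ℕ.* s} (f n s)
      (λ e → ℕP.<⇒≱ M<n (proj₁ (product-bounds n s M e))))))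
    (∑-cong (suc (suc M)) (λ n → ∑-extend M<L (λ s M<s → δ*-zero {n ℕ.* s} (f n s)
      (λ e → ℕP.<⇒≱ M<s (proj₂ (product-bounds n s M e))))))

  PSum-cong : ∀ M {f g} → (∀ n s → n ℕ.* s ≡ M → f n s ≡ g n s) → PSum M f ≡ PSum M g
  PSum-cong M h = ∑-cong (suc M) (λ n → ∑-cong (suc M) (λ s → δ-*-cong (h n s)))

  PSum-swap : ∀ M f → PSum M f ≡ PSum M (λ n s → f s n)
  PSum-swap M f = trans (∑-swap (suc M) (suc M) (pairTerm M f))
    (∑-cong (suc M) (λ s → ∑-cong (suc M) (λ n → cong (λ k → δ k M * f n s) (ℕP.*-comm n s))))

  PSum-+ : ∀ M f g → PSum M (λ n s → f n s + g n s) ≡ PSum M f + PSum M g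
  PSum-+ M f g = trans (∑-cong (suc M) (λ n → trans (∑-cong (suc M)
    (λ s → ℤP.*-distribˡ-+ (δ (n ℕ.* s) M) (f n s) (g n s)))
                                                   (∑-distrib-+ (suc M) (pairTerm M f n) (pairTerm M g n))))
                       (∑-distrib-+ (suc M) _ _)

  PSum-* : ∀ M a f → PSum M (λ n s → a * f n s) ≡ a * PSum M f
  PSum-* M a f = sym (trans (*-distribˡ-∑ (suc M) a _) (∑-cong (suc M) (λ n → trans (*-distribˡ-∑ (suc M) a _)
    (∑-cong (suc M) (λ s → solve 3 (λ a d f → a :* (d :* f) := d :* (a :* f)) refl a (δ (n ℕ.* s) M) (f n s))))))
    where open ℤSolver

  PSum-zero : ∀ M {f} → (∀ n s → n ℕ.* s ≡ M → f n s ≡ 0ℤ) → PSum M f ≡ 0ℤ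
  PSum-zero M h = trans (PSum-cong M {g = λ _ _ → 0ℤ} h)
    (∑-zero (suc M) (λ n _ → ∑-zero (suc M) (λ s _ → ℤP.*-zeroʳ (δ (n ℕ.* s) M))))

  -- The range of `n` is first stretched to a multiple of `suc p`, so that it splits into whole
  -- blocks.
  PSum-multiplesˡ : ∀ p M f → (∀ n s → suc p ∤ n → f n s ≡ 0ℤ) →
    PSum (suc M) f ≡ ∑ (suc (suc M)) (λ i → ∑ (suc (suc M)) (λ s → δ (i ℕ.* suc p ℕ.* s) (suc M) * f (i ℕ.* suc p) s))
  PSum-multiplesˡ p M f h = trans (sym (PSum-bounds f (ℕP.m≤m*n (suc (suc M)) (suc p)) ℕP.≤-refl))
    (∑-multiples (suc (suc M)) p _ (λ n p∤n → ∑-zero (suc (suc M)) (λ s _ →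
      trans (cong (δ (n ℕ.* s) (suc M) *_) (h n s p∤n)) (ℤP.*-zeroʳ (δ (n ℕ.* s) (suc M))))))

  lt : ℕ → ℕ → ℤ
  lt n       zero    = 0ℤ
  lt zero    (suc s) = 1ℤ
  lt (suc n) (suc s) = lt n s

  lt-≤ : ∀ {n s} → s ≤ n → lt n s ≡ 0ℤ
  lt-≤ z≤n     = refl
  lt-≤ (s≤s p) = lt-≤ p

  lt-+ : ∀ n k → lt n (k ℕ.+ suc n) ≡ 1ℤ
  lt-+ zero    k rewrite ℕP.+-comm k 1 = refl
  lt-+ (suc n) k rewrite ℕP.+-suc k (suc n) = lt-+ n k

  lt-split : ∀ n s x → (n ≡ s → x ≡ 0ℤ) → x ≡ lt n s * x + lt s n * x
  lt-split zero    zero    x h = trans (h refl) (sym (trans (cong₂ _+_ (ℤP.*-zeroˡ x) (ℤP.*-zeroˡ x)) refl))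
  lt-split zero    (suc s) x h = sym (trans (cong₂ _+_ (ℤP.*-identityˡ x) (ℤP.*-zeroˡ x)) (ℤP.+-identityʳ x))
  lt-split (suc n) zero    x h = sym (trans (cong₂ _+_ (ℤP.*-zeroˡ x) (ℤP.*-identityˡ x)) (ℤP.+-identityˡ x))
  lt-split (suc n) (suc s) x h = lt-split n s x (h ∘ cong suc)

  -- Symmetry exchanges the parts n < s and n > s, and the diagonal contributes nothing.
  PSum-symmetric : ∀ M f → (∀ n s → f n s ≡ f s n) → (∀ n → f n n ≡ 0ℤ) →
                   PSum M f ≡ + 2 * PSum M (λ n s → lt n s * f n s)
  PSum-symmetric M f f-sym f-diag = begin
    PSum M f ≡⟨ PSum-cong M (λ n s _ → lt-split n s (f n s) (λ { refl → f-diag n })) ⟩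
    PSum M (λ n s → lt n s * f n s + lt s n * f n s) ≡⟨ PSum-+ M (λ n s → lt n s * f n s) (λ n s → lt s n * f n s) ⟩
    P + PSum M (λ n s → lt s n * f n s) ≡⟨ cong (λ z → P + z)
      (trans (PSum-swap M (λ n s → lt s n * f n s)) (PSum-cong M (λ n s _ → cong (lt n s *_) (f-sym s n)))) ⟩
    P + P ≡⟨ solve 1 (λ p → p :+ p := con (+ 2) :* p) refl P ⟩
    + 2 * P ∎
    where
    open ℤSolver
    P = PSum M (λ n s → lt n s * f n s)

  tri-double : ∀ n → tri n ℕ.+ tri n ≡ n ℕ.* suc n
  tri-double zero    = refl
  tri-double (suc n) = trans (solve 2 (λ n t → (con 1 :+ n :+ t) :+ (con 1 :+ n :+ t) := (t :+ t) :+
    (con 2 :+ n :+ n)) refl n (tri n))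
    (trans (cong (ℕ._+ (2 ℕ.+ n ℕ.+ n)) (tri-double n))
           (solve 1 (λ n → n :* (con 1 :+ n) :+ (con 2 :+ n :+ n) := (con 1 :+ n) :* (con 2 :+ n)) refl n))
    where open ℕSolver

  -- `tri n + k n` is the sum (k+1) + ... + (k+n) of n consecutive integers, and first and last add
  -- up to n + 2k + 1.
  trapezoid : ∀ n k → n ℕ.* (k ℕ.* 2 ℕ.+ suc n) ≡ (tri n ℕ.+ k ℕ.* n) ℕ.+ (tri n ℕ.+ k ℕ.* n)
  trapezoid n k = sym (trans (solve 3 (λ t k n → (t :+ k :* n) :+ (t :+ k :* n) := (t :+ t) :+ n :* (k :* con 2)) refl
    (tri n) k n)
    (trans (cong (ℕ._+ n ℕ.* (k ℕ.* 2)) (tri-double n))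
      (solve 2 (λ n k → n :* (con 1 :+ n) :+ n :* (k :* con 2) := n :* (k :* con 2 :+ (con 1 :+ n))) refl n k)))
    where open ℕSolver

  double-injective : ∀ {m n} → m ℕ.+ m ≡ n ℕ.+ n → m ≡ n
  double-injective {m} {n} e = ℕP.*-cancelʳ-≡ m n 2 (trans (twice m) (trans e (sym (twice n))))
    where
    twice : ∀ m → m ℕ.* 2 ≡ m ℕ.+ m
    twice m = trans (ℕP.*-comm m 2) (cong (m ℕ.+_) (ℕP.+-identityʳ m))

  -- tri n + k n = N iff n s = 2N for s = n + 2k + 1.
  PSum-lambert : ∀ c m N′ f → let N = suc N′ in (∀ n s → f n s ≡ f s n) → (∀ n → f n n ≡ 0ℤ) →
    (∀ n k → f n (k ℕ.* 2 ℕ.+ suc n) ≡ m * (sgn n * v c k)) → (∀ n i → 2 ∤ i → f n (i ℕ.+ suc n) ≡ 0ℤ) →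
    PSum (N ℕ.+ N) f ≡ + 2 * (m * lambert c N)
  PSum-lambert c m N′ f f-sym f-diag f-even f-odd = trans (PSum-symmetric (N ℕ.+ N) f f-sym f-diag)
    (cong (+ 2 *_) (begin
    PSum (N ℕ.+ N) g ≡⟨ ∑-cong (suc (N ℕ.+ N)) row ⟩
    ∑ (suc (N ℕ.+ N)) (λ n → ∑ (suc N) (term n)) ≡⟨ ∑-head (N ℕ.+ N) _ ⟩
    ∑ (suc N) (term 0) + ∑ (N ℕ.+ N) (λ j → ∑ (suc N) (term (suc j)))
      ≡⟨ cong (_+ ∑ (N ℕ.+ N) (λ j → ∑ (suc N) (term (suc j))))
           (∑-zero (suc N) (λ k _ → ℤP.*-zeroˡ (m * (sgn 0 * v c k)))) ⟩
    0ℤ + ∑ (N ℕ.+ N) (λ j → ∑ (suc N) (term (suc j))) ≡⟨ ℤP.+-identityˡ _ ⟩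
    ∑ (N ℕ.+ N) (λ j → ∑ (suc N) (term (suc j)))
      -- The range shrinks to that of `lambert`: for n = j + 1 > N and s > n the product n s already
      -- exceeds 2N.
      ≡⟨ ∑-extend (ℕP.m≤m+n N N) (λ j N≤j → ∑-zero (suc N)
           (λ k _ → δ*-zero {suc j ℕ.* (k ℕ.* 2 ℕ.+ suc (suc j))} _ (too-large j k N≤j))) ⟩
    ∑ N (λ j → ∑ (suc N) (term (suc j)))
      ≡⟨ ∑-cong N (λ j → trans (∑-cong (suc N) (λ k → trans (cong (_* (m * (sgn (suc j) * v c k))) (δ-half (suc j) k))
            (solve 4 (λ d m s v → d :* (m :* (s :* v)) := m :* (s :* v :* d)) refl (δ (tri (suc j) ℕ.+ k ℕ.* suc j) N)
              m (sgn (suc j)) (v c k))))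
            (sym (*-distribˡ-∑ (suc N) m _))) ⟩
    ∑ N (λ j → m * ∑ (suc N) (λ k → sgn (suc j) * v c k * δ (tri (suc j) ℕ.+ k ℕ.* suc j) N))
      ≡⟨ sym (*-distribˡ-∑ N m _) ⟩
    m * lambert c N ∎))
    where
    open ℤSolver
    N = suc N′
    M = N ℕ.+ N
    g : ℕ → ℕ → ℤ
    g n s = lt n s * f n s
    term : ℕ → ℕ → ℤ
    term n k = δ (n ℕ.* (k ℕ.* 2 ℕ.+ suc n)) M * (m * (sgn n * v c k))
    row : ∀ n → ∑ (suc M) (pairTerm M g n) ≡ ∑ (suc N) (term n)
    row n = begin
      ∑ (suc M) (pairTerm M g n)
        -- The range of `s` is stretched to n + 1 + 2 (N + 1): `lt` kills the first n + 1 values,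
        -- and among the remaining offsets only the even ones, 2k, survive.
        ≡⟨ sym (∑-extend {K′ = suc N ℕ.* 2 ℕ.+ suc n} (ℕP.≤-trans M≤ (ℕP.m≤m+n _ (suc n)))
             (λ s M<s → δ*-zero {n ℕ.* s} _ (λ e → ℕP.<⇒≱ M<s (proj₂ (product-bounds n s _ e))))) ⟩
      ∑ (suc N ℕ.* 2 ℕ.+ suc n) (pairTerm M g n) ≡⟨ ∑-concat (suc n) (suc N ℕ.* 2) _ ⟩
      ∑ (suc n) (pairTerm M g n) + ∑ (suc N ℕ.* 2) (λ i → pairTerm M g n (i ℕ.+ suc n))
        ≡⟨ cong₂ _+_ (∑-zero (suc n) (λ s s≤n → trans (cong (λ z → δ (n ℕ.* s) M * (z * f n s))
             (lt-≤ (ℕP.≤-pred s≤n))) (zero-term (δ (n ℕ.* s) M) (f n s))))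
                     (∑-multiples (suc N) 1 _ (λ i 2∤i → trans
                       (cong (λ z → δ (n ℕ.* (i ℕ.+ suc n)) M * (lt n (i ℕ.+ suc n) * z)) (f-odd n i 2∤i))
                        (zero-term′ (δ (n ℕ.* (i ℕ.+ suc n)) M) (lt n (i ℕ.+ suc n))))) ⟩
      0ℤ + ∑ (suc N) (λ k → pairTerm M g n (k ℕ.* 2 ℕ.+ suc n)) ≡⟨ ℤP.+-identityˡ _ ⟩
      ∑ (suc N) (λ k → pairTerm M g n (k ℕ.* 2 ℕ.+ suc n))
        ≡⟨ ∑-cong (suc N) (λ k → cong (δ (n ℕ.* (k ℕ.* 2 ℕ.+ suc n)) M *_)
             (trans (cong (_* f n (k ℕ.* 2 ℕ.+ suc n)) (lt-+ n (k ℕ.* 2)))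
             (trans (ℤP.*-identityˡ _) (f-even n k)))) ⟩
      ∑ (suc N) (term n) ∎
      where
      zero-term : ∀ d x → d * (0ℤ * x) ≡ 0ℤ
      zero-term d x = solve 2 (λ d x → d :* (con 0ℤ :* x) := con 0ℤ) refl d x
      zero-term′ : ∀ d x → d * (x * 0ℤ) ≡ 0ℤ
      zero-term′ d x = solve 2 (λ d x → d :* (x :* con 0ℤ) := con 0ℤ) refl d x
      M≤ : suc M ≤ suc N ℕ.* 2
      M≤ = ℕP.≤-trans (ℕP.n≤1+n (suc M)) (ℕP.≤-reflexive
        (cong (2 ℕ.+_) (trans (cong (N ℕ.+_) (sym (ℕP.+-identityʳ N))) (ℕP.*-comm 2 N))))
    too-large : ∀ j k → N ≤ j → suc j ℕ.* (k ℕ.* 2 ℕ.+ suc (suc j)) ≢ M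
    too-large j k N≤j e = ℕP.<⇒≱ big (ℕP.≤-reflexive e)
      where
      big : M < suc j ℕ.* (k ℕ.* 2 ℕ.+ suc (suc j))
      big = ℕP.≤-trans (ℕP.≤-trans (ℕP.≤-trans (ℕP.+-mono-≤ (s≤s N≤j) (ℕP.m≤n⇒m≤1+n N≤j))
        (ℕP.≤-reflexive (cong (suc j ℕ.+_) (sym (ℕP.+-identityʳ (suc j))))))
              (ℕP.≤-reflexive (ℕP.*-comm 2 (suc j)))) (ℕP.*-monoʳ-≤ (suc j)
                (ℕP.≤-trans (s≤s (s≤s z≤n)) (ℕP.m≤n+m (suc (suc j)) (k ℕ.* 2))))
    δ-half : ∀ n k → δ (n ℕ.* (k ℕ.* 2 ℕ.+ suc n)) M ≡ δ (tri n ℕ.+ k ℕ.* n) N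
    δ-half n k = δ-iff {m′ = tri n ℕ.+ k ℕ.* n} {n′ = N}
      (λ e → double-injective {tri n ℕ.+ k ℕ.* n} {N} (trans (sym (trapezoid n k)) e))
        (λ e → trans (trapezoid n k) (cong₂ ℕ._+_ e e))

-- Residues modulo 3 and characters

-- A finite type of residues lets congruence facts be checked case by case with `refl`.
data ℤ₃ : Set where
  𝟎 𝟏 𝟐 : ℤ₃

infixl 6 _⊞_
infixl 7 _⊠_
_⊞_ _⊠_ : ℤ₃ → ℤ₃ → ℤ₃
𝟎 ⊞ b = b
𝟏 ⊞ 𝟎 = 𝟏
𝟏 ⊞ 𝟏 = 𝟐
𝟏 ⊞ 𝟐 = 𝟎
𝟐 ⊞ 𝟎 = 𝟐
𝟐 ⊞ 𝟏 = 𝟎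
𝟐 ⊞ 𝟐 = 𝟏
𝟎 ⊠ b = 𝟎
𝟏 ⊠ b = b
𝟐 ⊠ b = b ⊞ b

res : ℕ → ℤ₃
res zero    = 𝟎
res (suc n) = 𝟏 ⊞ res n

χ : ℤ₃ → ℤ
χ 𝟎 = 0ℤ
χ 𝟏 = 1ℤ
χ 𝟐 = ℤ.- 1ℤ

-- With a primitive cube root of unity j this is -(jᵃ + j⁻ᵃ); equivalently it is 1 minus three times
-- the indicator of a = 0.
κ : ℤ₃ → ℤ
κ 𝟎 = ℤ.- (+ 2)
κ _ = 1ℤ

-- The nontrivial Dirichlet character mod 4.
ρ : ℕ → ℤ
ρ 0             = 0ℤ
ρ 1             = 1ℤ
ρ (suc (suc n)) = ℤ.- ρ n

cases₁ : ∀ {P : ℤ₃ → Set} → P 𝟎 → P 𝟏 → P 𝟐 → ∀ a → P a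
cases₁ x y z 𝟎 = x
cases₁ x y z 𝟏 = y
cases₁ x y z 𝟐 = z

cases₂ : ∀ {P : ℤ₃ → ℤ₃ → Set} → P 𝟎 𝟎 → P 𝟎 𝟏 → P 𝟎 𝟐 → P 𝟏 𝟎 → P 𝟏 𝟏 → P 𝟏 𝟐 → P 𝟐 𝟎 → P 𝟐 𝟏 → P 𝟐 𝟐 →
         ∀ a b → P a b
cases₂ a b c d e f g h i 𝟎 = cases₁ a b c
cases₂ a b c d e f g h i 𝟏 = cases₁ d e f
cases₂ a b c d e f g h i 𝟐 = cases₁ g h i

⊞-assoc : ∀ a b c → a ⊞ b ⊞ c ≡ a ⊞ (b ⊞ c)
⊞-assoc 𝟎 b c = refl
⊞-assoc 𝟏 = cases₂ refl refl refl refl refl refl refl refl refl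
⊞-assoc 𝟐 = cases₂ refl refl refl refl refl refl refl refl refl

⊞-zeroʳ : ∀ a → a ⊞ 𝟎 ≡ a
⊞-zeroʳ = cases₁ refl refl refl

⊠-zeroʳ : ∀ a → a ⊠ 𝟎 ≡ 𝟎
⊠-zeroʳ = cases₁ refl refl refl

res-+ : ∀ m n → res (m ℕ.+ n) ≡ res m ⊞ res n
res-+ zero    n = refl
res-+ (suc m) n = trans (cong (𝟏 ⊞_) (res-+ m n)) (sym (⊞-assoc 𝟏 (res m) (res n)))

1⊞-⊠ : ∀ a b → b ⊞ a ⊠ b ≡ (𝟏 ⊞ a) ⊠ b
1⊞-⊠ = cases₂ refl refl refl refl refl refl refl refl refl

res-* : ∀ m n → res (m ℕ.* n) ≡ res m ⊠ res n
res-* zero    n = refl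
res-* (suc m) n = trans (res-+ n (m ℕ.* n)) (trans (cong (res n ⊞_) (res-* m n)) (1⊞-⊠ (res m) (res n)))

res-*3 : ∀ m → res (m ℕ.* 3) ≡ 𝟎
res-*3 m = trans (res-* m 3) (⊠-zeroʳ (res m))

res-∣ : ∀ n → res n ≡ 𝟎 → 3 ∣ n
res-∣ 0 _ = divides 0 refl
res-∣ (suc (suc (suc n))) e with res-∣ n (trans (sym (lem (res n))) e)
  where
  lem : ∀ a → 𝟏 ⊞ (𝟏 ⊞ (𝟏 ⊞ a)) ≡ a
  lem = cases₁ refl refl refl
... | divides k refl = divides (suc k) refl

res-∤ : ∀ {n} → 3 ∤ n → res n ≢ 𝟎
res-∤ {n} 3∤n e = 3∤n (res-∣ n e)

χ-* : ∀ a b → χ (a ⊠ b) ≡ χ a ℤ.* χ b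
χ-* 𝟎 b = sym (ℤP.*-zeroˡ (χ b))
χ-* 𝟏 b = sym (ℤP.*-identityˡ (χ b))
χ-* 𝟐 𝟎 = refl
χ-* 𝟐 𝟏 = refl
χ-* 𝟐 𝟐 = refl

-- Modulo 3 doubling is negation, so the arguments are a - b and b - a, and χ is odd.
χ-antisym : ∀ a b → χ (a ⊞ (b ⊞ b)) ≡ ℤ.- χ (b ⊞ (a ⊞ a))
χ-antisym = cases₂ refl refl refl refl refl refl refl refl refl

parity : ∀ n → (∃ λ m → n ≡ m ℕ.* 2) ⊎ (∃ λ m → n ≡ suc (m ℕ.* 2))
parity zero = inj₁ (0 , refl)
parity (suc n) with parity n
... | inj₁ (m , refl) = inj₂ (m , refl)
... | inj₂ (m , refl) = inj₁ (suc m , refl)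

odd-form : ∀ {n} → 2 ∤ n → ∃ λ m → n ≡ suc (m ℕ.* 2)
odd-form {n} 2∤n with parity n
... | inj₁ (m , e) = contradiction (divides m e) 2∤n
... | inj₂ odd     = odd

sgn-+ : ∀ m n → sgn (m ℕ.+ n) ≡ sgn m ℤ.* sgn n
sgn-+ zero    n = sym (ℤP.*-identityˡ (sgn n))
sgn-+ (suc m) n = trans (cong ℤ.-_ (sgn-+ m n)) (ℤP.neg-distribˡ-* (sgn m) (sgn n))

sgn-square-1 : ∀ m → sgn m ℤ.* sgn m ≡ 1ℤ
sgn-square-1 zero    = refl
sgn-square-1 (suc m) = trans (ℤSolver.solve 1 (λ s → (ℤSolver.:- s) ℤSolver.:* (ℤSolver.:- s) ℤSolver.:= s ℤSolver.:*
  s) refl (sgn m)) (sgn-square-1 m)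

sgn-*2 : ∀ m → sgn (m ℕ.* 2) ≡ 1ℤ
sgn-*2 zero    = refl
sgn-*2 (suc m) = trans (ℤP.neg-involutive _) (sgn-*2 m)

ρ-odd : ∀ m → ρ (suc (m ℕ.* 2)) ≡ sgn m
ρ-odd zero    = refl
ρ-odd (suc m) = cong ℤ.-_ (ρ-odd m)

ρ-even : ∀ m → ρ (m ℕ.* 2) ≡ 0ℤ
ρ-even zero    = refl
ρ-even (suc m) = cong ℤ.-_ (ρ-even m)

ρ-*3 : ∀ n → ρ (n ℕ.* 3) ≡ ℤ.- ρ n
ρ-*3 0             = refl
ρ-*3 1             = refl
ρ-*3 (suc (suc n)) = trans (cong (ℤ.-_ ∘ ℤ.-_ ∘ ℤ.-_) (ρ-*3 n)) (ℤP.neg-involutive _)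

-- Coefficients for c = -2, -1, 1 as sums over factorisations

module Coefficients where
  open import Data.Integer using (_+_; _*_; -_; _-_)
  open ≡-Reasoning
  open DivisorPairs
  open ProductExpansion using (prodₛ; coeff-Appell; lambert)
  open PowerSeries using (coeff)

  C : ℤ → ℕ → ℤ
  C c n = coeff (prodₛ c n) n

  -- The generating function (1 + u)/(1 + 2u + u²) is 1/(1 + u).
  v-−2 : ∀ k → v (- (+ 2)) k ≡ sgn k
  v-−2 0             = refl
  v-−2 1             = refl
  v-−2 (suc (suc k)) = trans (cong₂ (λ a b → - (+ 2) * a - b) (v-−2 (suc k)) (v-−2 k))
    (solve 1 (λ s → con (- (+ 2)) :* (:- s) :- s := :- (:- s)) refl (sgn k))
    where open ℤSolver

  -- The generating function is (1 - u²)/(1 - u³), with coefficients 1, 0, -1 of period 3.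
  v-−1 : ∀ k → v (- 1ℤ) k ≡ χ (res (suc (k ℕ.+ k)))
  v-−1 0             = refl
  v-−1 1             = refl
  v-−1 (suc (suc k)) = trans (cong₂ (λ a b → - 1ℤ * a - b)
    (trans (v-−1 (suc k)) (cong (χ ∘ res ∘ suc ∘ suc) (ℕP.+-suc k k))) (v-−1 k))
    (trans (lem (res (k ℕ.+ k))) (cong (χ ∘ res ∘ suc ∘ suc ∘ suc)
      (sym (trans (ℕP.+-suc k (suc k)) (cong suc (ℕP.+-suc k k))))))
    where
    lem : ∀ a → - 1ℤ * χ (𝟏 ⊞ (𝟏 ⊞ (𝟏 ⊞ a))) - χ (𝟏 ⊞ a) ≡ χ (𝟏 ⊞ (𝟏 ⊞ (𝟏 ⊞ (𝟏 ⊞ (𝟏 ⊞ a)))))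
    lem = cases₁ refl refl refl

  -- The generating function is (1 + u)²/(1 + u³), with coefficients 1, 2, 1, -1, -2, -1 of period
  -- 6.
  v-1 : ∀ k → v 1ℤ k ≡ sgn k * κ (𝟐 ⊞ res k)
  v-1 0             = refl
  v-1 1             = refl
  v-1 (suc (suc k)) = trans (cong₂ (λ a b → 1ℤ * a - b) (v-1 (suc k)) (v-1 k)) (lem (sgn k) (res k))
    where
    open ℤSolver
    lem : ∀ s a → 1ℤ * (- s * κ (𝟐 ⊞ (𝟏 ⊞ a))) - s * κ (𝟐 ⊞ a) ≡ - - s * κ (𝟐 ⊞ (𝟏 ⊞ (𝟏 ⊞ a)))
    lem s 𝟎 = solve 1 (λ s → con 1ℤ :* ((:- s) :* con (- (+ 2))) :- s :* con 1ℤ := (:- (:- s)) :* con 1ℤ) refl s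
    lem s 𝟏 = solve 1 (λ s → con 1ℤ :* ((:- s) :* con 1ℤ) :- s :* con (- (+ 2)) := (:- (:- s)) :* con 1ℤ) refl s
    lem s 𝟐 = solve 1 (λ s → con 1ℤ :* ((:- s) :* con 1ℤ) :- s :* con 1ℤ := (:- (:- s)) :* con (- (+ 2))) refl s

  middle : ∀ n k → n ℕ.+ (k ℕ.* 2 ℕ.+ suc n) ≡ suc ((n ℕ.+ k) ℕ.* 2)
  middle = solve 2 (λ n k → n :+ (k :* con 2 :+ (con 1 :+ n)) := con 1 :+ (n :+ k) :* con 2) refl
    where open ℕSolver

  middle-odd : ∀ n m → n ℕ.+ (suc (m ℕ.* 2) ℕ.+ suc n) ≡ (n ℕ.+ suc m) ℕ.* 2
  middle-odd = solve 2 (λ n k → n :+ (con 1 :+ k :* con 2 :+ (con 1 :+ n)) := (n :+ (con 1 :+ k)) :* con 2) refl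
    where open ℕSolver

  ρ-diag : ∀ n → ρ (n ℕ.+ n) ≡ 0ℤ
  ρ-diag n = trans (cong ρ (trans (cong (n ℕ.+_) (sym (ℕP.+-identityʳ n))) (ℕP.*-comm 2 n))) (ρ-even n)

  R : ℕ → ℤ
  R N = PSum (N ℕ.+ N) (λ n s → ρ (n ℕ.+ s))

  -- The argument of `κ` is n - s modulo 3.
  K : ℕ → ℕ → ℤ
  K n s = κ (res n ⊞ (res s ⊞ res s))

  -- For s = n + 2k + 1 the value ρ(n + s) is (-1)^(n+k), which is the sign times `v` at c = -2; for
  -- equal parities ρ vanishes.
  coeff-−2-R : ∀ n → C (- (+ 2)) (suc n) ≡ + 2 * R (suc n)
  coeff-−2-R n = trans (coeff-Appell (- (+ 2)) n) (trans
    (solve 1 (λ l → con (+ 4) :* l := con (+ 2) :* (con (+ 2) :* (con 1ℤ :* l))) refl (lambert (- (+ 2)) (suc n)))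
    (cong (+ 2 *_) (sym (PSum-lambert (- (+ 2)) 1ℤ n (λ n s → ρ (n ℕ.+ s)) (λ n s → cong ρ (ℕP.+-comm n s)) ρ-diag
      (λ n k → trans (cong ρ (middle n k)) (trans (ρ-odd (n ℕ.+ k)) (trans (sgn-+ n k)
         (trans (cong (sgn n *_) (sym (v-−2 k))) (sym (ℤP.*-identityˡ _))))))
      (λ { n i 2∤i → let m , e = odd-form 2∤i in trans (cong (λ i → ρ (n ℕ.+ (i ℕ.+ suc n))) e) (trans (cong ρ (middle-odd n m)) (ρ-even (n ℕ.+ suc m))) })))))
    where open ℤSolver

  -- For s = n + 2k + 1 one has n - s ≡ k + 2 modulo 3, the argument of `κ` in `v-1`; the sign is
  -- the same as for c = -2.
  coeff-1-R : ∀ n → + 2 * C 1ℤ (suc n) ≡ PSum (suc n ℕ.+ suc n) (λ n s → ρ (n ℕ.+ s) * K n s)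
  coeff-1-R n = trans (cong (+ 2 *_) (coeff-Appell 1ℤ n))
    (sym (PSum-lambert 1ℤ 1ℤ n (λ n s → ρ (n ℕ.+ s) * K n s)
      (λ n s → cong₂ _*_ (cong ρ (ℕP.+-comm n s)) (K-sym (res n) (res s)))
      (λ n → trans (cong (_* K n n) (ρ-diag n)) (ℤP.*-zeroˡ (K n n)))
      (λ n k → begin
        ρ (n ℕ.+ (k ℕ.* 2 ℕ.+ suc n)) * K n (k ℕ.* 2 ℕ.+ suc n)
          ≡⟨ cong₂ _*_ (trans (cong ρ (middle n k)) (trans (ρ-odd (n ℕ.+ k)) (sgn-+ n k)))
               (trans (cong (λ a → κ (res n ⊞ (a ⊞ a)))
                 (trans (res-+ (k ℕ.* 2) (suc n)) (cong (_⊞ (𝟏 ⊞ res n)) (res-* k 2)))) (K-k (res n) (res k))) ⟩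
        sgn n * sgn k * κ (𝟐 ⊞ res k) ≡⟨ trans (ℤP.*-assoc (sgn n) _ _)
          (trans (cong (sgn n *_) (sym (v-1 k))) (sym (ℤP.*-identityˡ _))) ⟩
        1ℤ * (sgn n * v 1ℤ k) ∎)
      (λ { n i 2∤i → let m , e = odd-form 2∤i in trans (cong (_* K n (i ℕ.+ suc n)) (trans (cong (λ i → ρ (n ℕ.+ (i ℕ.+ suc n))) e)
             (trans (cong ρ (middle-odd n m)) (ρ-even (n ℕ.+ suc m))))) (ℤP.*-zeroˡ (K n (i ℕ.+ suc n))) })))
    where
    K-sym : ∀ a b → κ (a ⊞ (b ⊞ b)) ≡ κ (b ⊞ (a ⊞ a))
    K-sym = cases₂ refl refl refl refl refl refl refl refl refl
    K-k : ∀ a b → κ (a ⊞ ((b ⊠ 𝟐 ⊞ (𝟏 ⊞ a)) ⊞ (b ⊠ 𝟐 ⊞ (𝟏 ⊞ a)))) ≡ κ (𝟐 ⊞ b)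
    K-k = cases₂ refl refl refl refl refl refl refl refl refl

  -- This is χ(s - n), with -n written as n + n modulo 3.
  X : ℕ → ℕ → ℤ
  X n s = χ (res s ⊞ (res n ⊞ res n))

  -- The sign difference is 2 (-1)ⁿ for opposite parities and 0 otherwise. Both factors are
  -- antisymmetric, which makes `F` symmetric.
  F : ℕ → ℕ → ℤ
  F n s = (sgn n - sgn s) * X n s

  -- For s = n + 2k + 1 the factor `X n s` is χ(2k + 1), which is `v` at c = -1. The sum of `F` is
  -- then four times `lambert`, the coefficient three times.
  coeff-−1-F : ∀ n → + 4 * C (- 1ℤ) (suc n) ≡ + 3 * PSum (suc n ℕ.+ suc n) F
  coeff-−1-F n = trans (cong (+ 4 *_) (coeff-Appell (- 1ℤ) n)) (trans
    (solve 1 (λ l → con (+ 4) :* (con (+ 3) :* l) := con (+ 3) :* (con (+ 2) :* (con (+ 2) :* l))) refl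
      (lambert (- 1ℤ) (suc n)))
    (cong (+ 3 *_) (sym (PSum-lambert (- 1ℤ) (+ 2) n F
      (λ n s → F-sym (sgn n) (sgn s) (res n) (res s))
      (λ n → solve 2 (λ s x → (s :- s) :* x := con 0ℤ) refl (sgn n) (χ (res n ⊞ (res n ⊞ res n))))
      (λ n k → begin
        (sgn n - sgn (k ℕ.* 2 ℕ.+ suc n)) * χ (res (k ℕ.* 2 ℕ.+ suc n) ⊞ (res n ⊞ res n))
          ≡⟨ cong₂ _*_ (cong (_-_ (sgn n)) (trans (sgn-+ (k ℕ.* 2) (suc n))
               (trans (cong (_* (- sgn n)) (sgn-*2 k)) (ℤP.*-identityˡ (- sgn n)))))
               (trans (cong (λ a → χ (a ⊞ (res n ⊞ res n))) (res-+ (k ℕ.* 2) (suc n)))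
                 (trans (χ-k (res (k ℕ.* 2)) (res n)) (trans (cong (λ m → χ (𝟏 ⊞ res m)) (ℕP.*-comm k 2))
                   (cong (λ m → χ (𝟏 ⊞ res (k ℕ.+ m))) (ℕP.+-identityʳ k))))) ⟩
        (sgn n - (- sgn n)) * χ (𝟏 ⊞ res (k ℕ.+ k)) ≡⟨ cong ((sgn n - (- sgn n)) *_) (sym (v-−1 k)) ⟩
        (sgn n - (- sgn n)) * v (- 1ℤ) k ≡⟨ solve 2 (λ s v → (s :- (:- s)) :* v := con (+ 2) :* (s :* v)) refl (sgn n)
          (v (- 1ℤ) k) ⟩
        + 2 * (sgn n * v (- 1ℤ) k) ∎)
      (λ { n i 2∤i → let m , e = odd-form 2∤i in trans (cong (λ z → (sgn n - z) * χ (res (i ℕ.+ suc n) ⊞ (res n ⊞ res n)))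
              (trans (cong (λ i → sgn (i ℕ.+ suc n)) e)
                (trans (sgn-+ (suc (m ℕ.* 2)) (suc n)) (trans (cong (λ z → - z * (- sgn n)) (sgn-*2 m))
                (solve 1 (λ s → (:- con 1ℤ) :* (:- s) := s) refl (sgn n))))))
            (solve 2 (λ s x → (s :- s) :* x := con 0ℤ) refl (sgn n) (χ (res (i ℕ.+ suc n) ⊞ (res n ⊞ res n)))) })))))
    where
    open ℤSolver
    F-sym : ∀ x y a b → (x - y) * χ (b ⊞ (a ⊞ a)) ≡ (y - x) * χ (a ⊞ (b ⊞ b))
    F-sym x y a b = trans (cong ((x - y) *_) (χ-antisym b a))
      (solve 3 (λ x y c → (x :- y) :* (:- c) := (y :- x) :* c) refl x y (χ (a ⊞ (b ⊞ b))))
    χ-k : ∀ c a → χ ((c ⊞ (𝟏 ⊞ a)) ⊞ (a ⊞ a)) ≡ χ (𝟏 ⊞ c)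
    χ-k = cases₂ refl refl refl refl refl refl refl refl refl

-- The case c = -1 and the divisor sum of χ

module LambdaSum where
  open import Data.Integer using (_+_; _*_; -_; _-_)
  open ≡-Reasoning
  open FiniteSum ℤP.+-*-commutativeRing
  open DivisorPairs
  open Coefficients
  open ℤSolver

  self-negative : ∀ x → x ≡ - x → x ≡ 0ℤ
  self-negative x e = ℤP.*-cancelˡ-≡ (+ 2) x 0ℤ (trans (solve 1 (λ x → con (+ 2) :* x := x :+ x) refl x)
    (trans (cong (_+_ x) e) (ℤP.+-inverseʳ x)))

  PSum-neg : ∀ M f → PSum M (λ n s → - f n s) ≡ - PSum M f
  PSum-neg M f = trans (PSum-cong M (λ n s _ → sym (ℤP.-1*i≡-i (f n s)))) (trans (PSum-* M (- 1ℤ) f) (ℤP.-1*i≡-i _))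

  PSum-antisymmetric : ∀ M f → (∀ n s → n ℕ.* s ≡ M → f s n ≡ - f n s) → PSum M f ≡ 0ℤ
  PSum-antisymmetric M f h = self-negative _ (trans (PSum-swap M f) (trans (PSum-cong M h) (PSum-neg M f)))

  even : ℕ → ℤ
  even 0             = 1ℤ
  even 1             = 0ℤ
  even (suc (suc n)) = even n

  sgn-even : ∀ n → sgn n ≡ - 1ℤ + + 2 * even n
  sgn-even 0             = refl
  sgn-even 1             = refl
  sgn-even (suc (suc n)) = trans (ℤP.neg-involutive _) (sgn-even n)

  even-*2 : ∀ n → even (n ℕ.* 2) ≡ 1ℤ
  even-*2 zero    = refl
  even-*2 (suc n) = even-*2 n

  even-odd : ∀ n → even (suc (n ℕ.* 2)) ≡ 0ℤ
  even-odd zero    = refl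
  even-odd (suc n) = even-odd n

  X-anti : ∀ n s → X s n ≡ - X n s
  X-anti n s = χ-antisym (res n) (res s)

  χ+ : ℕ → ℕ → ℤ
  χ+ n s = χ (res n ⊞ res s)

  -- Put n = 2i: then n s = 2N becomes i s = N, and χ(s - 2i) = χ(s + i).
  halve : ∀ N′ → let N = suc N′ in PSum (N ℕ.+ N) (λ n s → even n * X n s) ≡ PSum N χ+
  halve N′ = begin
    PSum M (λ n s → even n * X n s)
      ≡⟨ PSum-multiplesˡ 1 (N′ ℕ.+ N) (λ n s → even n * X n s) (λ n s 2∤n → let m , e = odd-form 2∤n in
           trans (cong (λ n → even n * X n s) e) (trans (cong (_* X (suc (m ℕ.* 2)) s) (even-odd m))
             (ℤP.*-zeroˡ (X (suc (m ℕ.* 2)) s)))) ⟩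
    ∑ (suc M) (λ i → ∑ (suc M) (λ s → δ (i ℕ.* 2 ℕ.* s) M * (even (i ℕ.* 2) * X (i ℕ.* 2) s)))
      ≡⟨ ∑-cong (suc M) (λ i → ∑-cong (suc M) (λ s → cong₂ _*_
           (δ-iff (λ e → double-injective {i ℕ.* s} {N} (trans (sym (twice i s)) e))
             (λ e → trans (twice i s) (cong₂ ℕ._+_ e e)))
           (trans (cong₂ _*_ (even-*2 i) (trans (cong (λ a → χ (res s ⊞ (a ⊞ a))) (res-* i 2)) (X-2 (res i) (res s))))
             (ℤP.*-identityˡ _)))) ⟩
    ∑ (suc M) (λ i → ∑ (suc M) (pairTerm N χ+ i)) ≡⟨ PSum-bounds χ+ N≤M N≤M ⟩
    PSum N χ+ ∎
    where
    N = suc N′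
    M = N ℕ.+ N
    N≤M : suc N ≤ suc M
    N≤M = s≤s (ℕP.m≤m+n N N)
    twice : ∀ i s → i ℕ.* 2 ℕ.* s ≡ i ℕ.* s ℕ.+ i ℕ.* s
    twice = S.solve 2 (λ i s → i S.:* S.con 2 S.:* s S.:= i S.:* s S.:+ i S.:* s) refl
      where module S = ℕSolver
    X-2 : ∀ a b → χ (b ⊞ (a ⊠ 𝟐 ⊞ a ⊠ 𝟐)) ≡ χ (a ⊞ b)
    X-2 = cases₂ refl refl refl refl refl refl refl refl refl

  -- With sgn n = 2 [2 ∣ n] - 1, the constant part cancels under n ↔ s, and the even n
  -- turn factorisations of 2N into factorisations of N.
  PSum-F : ∀ N′ → let N = suc N′ in PSum (N ℕ.+ N) F ≡ + 4 * PSum N χ+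
  PSum-F N′ = begin
    PSum M F ≡⟨ PSum-cong M (λ n s _ → solve 3 (λ a b x → (a :- b) :* x := a :* x :+ (:- b) :* x) refl (sgn n) (sgn s)
      (X n s)) ⟩
    PSum M (λ n s → sgn n * X n s + - sgn s * X n s) ≡⟨ PSum-+ M (λ n s → sgn n * X n s) (λ n s → - sgn s * X n s) ⟩
    P + PSum M (λ n s → - sgn s * X n s) ≡⟨ cong (λ z → P + z)
      (trans (PSum-swap M (λ n s → - sgn s * X n s)) (PSum-cong M (λ n s _ →
        trans (cong (- sgn n *_) (X-anti n s)) (solve 2 (λ a x → (:- a) :* (:- x) := a :* x) refl (sgn n) (X n s))))) ⟩
    P + P ≡⟨ cong (λ z → z + z) (begin
      P ≡⟨ PSum-cong M (λ n s _ → trans (cong (_* X n s) (sgn-even n))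
        (solve 2 (λ e x → (con (- 1ℤ) :+ con (+ 2) :* e) :* x := (:- x) :+ con (+ 2) :* (e :* x)) refl (even n)
          (X n s))) ⟩
      PSum M (λ n s → - X n s + + 2 * (even n * X n s)) ≡⟨ PSum-+ M (λ n s → - X n s) (λ n s → + 2 * (even n * X n s)) ⟩
      PSum M (λ n s → - X n s) + PSum M (λ n s → + 2 * (even n * X n s))
        ≡⟨ cong₂ _+_ (PSum-antisymmetric M (λ n s → - X n s) (λ n s _ → cong -_ (X-anti n s)))
             (trans (PSum-* M (+ 2) (λ n s → even n * X n s)) (cong (+ 2 *_) (halve N′))) ⟩
      0ℤ + + 2 * PSum N χ+ ∎) ⟩
    (0ℤ + + 2 * PSum N χ+) + (0ℤ + + 2 * PSum N χ+)
      ≡⟨ solve 1 (λ p → (con 0ℤ :+ con (+ 2) :* p) :+ (con 0ℤ :+ con (+ 2) :* p) := con (+ 4) :* p) refl (PSum N χ+) ⟩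
    + 4 * PSum N χ+ ∎
    where
    N = suc N′
    M = N ℕ.+ N
    P = PSum M (λ n s → sgn n * X n s)

  coeff-−1 : ∀ n → C (- 1ℤ) (suc n) ≡ + 3 * PSum (suc n) χ+
  coeff-−1 n = ℤP.*-cancelˡ-≡ (+ 4) _ _ (trans (coeff-−1-F n) (trans (cong (+ 3 *_) (PSum-F n))
    (solve 1 (λ p → con (+ 3) :* (con (+ 4) :* p) := con (+ 4) :* (con (+ 3) :* p)) refl (PSum (suc n) χ+))))

  -- The sum of χ over the divisors of N, which is the number of ideals of norm N in ℤ[j].
  E : ℕ → ℤ
  E N = PSum N (λ n _ → χ (res n))

  w : ℤ₃ → ℤ
  w 𝟎 = - (+ 2)
  w _ = 1ℤ

  -- If n s ≡ 1 modulo 3, then n ≡ s and χ(n + s) = χ(2n) = -χ(n). If n s ≡ 2, then n + s ≡ 0, and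
  -- `E N` vanishes too because χ(s) = -χ(n). If n s ≡ 0, then n or s is 0 modulo 3 and χ(n + s) =
  -- χ(n) + χ(s), which yields `E N` twice.
  χ+-E : ∀ N → - PSum N χ+ ≡ w (res N) * E N
  χ+-E N = by-residue (res N) refl
    where
    by-residue : ∀ a → res N ≡ a → - PSum N χ+ ≡ w a * E N
    by-residue 𝟏 eq = trans (sym (PSum-neg N χ+)) (trans
      (PSum-cong N (λ n s e → lem (res n) (res s) (trans (sym (res-* n s)) (trans (cong res e) eq))))
        (sym (ℤP.*-identityˡ _)))
      where
      lem : ∀ a b → a ⊠ b ≡ 𝟏 → - χ (a ⊞ b) ≡ χ a
      lem 𝟏 𝟏 _ = refl
      lem 𝟐 𝟐 _ = refl
    by-residue 𝟐 eq = trans (cong -_ (PSum-zero N (λ n s e → sum-zero (res n) (res s) (residues n s e))))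
                (sym (trans (ℤP.*-identityˡ _) (PSum-antisymmetric N _
                  (λ n s e → opposite (res n) (res s) (residues n s e)))))
      where
      residues : ∀ n s → n ℕ.* s ≡ N → res n ⊠ res s ≡ 𝟐
      residues n s e = trans (sym (res-* n s)) (trans (cong res e) eq)
      sum-zero : ∀ a b → a ⊠ b ≡ 𝟐 → χ (a ⊞ b) ≡ 0ℤ
      sum-zero 𝟏 𝟐 _ = refl
      sum-zero 𝟐 𝟏 _ = refl
      opposite : ∀ a b → a ⊠ b ≡ 𝟐 → χ b ≡ - χ a
      opposite 𝟏 𝟐 _ = refl
      opposite 𝟐 𝟏 _ = refl
    by-residue 𝟎 eq = begin
      - PSum N χ+ ≡⟨ cong -_ (PSum-cong N (λ n s e → additive (res n) (res s)
        (trans (sym (res-* n s)) (trans (cong res e) eq)))) ⟩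
      - PSum N (λ n s → χ (res n) + χ (res s)) ≡⟨ cong -_ (PSum-+ N (λ n _ → χ (res n)) (λ _ s → χ (res s))) ⟩
      - (E N + PSum N (λ _ s → χ (res s))) ≡⟨ cong (λ z → - (E N + z)) (PSum-swap N (λ _ s → χ (res s))) ⟩
      - (E N + E N) ≡⟨ solve 1 (λ e → :- (e :+ e) := con (- (+ 2)) :* e) refl (E N) ⟩
      - (+ 2) * E N ∎
      where
      additive : ∀ a b → a ⊠ b ≡ 𝟎 → χ (a ⊞ b) ≡ χ a + χ b
      additive 𝟎 𝟎 _ = refl
      additive 𝟎 𝟏 _ = refl
      additive 𝟎 𝟐 _ = refl
      additive 𝟏 𝟎 _ = refl
      additive 𝟐 𝟎 _ = refl

  geometric : ℤ → ℕ → ℤ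
  geometric y zero    = 1ℤ
  geometric y (suc e) = y * geometric y e + 1ℤ

  -- Recursion in the exponent of a prime

  module _ (p′ : ℕ) (p-prime : Prime (suc p′)) where
    private
      p : ℕ
      p = suc p′

    [p∣_] : ℕ → ℤ
    [p∣ n ] with p ∣? n
    ... | yes _ = 1ℤ
    ... | no _  = 0ℤ

    [p∣]-yes : ∀ {n} → p ∣ n → [p∣ n ] ≡ 1ℤ
    [p∣]-yes {n} d with p ∣? n
    ... | yes _ = refl
    ... | no ¬d = contradiction d ¬d

    [p∣]-no : ∀ {n} → p ∤ n → [p∣ n ] ≡ 0ℤ
    [p∣]-no {n} ¬d with p ∣? n
    ... | yes d = contradiction d ¬d
    ... | no _  = refl

    -- Collects the divisors that p does not divide; unlike `E` it stays the same when N is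
    -- multiplied by p.
    E′ : ℕ → ℤ
    E′ N = PSum N (λ n _ → (1ℤ - [p∣ n ]) * χ (res n))

    E′-coprime : ∀ {m} → p ∤ m → E′ m ≡ E m
    E′-coprime {m} p∤m = PSum-cong m (λ n s e → trans (cong (λ z → (1ℤ - z) * χ (res n))
      ([p∣]-no {n} (λ d → p∤m (subst (p ∣_) e (∣m⇒∣m*n {m = n} s d)))))
      (ℤP.*-identityˡ (χ (res n))))

    -- The divisors of M p that are multiples of p are p times the divisors of M, and χ is
    -- multiplicative.
    E-split : ∀ M′ → let M = suc M′ in E (M ℕ.* p) ≡ χ (res p) * E M + E′ (M ℕ.* p)
    E-split M′ = begin
      E Mp ≡⟨ PSum-cong Mp (λ n _ _ → solve 2 (λ i x → x := i :* x :+ (con 1ℤ :- i) :* x) refl [p∣ n ] (χ (res n))) ⟩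
      PSum Mp (λ n _ → [p∣ n ] * χ (res n) + (1ℤ - [p∣ n ]) * χ (res n))
        ≡⟨ PSum-+ Mp (λ n _ → [p∣ n ] * χ (res n)) (λ n _ → (1ℤ - [p∣ n ]) * χ (res n)) ⟩
      PSum Mp (λ n _ → [p∣ n ] * χ (res n)) + E′ Mp ≡⟨ cong (_+ E′ Mp) (begin
        PSum Mp (λ n _ → [p∣ n ] * χ (res n))
          ≡⟨ PSum-multiplesˡ p′ (p′ ℕ.+ M′ ℕ.* p) (λ n _ → [p∣ n ] * χ (res n))
               (λ n s p∤n → trans (cong (_* χ (res n)) ([p∣]-no {n} p∤n)) (ℤP.*-zeroˡ (χ (res n)))) ⟩
        ∑ (suc Mp) (λ i → ∑ (suc Mp) (λ s → δ (i ℕ.* p ℕ.* s) Mp * ([p∣ i ℕ.* p ] * χ (res (i ℕ.* p)))))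
          ≡⟨ ∑-cong (suc Mp) (λ i → ∑-cong (suc Mp) (λ s → cong₂ _*_ (δ-cancel i s)
               (trans (cong₂ _*_ ([p∣]-yes {i ℕ.* p} (n∣m*n i)) (trans (cong χ (res-* i p)) (χ-* (res i) (res p))))
                 (trans (ℤP.*-identityˡ _) (ℤP.*-comm (χ (res i)) (χ (res p))))))) ⟩
        ∑ (suc Mp) (λ i → ∑ (suc Mp) (pairTerm M (λ n _ → χ (res p) * χ (res n)) i))
          ≡⟨ PSum-bounds (λ n _ → χ (res p) * χ (res n)) M≤Mp M≤Mp ⟩
        PSum M (λ n _ → χ (res p) * χ (res n)) ≡⟨ PSum-* M (χ (res p)) (λ n _ → χ (res n)) ⟩
        χ (res p) * E M ∎) ⟩
      χ (res p) * E M + E′ Mp ∎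
      where
      M = suc M′
      Mp = M ℕ.* p
      M≤Mp : suc M ≤ suc Mp
      M≤Mp = s≤s (ℕP.m≤m*n M p)
      δ-cancel : ∀ i s → δ (i ℕ.* p ℕ.* s) Mp ≡ δ (i ℕ.* s) M
      δ-cancel i s = δ-iff {m′ = i ℕ.* s} {n′ = M} (λ e → ℕP.*-cancelʳ-≡ (i ℕ.* s) M p (trans (sym (shuffle i s)) e))
        (λ e → trans (shuffle i s) (cong (ℕ._* p) e))
        where
        shuffle : ∀ i s → i ℕ.* p ℕ.* s ≡ i ℕ.* s ℕ.* p
        shuffle i s = trans (ℕP.*-assoc i p s) (trans (cong (i ℕ.*_) (ℕP.*-comm p s)) (sym (ℕP.*-assoc i s p)))

    -- If n s = M p and p does not divide n, then p divides s, and s/p completes n to a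
    -- factorisation of M.
    E′-step : ∀ M′ → let M = suc M′ in E′ (M ℕ.* p) ≡ E′ M
    E′-step M′ = begin
      PSum Mp f ≡⟨ sym (PSum-bounds f ℕP.≤-refl (ℕP.m≤m*n (suc Mp) p)) ⟩
      ∑ (suc Mp) (λ n → ∑ (suc Mp ℕ.* p) (pairTerm Mp f n))
        ≡⟨ ∑-cong (suc Mp) (λ n → trans (∑-multiples (suc Mp) p′ _ (only-multiples n))
             (∑-cong (suc Mp) (λ i → cong (_* f n i) (δ-cancel n i)))) ⟩
      ∑ (suc Mp) (λ n → ∑ (suc Mp) (pairTerm M f n)) ≡⟨ PSum-bounds f M≤Mp M≤Mp ⟩
      PSum M f ∎
      where
      M = suc M′
      Mp = M ℕ.* p
      f : ℕ → ℕ → ℤ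
      f n _ = (1ℤ - [p∣ n ]) * χ (res n)
      M≤Mp : suc M ≤ suc Mp
      M≤Mp = s≤s (ℕP.m≤m*n M p)
      δ-cancel : ∀ n i → δ (n ℕ.* (i ℕ.* p)) Mp ≡ δ (n ℕ.* i) M
      δ-cancel n i = δ-iff {m′ = n ℕ.* i} {n′ = M} (λ e → ℕP.*-cancelʳ-≡ (n ℕ.* i) M p (trans (ℕP.*-assoc n i p) e))
        (λ e → trans (sym (ℕP.*-assoc n i p)) (cong (ℕ._* p) e))
      only-multiples : ∀ n s → p ∤ s → pairTerm Mp f n s ≡ 0ℤ
      only-multiples n s p∤s with n ℕ.* s ℕ.≟ Mp
      ... | no ne = δ*-zero {n ℕ.* s} {Mp} (f n s) ne
      ... | yes e with euclidsLemma n s p-prime (subst (p ∣_) (sym e) (n∣m*n M))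
      ...   | inj₂ p∣s = contradiction p∣s p∤s
      ...   | inj₁ p∣n = trans (cong (λ z → δ (n ℕ.* s) Mp * ((1ℤ - z) * χ (res n))) ([p∣]-yes {n} p∣n))
                           (solve 2 (λ d x → d :* ((con 1ℤ :- con 1ℤ) :* x) := con 0ℤ) refl (δ (n ℕ.* s) Mp)
                             (χ (res n)))

    -- `E′` keeps the value `E m`, so raising the exponent multiplies `E` by χ(p) and adds `E m`:
    -- Horner's rule for 1 + χ(p) + ... + χ(p)^e.
    E-prime-power : ∀ e m′ → let m = suc m′ in p ∤ m → E (m ℕ.* p ℕ.^ e) ≡ geometric (χ (res p)) e * E m × E′ (m ℕ.* p ℕ.^ e) ≡ E m
    E-prime-power zero    m′ p∤m rewrite ℕP.*-identityʳ m′ = sym (ℤP.*-identityˡ _) , E′-coprime p∤m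
    -- The product is abstracted to be matched with `suc K`, the form in which `E-split` and
    -- `E′-step` take their argument.
    E-prime-power (suc e) m′ p∤m with suc m′ ℕ.* p ℕ.^ e in eq | E-prime-power e m′ p∤m
    ... | zero  | _ = contradiction eq (ℕ.≢-nonZero⁻¹ _ {{ℕP.m*n≢0 (suc m′) (p ℕ.^ e) {{_}} {{ℕP.m^n≢0 p e}}}})
    ... | suc K | ihE , ihE′ rewrite trans (trans (cong (suc m′ ℕ.*_) (ℕP.*-comm p (p ℕ.^ e)))
      (sym (ℕP.*-assoc (suc m′) (p ℕ.^ e) p))) (cong (ℕ._* p) eq) =
        trans (E-split K) (trans (cong₂ (λ a b → χ (res p) * a + b) ihE (trans (E′-step K) ihE′))
          (solve 3 (λ x g e → x :* (g :* e) :+ e := (x :* g :+ con 1ℤ) :* e) refl (χ (res p))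
            (geometric (χ (res p)) e) (E (suc m′))))
      , trans (E′-step K) ihE′

-- The values of λ

module LambdaValues where
  open import Data.Integer using (_+_; _*_; -_; _-_)
  open ≡-Reasoning
  open LambdaSum

  geometric-0 : ∀ e → geometric 0ℤ e ≡ 1ℤ
  geometric-0 zero    = refl
  geometric-0 (suc e) = cong (_+ 1ℤ) (ℤP.*-zeroˡ (geometric 0ℤ e))

  geometric-1 : ∀ e → geometric 1ℤ e ≡ + (e ℕ.+ 1)
  geometric-1 zero    = refl
  geometric-1 (suc e) = trans (cong (_+ 1ℤ) (trans (ℤP.*-identityˡ _) (geometric-1 e)))
    (cong +_ (ℕP.+-comm (e ℕ.+ 1) 1))

  geometric-−1 : ∀ m → geometric (- 1ℤ) (m ℕ.* 2) ≡ 1ℤ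
  geometric-−1 zero    = refl
  geometric-−1 (suc m) rewrite geometric-−1 m = refl

  sgn-^ : ∀ e → ℤ.-1ℤ ℤ.^ e ≡ sgn e
  sgn-^ zero    = refl
  sgn-^ (suc e) = trans (ℤP.-1*i≡-i (ℤ.-1ℤ ℤ.^ e)) (cong -_ (sgn-^ e))

  geometric-half : ∀ e → (1ℤ + ℤ.-1ℤ ℤ.^ e) ℤ./ + 2 ≡ geometric (- 1ℤ) e
  geometric-half e with parity e
  ... | inj₁ (m , refl) = trans (cong (λ z → (1ℤ + z) ℤ./ + 2) (trans (sgn-^ (m ℕ.* 2)) (sgn-*2 m)))
    (sym (geometric-−1 m))
  ... | inj₂ (m , refl) = trans (cong (λ z → (1ℤ + z) ℤ./ + 2) (trans (sgn-^ (suc (m ℕ.* 2))) (cong -_ (sgn-*2 m))))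
                            (sym (cong (λ z → - 1ℤ * z + 1ℤ) (geometric-−1 m)))

  ⊠-nonzero : ∀ a b → a ≢ 𝟎 → b ≢ 𝟎 → a ⊠ b ≢ 𝟎
  ⊠-nonzero 𝟎 b a≢ b≢ = contradiction refl a≢
  ⊠-nonzero 𝟏 b a≢ b≢ = b≢
  ⊠-nonzero 𝟐 𝟎 a≢ b≢ = contradiction refl b≢
  ⊠-nonzero 𝟐 𝟏 a≢ b≢ = λ ()
  ⊠-nonzero 𝟐 𝟐 a≢ b≢ = λ ()

  w-⊠ : ∀ a b → b ≢ 𝟎 → w (a ⊠ b) ≡ w a
  w-⊠ 𝟎 b b≢ = refl
  w-⊠ 𝟏 𝟎 b≢ = contradiction refl b≢
  w-⊠ 𝟏 𝟏 b≢ = refl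
  w-⊠ 𝟏 𝟐 b≢ = refl
  w-⊠ 𝟐 𝟎 b≢ = contradiction refl b≢
  w-⊠ 𝟐 𝟏 b≢ = refl
  w-⊠ 𝟐 𝟐 b≢ = refl

  w-nonzero : ∀ a → a ≢ 𝟎 → w a ≡ 1ℤ
  w-nonzero 𝟎 a≢ = contradiction refl a≢
  w-nonzero 𝟏 a≢ = refl
  w-nonzero 𝟐 a≢ = refl

  res-^-nonzero : ∀ p e → res p ≢ 𝟎 → res (p ℕ.^ e) ≢ 𝟎
  res-^-nonzero p zero    h = λ ()
  res-^-nonzero p (suc e) h = ⊠-nonzero (res p) (res (p ℕ.^ e)) h (res-^-nonzero p e h) ∘ trans
    (sym (res-* p (p ℕ.^ e)))

  res-%6 : ∀ p → res p ≡ res (p ℕ.% 6)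
  res-%6 p = begin
    res p ≡⟨ cong res (m≡m%n+[m/n]*n p 6) ⟩
    res (p ℕ.% 6 ℕ.+ p ℕ./ 6 ℕ.* 6) ≡⟨ res-+ (p ℕ.% 6) (p ℕ./ 6 ℕ.* 6) ⟩
    res (p ℕ.% 6) ⊞ res (p ℕ./ 6 ℕ.* 6) ≡⟨ cong (res (p ℕ.% 6) ⊞_)
      (trans (res-* (p ℕ./ 6) 6) (⊠-zeroʳ (res (p ℕ./ 6)))) ⟩
    res (p ℕ.% 6) ⊞ 𝟎 ≡⟨ ⊞-zeroʳ (res (p ℕ.% 6)) ⟩
    res (p ℕ.% 6) ∎

  prime-divisor : ∀ {p d} → Prime p → d ∣ p → d ≢ 1 → d ≡ p
  prime-divisor p-prime d∣p d≢1 with prime⇒irreducible p-prime d∣p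
  ... | inj₁ d≡1 = contradiction d≡1 d≢1
  ... | inj₂ d≡p = d≡p

  data PrimeClass (p : ℕ) : Set where
    is-3  : p ≡ 3 → PrimeClass p
    is-1  : p ℕ.% 6 ≡ 1 → PrimeClass p
    is-25 : p ℕ.% 6 ≡ 2 ⊎ p ℕ.% 6 ≡ 5 → PrimeClass p

  classify : ∀ p → Prime p → PrimeClass p
  classify p p-prime with p ℕ.% 6 in r | m%n<n p 6 | m≡m%n+[m/n]*n p 6
  -- Residue 0 or 4 would make 2 a divisor, hence p = 2, whose residue is 2; likewise residue 3
  -- forces p = 3.
  ... | 0 | _ | e = contradiction (trans (cong (ℕ._% 6)
    (prime-divisor {d = 2} p-prime (divides (p ℕ./ 6 ℕ.* 3) (trans e (sym (ℕP.*-assoc (p ℕ./ 6) 3 2)))) (λ ()))) r) λ ()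
  ... | 1 | _ | e = is-1 r
  ... | 2 | _ | e = is-25 (inj₁ r)
  ... | 3 | _ | e = is-3 (sym (prime-divisor {d = 3} p-prime
    (divides (suc (p ℕ./ 6 ℕ.* 2)) (trans e (cong (3 ℕ.+_) (sym (ℕP.*-assoc (p ℕ./ 6) 2 3))))) (λ ())))
  ... | 4 | _ | e = contradiction (trans (cong (ℕ._% 6)
    (prime-divisor {d = 2} p-prime (divides (2 ℕ.+ p ℕ./ 6 ℕ.* 3)
      (trans e (cong (4 ℕ.+_) (sym (ℕP.*-assoc (p ℕ./ 6) 3 2))))) (λ ()))) r) λ ()
  ... | 5 | _ | e = is-25 (inj₂ r)
  ... | suc (suc (suc (suc (suc (suc _))))) | s≤s (s≤s (s≤s (s≤s (s≤s (s≤s ()))))) | _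

  coprime-prime-power : ∀ {p m} e → Prime p → p ∤ m → Coprime m (p ℕ.^ e)
  coprime-prime-power zero    p-prime p∤m (d∣m , divides k e) = ℕP.m*n≡1⇒n≡1 k _ (sym e)
  coprime-prime-power {p} (suc e) p-prime p∤m {d} (d∣m , d∣p^) = coprime-prime-power e p-prime p∤m
    (d∣m , coprime-divisor d-p d∣p^)
    where
    d-p : Coprime d p
    d-p {c} (c∣d , c∣p) with prime⇒irreducible p-prime c∣p
    ... | inj₁ c≡1  = c≡1
    ... | inj₂ refl = contradiction (∣-trans c∣d d∣m) p∤m

  split-power : ∀ p → 2 ≤ p → ∀ n → ∃₂ λ m′ e → suc n ≡ suc m′ ℕ.* p ℕ.^ e × p ∤ suc m′
  split-power p 2≤p = <-rec _ go
    where
    go : ∀ n → (∀ {k} → k < n → ∃₂ λ m′ e → suc k ≡ suc m′ ℕ.* p ℕ.^ e × p ∤ suc m′) → ∃₂ λ m′ e → suc n ≡ suc m′ ℕ.*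
      p ℕ.^ e × p ∤ suc m′
    go n rec with p ∣? suc n
    ... | no p∤n = n , 0 , sym (ℕP.*-identityʳ (suc n)) , p∤n
    ... | yes (divides (suc k) e) with rec (ℕP.≤-pred (subst (suc k <_) (sym e) (ℕP.m<m*n (suc k) p 2≤p)))
    ...   | m′ , f , e′ , p∤m = m′ , suc f , trans e (trans (cong (ℕ._* p) e′)
      (trans (ℕP.*-assoc (suc m′) (p ℕ.^ f) p) (cong (suc m′ ℕ.*_) (ℕP.*-comm (p ℕ.^ f) p)))) , p∤m

  prime-factor : ∀ n → ∃ λ p → Prime p × p ∣ suc (suc n)
  prime-factor n with factorise (suc (suc n))
  ... | record { factors = [] ; isFactorisation = () }
  ... | record { factors = p ∷ ps ; isFactorisation = e ; factorsPrime = p-prime ∷ _ } = p , p-prime , divides (product ps) (trans e (ℕP.*-comm p (product ps)))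

  prime≥2 : ∀ {p} → Prime p → 2 ≤ p
  prime≥2 {zero}        pr with () ← NonZero.nonZero (prime⇒nonZero pr)
  prime≥2 {suc zero}    pr = contradiction pr ¬prime[1]
  prime≥2 {suc (suc p)} pr = s≤s (s≤s z≤n)

  module _ (λ′ : ℕ → ℤ) (isλ : IsLambda λ′) where
    open IsLambda isλ

    -- At p = 3 the geometric sum is 1 since χ(3) = 0, and the value -2 comes from `w`, which passes
    -- from a nonzero residue to 0. Any other prime power is a unit modulo 3 and leaves `w` alone,
    -- so λ has to be the geometric sum.
    λ-local : ∀ p e m → Prime p → 1 ≤ e → p ∤ m → λ′ (p ℕ.^ e) * w (res m) ≡ w (res (m ℕ.* p ℕ.^ e)) * geometric
      (χ (res p)) e
    λ-local p e m p-prime 1≤e p∤m with classify p p-prime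
    λ-local p (suc e) m p-prime 1≤e p∤m | is-3 refl = begin
      λ′ (3 ℕ.^ suc e) * w (res m) ≡⟨ cong₂ _*_ (three (suc e) 1≤e) (w-nonzero (res m) (res-∤ p∤m)) ⟩
      - (+ 2) ≡⟨ sym (cong₂ _*_ (cong w (trans (res-* m (3 ℕ.* 3 ℕ.^ e))
        (trans (cong (res m ⊠_) (res-* 3 (3 ℕ.^ e))) (⊠-zeroʳ (res m))))) (geometric-0 (suc e))) ⟩
      w (res (m ℕ.* 3 ℕ.^ suc e)) * geometric 0ℤ (suc e) ∎
    ... | is-1 r = begin
      λ′ (p ℕ.^ e) * w (res m) ≡⟨ cong₂ _*_ (trans (p1 p e p-prime r 1≤e) (sym (geometric-1 e)))
        (sym (trans (cong w (res-* m (p ℕ.^ e)))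
          (w-⊠ (res m) (res (p ℕ.^ e)) (res-^-nonzero p e (λ e → contradiction (trans (sym e) res-p) λ ()))))) ⟩
      geometric 1ℤ e * w (res (m ℕ.* p ℕ.^ e)) ≡⟨ ℤP.*-comm (geometric 1ℤ e) _ ⟩
      w (res (m ℕ.* p ℕ.^ e)) * geometric 1ℤ e ≡⟨ cong (λ a → w (res (m ℕ.* p ℕ.^ e)) * geometric (χ a) e) (sym res-p) ⟩
      w (res (m ℕ.* p ℕ.^ e)) * geometric (χ (res p)) e ∎
      where
      res-p : res p ≡ 𝟏
      res-p = trans (res-%6 p) (cong res r)
    ... | is-25 r = begin
      λ′ (p ℕ.^ e) * w (res m) ≡⟨ cong₂ _*_ (trans (p25 p e p-prime r 1≤e) (geometric-half e))
        (sym (trans (cong w (res-* m (p ℕ.^ e)))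
          (w-⊠ (res m) (res (p ℕ.^ e)) (res-^-nonzero p e (λ e → contradiction (trans (sym e) res-p) λ ()))))) ⟩
      geometric (- 1ℤ) e * w (res (m ℕ.* p ℕ.^ e)) ≡⟨ ℤP.*-comm (geometric (- 1ℤ) e) _ ⟩
      w (res (m ℕ.* p ℕ.^ e)) * geometric (- 1ℤ) e ≡⟨ cong (λ a → w (res (m ℕ.* p ℕ.^ e)) * geometric (χ a) e)
        (sym res-p) ⟩
      w (res (m ℕ.* p ℕ.^ e)) * geometric (χ (res p)) e ∎
      where
      res-p : res p ≡ 𝟐
      res-p = [ (λ r → trans (res-%6 p) (cong res r)) , (λ r → trans (res-%6 p) (cong res r)) ]′ r

    -- Strong induction that splits off the full power of one prime factor: λ factors by `mult`, the
    -- divisor sum by `E-prime-power`.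
    λ-value : ∀ n → λ′ (suc n) ≡ w (res (suc n)) * E (suc n)
    λ-value = <-rec _ go
      where
      go : ∀ n → (∀ {k} → k < n → λ′ (suc k) ≡ w (res (suc k)) * E (suc k)) → λ′ (suc n) ≡ w (res (suc n)) * E (suc n)
      go zero    rec = one
      go (suc n) rec with prime-factor n
      ... | zero  , p-prime , _ = contradiction (prime≥2 p-prime) λ ()
      ... | suc p′ , p-prime , p∣n with split-power (suc p′) (prime≥2 p-prime) (suc n)
      ...   | m′ , zero , e , p∤m = contradiction (subst (suc p′ ∣_) (trans e (ℕP.*-identityʳ (suc m′))) p∣n) p∤m
      ...   | m′ , suc f , e , p∤m = begin
        λ′ (suc (suc n)) ≡⟨ trans (cong λ′ e) (mult (suc m′) P (coprime-prime-power (suc f) p-prime p∤m)) ⟩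
        λ′ (suc m′) * λ′ P ≡⟨ cong (_* λ′ P) (rec (ℕP.≤-pred m<n)) ⟩
        w (res (suc m′)) * E (suc m′) * λ′ P ≡⟨ solve 3 (λ a b c → a :* b :* c := (c :* a) :* b) refl
          (w (res (suc m′))) (E (suc m′)) (λ′ P) ⟩
        λ′ P * w (res (suc m′)) * E (suc m′) ≡⟨ cong (_* E (suc m′))
          (λ-local p (suc f) (suc m′) p-prime (s≤s z≤n) p∤m) ⟩
        w (res (suc m′ ℕ.* P)) * geometric (χ (res p)) (suc f) * E (suc m′) ≡⟨ ℤP.*-assoc (w (res (suc m′ ℕ.* P))) _ _ ⟩
        w (res (suc m′ ℕ.* P)) * (geometric (χ (res p)) (suc f) * E (suc m′))
          ≡⟨ cong (w (res (suc m′ ℕ.* P)) *_) (sym (proj₁ (E-prime-power p′ p-prime (suc f) m′ p∤m))) ⟩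
        w (res (suc m′ ℕ.* P)) * E (suc m′ ℕ.* P) ≡⟨ cong (λ n → w (res n) * E n) (sym e) ⟩
        w (res (suc (suc n))) * E (suc (suc n)) ∎
        where
        open ℤSolver
        p = suc p′
        P = p ℕ.^ suc f
        m<n : suc m′ < suc (suc n)
        m<n = subst (suc m′ <_) (sym e) (ℕP.m<m*n (suc m′) P
          (ℕP.≤-trans (prime≥2 p-prime) (ℕP.m≤m*n p (p ℕ.^ f) {{ℕP.m^n≢0 p f}})))

-- The case c = 1 compared with c = -2

module SixthRoot where
  open import Data.Integer using (_+_; _*_; -_; _-_)
  open ≡-Reasoning
  open FiniteSum ℤP.+-*-commutativeRing
  open DivisorPairs
  open Coefficients
  open ProductExpansion using (thetaSum; weight; coeff-−2)
  open ℤSolver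

  -- Here n s = 2N ≡ 2 modulo 3, so n and s are incongruent and κ(n - s) is always 1.
  coeff-1-class1 : ∀ n → res (suc n) ≡ 𝟏 → + 4 * C 1ℤ (suc n) ≡ C (- (+ 2)) (suc n)
  coeff-1-class1 n r = begin
    + 4 * C 1ℤ N ≡⟨ solve 1 (λ c → con (+ 4) :* c := con (+ 2) :* (con (+ 2) :* c)) refl (C 1ℤ N) ⟩
    + 2 * (+ 2 * C 1ℤ N) ≡⟨ cong (+ 2 *_) (trans (coeff-1-R n) (PSum-cong (N ℕ.+ N) (λ n s e →
        trans (cong (ρ (n ℕ.+ s) *_) (lem (res n) (res s)
          (trans (sym (res-* n s)) (trans (cong res e) (trans (res-+ N N) (cong (λ a → a ⊞ a) r))))))
            (ℤP.*-identityʳ _)))) ⟩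
    + 2 * R N ≡⟨ sym (coeff-−2-R n) ⟩
    C (- (+ 2)) N ∎
    where
    N = suc n
    lem : ∀ a b → a ⊠ b ≡ 𝟐 → κ (a ⊞ (b ⊞ b)) ≡ 1ℤ
    lem 𝟏 𝟐 _ = refl
    lem 𝟐 𝟏 _ = refl

  -- Here n s = 2N ≡ 1 modulo 3, so n ≡ s and κ(n - s) is always -2.
  coeff-1-class2 : ∀ n → res (suc n) ≡ 𝟐 → + 2 * C 1ℤ (suc n) ≡ - C (- (+ 2)) (suc n)
  coeff-1-class2 n r = begin
    + 2 * C 1ℤ N ≡⟨ trans (coeff-1-R n) (PSum-cong (N ℕ.+ N) (λ n s e →
        trans (cong (ρ (n ℕ.+ s) *_) (lem (res n) (res s)
          (trans (sym (res-* n s)) (trans (cong res e) (trans (res-+ N N) (cong (λ a → a ⊞ a) r))))))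
            (ℤP.*-comm (ρ (n ℕ.+ s)) (- (+ 2))))) ⟩
    PSum (N ℕ.+ N) (λ n s → - (+ 2) * ρ (n ℕ.+ s)) ≡⟨ PSum-* (N ℕ.+ N) (- (+ 2)) (λ n s → ρ (n ℕ.+ s)) ⟩
    - (+ 2) * R N ≡⟨ sym (ℤP.neg-distribˡ-* (+ 2) (R N)) ⟩
    - (+ 2 * R N) ≡⟨ cong -_ (sym (coeff-−2-R n)) ⟩
    - C (- (+ 2)) N ∎
    where
    N = suc n
    lem : ∀ a b → a ⊠ b ≡ 𝟏 → κ (a ⊞ (b ⊞ b)) ≡ - (+ 2)
    lem 𝟏 𝟏 _ = refl
    lem 𝟐 𝟐 _ = refl

  ζ : ℤ₃ → ℤ
  ζ 𝟎 = 1ℤ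
  ζ _ = 0ℤ

  ζ-∤ : ∀ {n} → 3 ∤ n → ζ (res n) ≡ 0ℤ
  ζ-∤ {n} 3∤n with res n in e
  ... | 𝟎 = contradiction (res-∣ n e) 3∤n
  ... | 𝟏 = refl
  ... | 𝟐 = refl

  both : ℕ → ℕ → ℤ
  both n s = ζ (res n) * (ζ (res s) * ρ (n ℕ.+ s))

  nines : ∀ i l → i ℕ.* 3 ℕ.* (l ℕ.* 3) ≡ i ℕ.* l ℕ.* 9
  nines = solve′ 2 (λ i l → i :*′ con′ 3 :*′ (l :*′ con′ 3) :=′ i :*′ l :*′ con′ 9) refl
    where open ℕSolver renaming (solve to solve′; _:*_ to _:*′_; con to con′; _:=_ to _:=′_)

  -- Put n = 3i and s = 3l; the sign is ρ(3) = -1. The condition stays 9 i l = M because 9 need not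
  -- divide M.
  PSum-both : ∀ M′ → let M = suc M′ in PSum M both ≡ ∑ (suc M) (λ i → ∑ (suc M) (λ l → δ (i ℕ.* l ℕ.* 9) M * - ρ (i ℕ.+ l)))
  PSum-both M′ = begin
    PSum M both ≡⟨ sym (PSum-bounds both M≤ M≤) ⟩
    ∑ B (λ n → ∑ B (pairTerm M both n)) ≡⟨ ∑-multiples (suc M) 2 _ (λ n 3∤n → ∑-zero B (λ s _ →
        trans (cong (λ z → δ (n ℕ.* s) M * (z * (ζ (res s) * ρ (n ℕ.+ s)))) (ζ-∤ 3∤n))
          (zero₁ (δ (n ℕ.* s) M) (ζ (res s) * ρ (n ℕ.+ s))))) ⟩
    ∑ (suc M) (λ i → ∑ B (pairTerm M both (i ℕ.* 3))) ≡⟨ ∑-cong (suc M) (λ i → trans (∑-multiples (suc M) 2 _ (λ s 3∤s →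
        trans (cong (λ z → δ (i ℕ.* 3 ℕ.* s) M * (ζ (res (i ℕ.* 3)) * (z * ρ (i ℕ.* 3 ℕ.+ s)))) (ζ-∤ 3∤s))
          (zero₂ (δ (i ℕ.* 3 ℕ.* s) M) (ζ (res (i ℕ.* 3))) (ρ (i ℕ.* 3 ℕ.+ s)))))
        (∑-cong (suc M) (λ l → cong₂ _*_ (cong (λ n → δ n M) (nines i l)) (begin
          ζ (res (i ℕ.* 3)) * (ζ (res (l ℕ.* 3)) * ρ (i ℕ.* 3 ℕ.+ l ℕ.* 3))
            ≡⟨ cong₂ (λ a b → ζ a * (ζ b * ρ (i ℕ.* 3 ℕ.+ l ℕ.* 3))) (res-*3 i) (res-*3 l) ⟩
          1ℤ * (1ℤ * ρ (i ℕ.* 3 ℕ.+ l ℕ.* 3)) ≡⟨ trans (ℤP.*-identityˡ _) (ℤP.*-identityˡ _) ⟩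
          ρ (i ℕ.* 3 ℕ.+ l ℕ.* 3) ≡⟨ trans (cong ρ (sym (ℕP.*-distribʳ-+ 3 i l))) (ρ-*3 (i ℕ.+ l)) ⟩
          - ρ (i ℕ.+ l) ∎)))) ⟩
    ∑ (suc M) (λ i → ∑ (suc M) (λ l → δ (i ℕ.* l ℕ.* 9) M * - ρ (i ℕ.+ l))) ∎
    where
    M = suc M′
    B = suc M ℕ.* 3
    M≤ : suc M ≤ B
    M≤ = ℕP.m≤m*n (suc M) 3
    zero₁ : ∀ d x → d * (0ℤ * x) ≡ 0ℤ
    zero₁ = solve 2 (λ d x → d :* (con 0ℤ :* x) := con 0ℤ) refl
    zero₂ : ∀ d z x → d * (z * (0ℤ * x)) ≡ 0ℤ
    zero₂ = solve 3 (λ d z x → d :* (z :* (con 0ℤ :* x)) := con 0ℤ) refl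

  sq : ℕ → ℕ → ℕ
  sq j l = j ℕ.* j ℕ.+ l ℕ.* l

  sqTerm : ℕ → ℕ → ℕ → ℤ
  sqTerm N j l = weight j * weight l * δ (sq j l) N

  weight-zero : ∀ x {m n} → m ≢ n → x * δ m n ≡ 0ℤ
  weight-zero x {m} {n} ne = trans (cong (x *_) (δ-≢ ne)) (ℤP.*-zeroʳ x)

  thetaSum-bounds : ∀ {B} N → suc N ≤ B → ∑ B (λ j → ∑ B (sqTerm N j)) ≡ thetaSum sq N
  thetaSum-bounds {B} N N<B = trans
    (∑-extend N<B (λ j N<j → ∑-zero B (λ l _ → weight-zero (weight j * weight l) {sq j l}
      (λ e → ℕP.<⇒≱ N<j (subst (j ≤_) e (ℕP.≤-trans (n≤n*n j) (ℕP.m≤m+n _ _)))))))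
    (∑-cong (suc N) (λ j → ∑-extend N<B (λ l N<l → weight-zero (weight j * weight l) {sq j l}
      (λ e → ℕP.<⇒≱ N<l (subst (l ≤_) e (ℕP.≤-trans (n≤n*n l) (ℕP.m≤n+m _ (j ℕ.* j))))))))

  weight-*3 : ∀ i → weight (i ℕ.* 3) ≡ weight i
  weight-*3 zero    = refl
  weight-*3 (suc i) = cong (+ 2 *_) (cong (-_) (trans (ℤP.neg-involutive _) (sgn-*3 i)))
    where
    sgn-*3 : ∀ i → sgn (i ℕ.* 3) ≡ sgn i
    sgn-*3 zero    = refl
    sgn-*3 (suc i) = cong (-_) (trans (ℤP.neg-involutive _) (sgn-*3 i))

  -- 3 ∣ j² + l² forces 3 ∣ j and 3 ∣ l.
  thetaSum-nines : ∀ N → res N ≡ 𝟎 →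
    thetaSum sq N ≡ ∑ (suc N) (λ i → ∑ (suc N) (λ l → weight i * weight l * δ (sq i l ℕ.* 9) N))
  thetaSum-nines N r = begin
    thetaSum sq N ≡⟨ sym (thetaSum-bounds N (ℕP.m≤m*n (suc N) 3)) ⟩
    ∑ B (λ j → ∑ B (sqTerm N j)) ≡⟨ ∑-multiples (suc N) 2 _
      (λ j 3∤j → ∑-zero B (λ l _ → weight-zero (weight j * weight l) {sq j l}
        (λ e → res-∤ 3∤j (proj₁ (both-zero j l e))))) ⟩
    ∑ (suc N) (λ i → ∑ B (sqTerm N (i ℕ.* 3))) ≡⟨ ∑-cong (suc N) (λ i → trans (∑-multiples (suc N) 2 _
         (λ l 3∤l → weight-zero (weight (i ℕ.* 3) * weight l) {sq (i ℕ.* 3) l}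
           (λ e → res-∤ 3∤l (proj₂ (both-zero (i ℕ.* 3) l e)))))
         (∑-cong (suc N) (λ l → cong₂ _*_ (cong₂ _*_ (weight-*3 i) (weight-*3 l))
           (cong (λ n → δ n N) (trans (cong₂ ℕ._+_ (nines i i) (nines l l))
             (sym (ℕP.*-distribʳ-+ 9 (i ℕ.* i) (l ℕ.* l)))))))) ⟩
    ∑ (suc N) (λ i → ∑ (suc N) (λ l → weight i * weight l * δ (sq i l ℕ.* 9) N)) ∎
    where
    B = suc N ℕ.* 3
    lem : ∀ a b → a ⊠ a ⊞ b ⊠ b ≡ 𝟎 → a ≡ 𝟎 × b ≡ 𝟎
    lem 𝟎 𝟎 _ = refl , refl
    lem 𝟎 𝟏 ()
    lem 𝟎 𝟐 ()
    lem 𝟏 𝟎 ()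
    lem 𝟏 𝟏 ()
    lem 𝟏 𝟐 ()
    lem 𝟐 𝟎 ()
    lem 𝟐 𝟏 ()
    lem 𝟐 𝟐 ()
    both-zero : ∀ j l → sq j l ≡ N → res j ≡ 𝟎 × res l ≡ 𝟎
    both-zero j l e = lem (res j) (res l) (trans (sym (cong₂ _⊞_ (res-* j j) (res-* l l)))
      (trans (sym (res-+ (j ℕ.* j) (l ℕ.* l))) (trans (cong res e) r)))

  9⊥2 : Coprime 9 2
  9⊥2 = toWitness {a? = coprime? 9 2} _

  -- If 9 does not divide N, both sides are 0. If N = 9K, both equal -R(K): the left side by ρ(3) =
  -- -1, the right side because r(N) = r(K).
  R-nines : ∀ n → let N = suc n in res N ≡ 𝟎 → PSum (N ℕ.+ N) both ≡ - R N
  R-nines n r with 9 ∣? suc n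
  ... | no 9∤N = trans both-0 (cong -_ (sym R-0))
    where
    N = suc n
    double : N ℕ.+ N ≡ 2 ℕ.* N
    double = cong (N ℕ.+_) (sym (ℕP.+-identityʳ N))
    both-0 : PSum (N ℕ.+ N) both ≡ 0ℤ
    both-0 = trans (PSum-both (n ℕ.+ N)) (∑-zero (suc (N ℕ.+ N)) (λ i _ → ∑-zero (suc (N ℕ.+ N)) (λ l _ →
      δ*-zero {i ℕ.* l ℕ.* 9} (- ρ (i ℕ.+ l)) (λ e → 9∤N
        (coprime-divisor {9} {2} 9⊥2 (divides (i ℕ.* l) (trans (sym double) (sym e))))))))
    -- The vanishing is read off the sums of two squares: `thetaSum-nines` leaves only totals
    -- divisible by 9.
    R-0 : R N ≡ 0ℤ
    R-0 = ℤP.*-cancelˡ-≡ (+ 2) (R N) 0ℤ (trans (sym (coeff-−2-R n)) (trans (coeff-−2 N) (trans (thetaSum-nines N r)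
      (∑-zero (suc N) (λ i _ → ∑-zero (suc N) (λ l _ → weight-zero (weight i * weight l) {sq i l ℕ.* 9}
        (λ e → 9∤N (divides (sq i l) (sym e)))))))))
  ... | yes (divides (suc k) e) = trans both-R (cong -_ (sym R-R))
    where
    N = suc n
    K′ = suc k
    K≤N : K′ ≤ N
    K≤N = subst (K′ ≤_) (sym e) (ℕP.m≤m*n K′ 9)
    double-9 : N ℕ.+ N ≡ (K′ ℕ.+ K′) ℕ.* 9
    double-9 = trans (cong₂ ℕ._+_ e e) (sym (ℕP.*-distribʳ-+ 9 K′ K′))
    both-R : PSum (N ℕ.+ N) both ≡ - R K′
    both-R = begin
      PSum (N ℕ.+ N) both ≡⟨ PSum-both (n ℕ.+ N) ⟩
      ∑ (suc (N ℕ.+ N)) (λ i → ∑ (suc (N ℕ.+ N)) (λ l → δ (i ℕ.* l ℕ.* 9) (N ℕ.+ N) * - ρ (i ℕ.+ l)))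
        ≡⟨ ∑-cong (suc (N ℕ.+ N)) (λ i → ∑-cong (suc (N ℕ.+ N))
             (λ l → cong (_* - ρ (i ℕ.+ l)) (δ-iff {m′ = i ℕ.* l} {n′ = K′ ℕ.+ K′}
             (λ e → ℕP.*-cancelʳ-≡ (i ℕ.* l) (K′ ℕ.+ K′) 9 (trans e double-9))
               (λ e → trans (cong (ℕ._* 9) e) (sym double-9))))) ⟩
      ∑ (suc (N ℕ.+ N)) (λ i → ∑ (suc (N ℕ.+ N)) (pairTerm (K′ ℕ.+ K′) (λ i l → - ρ (i ℕ.+ l)) i))
        ≡⟨ PSum-bounds (λ i l → - ρ (i ℕ.+ l)) (s≤s (ℕP.+-mono-≤ K≤N K≤N)) (s≤s (ℕP.+-mono-≤ K≤N K≤N)) ⟩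
      PSum (K′ ℕ.+ K′) (λ i l → - ρ (i ℕ.+ l)) ≡⟨ PSum-cong (K′ ℕ.+ K′) (λ n s _ → sym (ℤP.-1*i≡-i (ρ (n ℕ.+ s)))) ⟩
      PSum (K′ ℕ.+ K′) (λ i l → - 1ℤ * ρ (i ℕ.+ l)) ≡⟨ PSum-* (K′ ℕ.+ K′) (- 1ℤ) (λ i l → ρ (i ℕ.+ l)) ⟩
      - 1ℤ * R K′ ≡⟨ ℤP.-1*i≡-i (R K′) ⟩
      - R K′ ∎
    R-R : R N ≡ R K′
    R-R = ℤP.*-cancelˡ-≡ (+ 2) (R N) (R K′) (begin
      + 2 * R N ≡⟨ trans (sym (coeff-−2-R n)) (coeff-−2 N) ⟩
      thetaSum sq N ≡⟨ thetaSum-nines N r ⟩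
      ∑ (suc N) (λ i → ∑ (suc N) (λ l → weight i * weight l * δ (sq i l ℕ.* 9) N))
        ≡⟨ ∑-cong (suc N) (λ i → ∑-cong (suc N) (λ l → cong (weight i * weight l *_) (δ-iff {m′ = sq i l} {n′ = K′}
             (λ e′ → ℕP.*-cancelʳ-≡ (sq i l) K′ 9 (trans e′ e)) (λ e′ → trans (cong (ℕ._* 9) e′) (sym e))))) ⟩
      ∑ (suc N) (λ i → ∑ (suc N) (sqTerm K′ i)) ≡⟨ thetaSum-bounds K′ (s≤s K≤N) ⟩
      thetaSum sq K′ ≡⟨ trans (sym (coeff-−2 K′)) (coeff-−2-R k) ⟩
      + 2 * R K′ ∎)

  -- As 3 divides n s, κ(n - s) is 1 except when 3 divides both factors, where it is 1 - 3. The sum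
  -- is R - 3 (-R) = 4 R by `R-nines`.
  coeff-1-class0 : ∀ n → res (suc n) ≡ 𝟎 → C 1ℤ (suc n) ≡ C (- (+ 2)) (suc n)
  coeff-1-class0 n r = ℤP.*-cancelˡ-≡ (+ 2) _ _ (begin
    + 2 * C 1ℤ N ≡⟨ coeff-1-R n ⟩
    PSum M (λ n s → ρ (n ℕ.+ s) * K n s) ≡⟨ PSum-cong M (λ n s e → trans (cong (ρ (n ℕ.+ s) *_) (lem (res n) (res s)
        (trans (sym (res-* n s)) (trans (cong res e) (trans (res-+ N N) (cong (λ a → a ⊞ a) r))))))
        (solve 3 (λ x a b → x :* (con 1ℤ :+ con (- (+ 3)) :* (a :* b)) := x :+ con (- (+ 3)) :* (a :* (b :* x))) refl
          (ρ (n ℕ.+ s)) (ζ (res n)) (ζ (res s)))) ⟩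
    PSum M (λ n s → ρ (n ℕ.+ s) + - (+ 3) * both n s) ≡⟨ PSum-+ M (λ n s → ρ (n ℕ.+ s)) (λ n s → - (+ 3) * both n s) ⟩
    R N + PSum M (λ n s → - (+ 3) * both n s) ≡⟨ cong (_+_ (R N))
      (trans (PSum-* M (- (+ 3)) both) (cong (- (+ 3) *_) (R-nines n r))) ⟩
    R N + - (+ 3) * - R N ≡⟨ solve 1 (λ x → x :+ con (- (+ 3)) :* (:- x) := con (+ 2) :* (con (+ 2) :* x)) refl (R N) ⟩
    + 2 * (+ 2 * R N) ≡⟨ cong (+ 2 *_) (sym (coeff-−2-R n)) ⟩
    + 2 * C (- (+ 2)) N ∎)
    where
    N = suc n
    M = N ℕ.+ N
    lem : ∀ a b → a ⊠ b ≡ 𝟎 → κ (a ⊞ (b ⊞ b)) ≡ 1ℤ + - (+ 3) * (ζ a * ζ b)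
    lem 𝟎 𝟎 _ = refl
    lem 𝟎 𝟏 _ = refl
    lem 𝟎 𝟐 _ = refl
    lem 𝟏 𝟎 _ = refl
    lem 𝟐 𝟎 _ = refl

-- Representation numbers as theta coefficients

module Representations where
  open import Data.Integer using (_+_; _*_; -_; _-_)
  open ≡-Reasoning
  open FiniteSum ℤP.+-*-commutativeRing
  open ProductExpansion using (thetaSum; weight)
  open ℤSolver

  ind : ∀ {a} {P : Set a} → Dec P → ℤ
  ind (yes _) = 1ℤ
  ind (no _)  = 0ℤ

  listSum : ∀ {A : Set} → List A → (A → ℤ) → ℤ
  listSum []       h = 0ℤ
  listSum (x ∷ xs) h = h x + listSum xs h

  listSum-cong : ∀ {A : Set} (xs : List A) {g h} → (∀ x → g x ≡ h x) → listSum xs g ≡ listSum xs h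
  listSum-cong []       p = refl
  listSum-cong (x ∷ xs) p = cong₂ _+_ (p x) (listSum-cong xs p)

  length-filter-row : ∀ (Q : ℤ × ℤ → ℤ) z x ys → + length (filter (λ p → Q p ℤ.≟ z) (map (x ,_) ys)) ≡ listSum ys
    (λ y → ind (Q (x , y) ℤ.≟ z))
  length-filter-row Q z x []       = refl
  length-filter-row Q z x (y ∷ ys) with Q (x , y) ℤ.≟ z
  ... | yes _ = cong (_+_ 1ℤ) (length-filter-row Q z x ys)
  ... | no _  = trans (length-filter-row Q z x ys) (sym (ℤP.+-identityˡ _))

  length-filter-product : ∀ (Q : ℤ × ℤ → ℤ) z xs ys →
    + length (filter (λ p → Q p ℤ.≟ z) (cartesianProduct xs ys)) ≡ listSum xs
      (λ x → listSum ys (λ y → ind (Q (x , y) ℤ.≟ z)))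
  length-filter-product Q z []       ys = refl
  length-filter-product Q z (x ∷ xs) ys = trans (cong (+_ ∘ length)
    (filter-++ (λ p → Q p ℤ.≟ z) (map (x ,_) ys) (cartesianProduct xs ys)))
    (trans (cong +_ (length-++ (filter (λ p → Q p ℤ.≟ z) (map (x ,_) ys))))
      (cong₂ _+_ (length-filter-row Q z x ys) (length-filter-product Q z xs ys)))

  listSum-applyUpTo : ∀ {A : Set} (f : ℕ → A) h m → listSum (applyUpTo f m) h ≡ ∑ m (h ∘ f)
  listSum-applyUpTo f h zero    = refl
  listSum-applyUpTo f h (suc m) = trans (cong (_+_ (h (f 0))) (listSum-applyUpTo (f ∘ suc) h m))
    (sym (∑-head m (h ∘ f)))

  -- The list runs from -n to n; its negative half is reversed onto the positive one.
  box-sum : ∀ n (h : ℤ → ℤ) → (∀ x → h (- x) ≡ h x) → listSum (box n) h ≡ ∑ (suc n) (λ j → εℤ j * h (+ j))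
  box-sum n h h-even = begin
    listSum (box n) h ≡⟨ cong (λ xs → listSum xs h) (map-upTo (λ k → + k - + n) (suc (n ℕ.+ n))) ⟩
    listSum (applyUpTo (λ k → + k - + n) (suc n ℕ.+ n)) h ≡⟨ listSum-applyUpTo (λ k → + k - + n) h (suc n ℕ.+ n) ⟩
    ∑ (suc n ℕ.+ n) (λ k → h (+ k - + n)) ≡⟨ ∑-concat n (suc n) (λ k → h (+ k - + n)) ⟩
    ∑ n (λ k → h (+ k - + n)) + ∑ (suc n) (λ k → h (+ (k ℕ.+ n) - + n))
      ≡⟨ cong₂ _+_ (negative n) (trans (∑-cong (suc n) (λ k → cong h (cancel k))) (∑-head n (λ k → h (+ k)))) ⟩
    S + (h 0ℤ + S) ≡⟨ solve 2 (λ s z → s :+ (z :+ s) := con 1ℤ :* z :+ con (+ 2) :* s) refl S (h 0ℤ) ⟩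
    1ℤ * h 0ℤ + + 2 * S ≡⟨ cong (_+_ (1ℤ * h 0ℤ)) (*-distribˡ-∑ n (+ 2) (λ j → h (+ suc j))) ⟩
    1ℤ * h 0ℤ + ∑ n (λ j → + 2 * h (+ suc j)) ≡⟨ sym (∑-head n (λ j → εℤ j * h (+ j))) ⟩
    ∑ (suc n) (λ j → εℤ j * h (+ j)) ∎
    where
    S = ∑ n (λ j → h (+ suc j))
    cancel : ∀ k → + (k ℕ.+ n) - + n ≡ + k
    cancel k = solve 2 (λ k n → (k :+ n) :- n := k) refl (+ k) (+ n)
    negative : ∀ n → ∑ n (λ k → h (+ k - + n)) ≡ ∑ n (λ j → h (+ suc j))
    negative zero    = refl
    negative (suc n) = begin
      ∑ (suc n) (λ k → h (+ k - + suc n)) ≡⟨ ∑-head n (λ k → h (+ k - + suc n)) ⟩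
      h (0ℤ - + suc n) + ∑ n (λ k → h (+ suc k - + suc n))
        ≡⟨ cong₂ _+_ (h-even (+ suc n)) (trans (∑-cong n
             (λ k → cong h (trans (ℤP.[1+m]⊖[1+n]≡m⊖n k n) (sym (ℤP.m-n≡m⊖n k n))))) (negative n)) ⟩
      h (+ suc n) + ∑ n (λ j → h (+ suc j)) ≡⟨ ℤP.+-comm (h (+ suc n)) _ ⟩
      ∑ n (λ j → h (+ suc j)) + h (+ suc n) ∎

  countReps-sum : ∀ (Q : ℤ → ℤ → ℤ) (q : ℕ → ℕ → ℕ) n →
    (∀ x y → Q (- x) y ≡ Q x y) → (∀ x y → Q x (- y) ≡ Q x y) → (∀ j l → Q (+ j) (+ l) ≡ + q j l) →
    + countReps Q n ≡ ∑ (suc n) (λ j → ∑ (suc n) (λ l → εℤ j * εℤ l * δ (q j l) n))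
  countReps-sum Q q n evenˡ evenʳ onℕ = begin
    + countReps Q n ≡⟨ length-filter-product (λ p → Q (proj₁ p) (proj₂ p)) (+ n) (box n) (box n) ⟩
    listSum (box n) row ≡⟨ box-sum n row (λ x → listSum-cong (box n) (λ y → cong (λ z → ind (z ℤ.≟ + n)) (evenˡ x y))) ⟩
    ∑ (suc n) (λ j → εℤ j * row (+ j)) ≡⟨ ∑-cong (suc n)
      (λ j → cong (εℤ j *_) (box-sum n (λ y → ind (Q (+ j) y ℤ.≟ + n))
        (λ y → cong (λ z → ind (z ℤ.≟ + n)) (evenʳ (+ j) y)))) ⟩
    ∑ (suc n) (λ j → εℤ j * ∑ (suc n) (λ l → εℤ l * ind (Q (+ j) (+ l) ℤ.≟ + n)))
      ≡⟨ ∑-cong (suc n) (λ j → trans (*-distribˡ-∑ (suc n) (εℤ j) _) (∑-cong (suc n) (λ l →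
          trans (sym (ℤP.*-assoc (εℤ j) (εℤ l) _)) (cong (εℤ j * εℤ l *_)
            (trans (cong (λ z → ind (z ℤ.≟ + n)) (onℕ j l)) (ind-δ (q j l) n)))))) ⟩
    ∑ (suc n) (λ j → ∑ (suc n) (λ l → εℤ j * εℤ l * δ (q j l) n)) ∎
    where
    row : ℤ → ℤ
    row x = listSum (box n) (λ y → ind (Q x y ℤ.≟ + n))
    ind-δ : ∀ m n → ind (+ m ℤ.≟ + n) ≡ δ m n
    ind-δ m n with + m ℤ.≟ + n
    ... | yes e = sym (δ-≡ (ℤP.+-injective e))
    ... | no ne = sym (δ-≢ (λ e → ne (cong +_ e)))

  -- Where `δ (q j l) n` is nonzero the sign depends on `n` alone and comes out of the sum.
  thetaSum-sign : ∀ (q : ℕ → ℕ → ℕ) n σ → (∀ j l → q j l ≡ n → sgn j * sgn l ≡ σ) →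
    thetaSum q n ≡ σ * ∑ (suc n) (λ j → ∑ (suc n) (λ l → εℤ j * εℤ l * δ (q j l) n))
  thetaSum-sign q n σ h = sym (trans (*-distribˡ-∑ (suc n) σ _)
    (∑-cong (suc n) (λ j → trans (*-distribˡ-∑ (suc n) σ _) (∑-cong (suc n) (λ l → begin
    σ * (εℤ j * εℤ l * δ (q j l) n) ≡⟨ solve 4 (λ s a b d → s :* (a :* b :* d) := d :* s :* (a :* b)) refl σ (εℤ j)
      (εℤ l) (δ (q j l) n) ⟩
    δ (q j l) n * σ * (εℤ j * εℤ l) ≡⟨ cong (_* (εℤ j * εℤ l)) (sym (δ-*-cong (h j l))) ⟩
    δ (q j l) n * (sgn j * sgn l) * (εℤ j * εℤ l)
      ≡⟨ solve 5 (λ d s t a b → d :* (s :* t) :* (a :* b) := (a :* s) :* (b :* t) :* d) refl (δ (q j l) n) (sgn j)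
           (sgn l) (εℤ j) (εℤ l) ⟩
    weight j * weight l * δ (q j l) n ∎)))))

  sgn-square : ∀ j → sgn (j ℕ.* j) ≡ sgn j
  sgn-square zero    = refl
  sgn-square (suc j) = cong -_ (begin
    sgn (j ℕ.+ j ℕ.* suc j) ≡⟨ cong (λ m → sgn (j ℕ.+ m)) (ℕP.*-suc j j) ⟩
    sgn (j ℕ.+ (j ℕ.+ j ℕ.* j)) ≡⟨ trans (sgn-+ j (j ℕ.+ j ℕ.* j)) (cong (sgn j *_) (sgn-+ j (j ℕ.* j))) ⟩
    sgn j * (sgn j * sgn (j ℕ.* j)) ≡⟨ trans (sym (ℤP.*-assoc (sgn j) _ _))
      (trans (cong (_* sgn (j ℕ.* j)) (sgn-square-1 j)) (ℤP.*-identityˡ _)) ⟩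
    sgn (j ℕ.* j) ≡⟨ sgn-square j ⟩
    sgn j ∎)

  thetaSum-r : ∀ n → thetaSum (λ j l → j ℕ.* j ℕ.+ l ℕ.* l) n ≡ sgn n * + r n
  thetaSum-r n = trans (thetaSum-sign (λ j l → j ℕ.* j ℕ.+ l ℕ.* l) n (sgn n)
    (λ j l e → trans (sym (cong₂ _*_ (sgn-square j) (sgn-square l)))
      (trans (sym (sgn-+ (j ℕ.* j) (l ℕ.* l))) (cong sgn e))))
    (cong (sgn n *_) (sym (countReps-sum (λ x y → x * x + y * y) (λ j l → j ℕ.* j ℕ.+ l ℕ.* l) n
      (λ x y → solve 2 (λ x y → (:- x) :* (:- x) :+ y :* y := x :* x :+ y :* y) refl x y)
      (λ x y → solve 2 (λ x y → x :* x :+ (:- y) :* (:- y) := x :* x :+ y :* y) refl x y)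
      (λ j l → cong₂ _+_ (sym (ℤP.pos-* j j)) (sym (ℤP.pos-* l l))))))

  -- The sign (-1)^(j+l) of a solution of j² + 2l² = n, expressed by n.
  halfSgn : ℕ → ℤ
  halfSgn n = sgn ⌊ n ℕ.+ 1 /2⌋

  halfSgn-double : ∀ x m → halfSgn (x ℕ.+ x ℕ.+ m) ≡ sgn x * halfSgn m
  halfSgn-double zero    m = sym (ℤP.*-identityˡ _)
  halfSgn-double (suc x) m = trans (cong (λ y → halfSgn (suc y ℕ.+ m)) (ℕP.+-suc x x))
    (trans (cong -_ (halfSgn-double x m)) (ℤP.neg-distribˡ-* (sgn x) _))

  -- Even squares are divisible by 4, and odd squares are 1 modulo 4.
  halfSgn-square : ∀ j → halfSgn (j ℕ.* j) ≡ sgn j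
  halfSgn-square j with parity j
  ... | inj₁ (i , refl) = begin
    halfSgn (i ℕ.* 2 ℕ.* (i ℕ.* 2)) ≡⟨ cong halfSgn (N.solve 1
      (λ i → i N.:* N.con 2 N.:* (i N.:* N.con 2) N.:= i N.:* i N.:* N.con 2 N.:+ i N.:* i N.:* N.con 2 N.:+ N.con 0)
        refl i) ⟩
    halfSgn (i ℕ.* i ℕ.* 2 ℕ.+ i ℕ.* i ℕ.* 2 ℕ.+ 0) ≡⟨ trans (halfSgn-double (i ℕ.* i ℕ.* 2) 0)
      (cong (_* 1ℤ) (sgn-*2 (i ℕ.* i))) ⟩
    1ℤ ≡⟨ sym (sgn-*2 i) ⟩
    sgn (i ℕ.* 2) ∎
    where module N = ℕSolver
  ... | inj₂ (i , refl) = begin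
    halfSgn (suc (i ℕ.* 2) ℕ.* suc (i ℕ.* 2))
      ≡⟨ cong halfSgn (N.solve 1 (λ i → (N.con 1 N.:+ i N.:* N.con 2) N.:* (N.con 1 N.:+ i N.:* N.con 2)
            N.:= (i N.:* i N.:+ i) N.:* N.con 2 N.:+ (i N.:* i N.:+ i) N.:* N.con 2 N.:+ N.con 1) refl i) ⟩
    halfSgn ((i ℕ.* i ℕ.+ i) ℕ.* 2 ℕ.+ (i ℕ.* i ℕ.+ i) ℕ.* 2 ℕ.+ 1)
      ≡⟨ trans (halfSgn-double ((i ℕ.* i ℕ.+ i) ℕ.* 2) 1) (cong (_* (- 1ℤ)) (sgn-*2 (i ℕ.* i ℕ.+ i))) ⟩
    - 1ℤ ≡⟨ cong -_ (sym (sgn-*2 i)) ⟩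
    sgn (suc (i ℕ.* 2)) ∎
    where module N = ℕSolver

  thetaSum-r′ : ∀ n → thetaSum (λ j l → j ℕ.* j ℕ.+ (l ℕ.* l ℕ.+ l ℕ.* l)) n ≡ halfSgn n * + r′ n
  thetaSum-r′ n = trans (thetaSum-sign (λ j l → j ℕ.* j ℕ.+ (l ℕ.* l ℕ.+ l ℕ.* l)) n (halfSgn n)
    (λ j l e → trans (ℤP.*-comm (sgn j) (sgn l)) (trans (sym (cong₂ _*_ (sgn-square l) (halfSgn-square j)))
      (trans (sym (halfSgn-double (l ℕ.* l) (j ℕ.* j)))
        (cong halfSgn (trans (ℕP.+-comm (l ℕ.* l ℕ.+ l ℕ.* l) (j ℕ.* j)) e))))))
    (cong (halfSgn n *_) (sym (countReps-sum (λ x y → x * x + + 2 * (y * y))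
      (λ j l → j ℕ.* j ℕ.+ (l ℕ.* l ℕ.+ l ℕ.* l)) n
      (λ x y → solve 2 (λ x y → (:- x) :* (:- x) :+ con (+ 2) :* (y :* y) := x :* x :+ con (+ 2) :* (y :* y)) refl x y)
      (λ x y → solve 2 (λ x y → x :* x :+ con (+ 2) :* ((:- y) :* (:- y)) := x :* x :+ con (+ 2) :* (y :* y)) refl x y)
      (λ j l → cong₂ _+_ (sym (ℤP.pos-* j j)) (trans (cong (+ 2 *_) (sym (ℤP.pos-* l l)))
         (solve 1 (λ x → con (+ 2) :* x := x :+ x) refl (+ (l ℕ.* l))))))))

open import Data.Nat using (_+_)

-- Integers and fractions inside the evaluation rings

module Fractions where
  fromℚᵘ-+ : ∀ p q → ℚ.fromℚᵘ p ℚ.+ ℚ.fromℚᵘ q ≡ ℚ.fromℚᵘ (p ℚᵘ.+ q)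
  fromℚᵘ-+ p q = ℚP.toℚᵘ-injective (ℚᵘP.≃-trans (ℚP.toℚᵘ-homo-+ (ℚ.fromℚᵘ p) (ℚ.fromℚᵘ q))
    (ℚᵘP.≃-trans (ℚᵘP.+-cong (ℚP.toℚᵘ-fromℚᵘ p) (ℚP.toℚᵘ-fromℚᵘ q)) (ℚᵘP.≃-sym (ℚP.toℚᵘ-fromℚᵘ (p ℚᵘ.+ q)))))

  fromℚᵘ-* : ∀ p q → ℚ.fromℚᵘ p ℚ.* ℚ.fromℚᵘ q ≡ ℚ.fromℚᵘ (p ℚᵘ.* q)
  fromℚᵘ-* p q = ℚP.toℚᵘ-injective (ℚᵘP.≃-trans (ℚP.toℚᵘ-homo-* (ℚ.fromℚᵘ p) (ℚ.fromℚᵘ q))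
    (ℚᵘP.≃-trans (ℚᵘP.*-cong (ℚP.toℚᵘ-fromℚᵘ p) (ℚP.toℚᵘ-fromℚᵘ q)) (ℚᵘP.≃-sym (ℚP.toℚᵘ-fromℚᵘ (p ℚᵘ.* q)))))

  suc/1 : ∀ n → ℚ.1ℚ ℚ.+ (+ n) ℚ./ 1 ≡ (+ suc n) ℚ./ 1
  suc/1 n = trans (fromℚᵘ-+ (ℚᵘ.mkℚᵘ (+ 1) 0) (ℚᵘ.mkℚᵘ (+ n) 0))
    (ℚP.fromℚᵘ-cong {ℚᵘ.mkℚᵘ (+ 1) 0 ℚᵘ.+ ℚᵘ.mkℚᵘ (+ n) 0} {ℚᵘ.mkℚᵘ (+ suc n) 0} (ℚᵘ.*≡*
    (solve 1 (λ n → (con (+ 1) :* con (+ 1) :+ n :* con (+ 1)) :* con (+ 1) := (con (+ 1) :+ n) :* con (+ 1)) refl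
      (+ n))))
    where open ℤSolver

  -- Relates a fraction of the theorem to the image of an integer times a unit fraction, the form
  -- that the ring computations yield.
  split-/ : ∀ z d → z ℚ./ suc d ≡ (z ℚ./ 1) ℚ.* ((+ 1) ℚ./ suc d)
  split-/ z d = sym (trans (fromℚᵘ-* (ℚᵘ.mkℚᵘ z 0) (ℚᵘ.mkℚᵘ (+ 1) d))
    (ℚP.fromℚᵘ-cong {ℚᵘ.mkℚᵘ z 0 ℚᵘ.* ℚᵘ.mkℚᵘ (+ 1) d} {ℚᵘ.mkℚᵘ z d} (ℚᵘ.*≡*
    (trans (cong (ℤ._* + suc d) (ℤP.*-identityʳ z)) (cong (λ k → z ℤ.* + suc k) (sym (ℕP.+-identityʳ d)))))))

  natR-ℚ : ∀ n → natR ℚR n ≡ (+ n) ℚ./ 1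
  natR-ℚ zero    = refl
  natR-ℚ (suc n) = trans (cong (ℚ.1ℚ ℚ.+_) (natR-ℚ n)) (suc/1 n)

  intR-ℚ : ∀ z → intR ℚR z ≡ z ℚ./ 1
  intR-ℚ (+ n)    = natR-ℚ n
  intR-ℚ -[1+ n ] = cong ℚ.-_ (natR-ℚ (suc n))

  natR-ℚ[i] : ∀ n → natR ℚ[i]R n ≡ ι ((+ n) ℚ./ 1)
  natR-ℚ[i] zero    = refl
  natR-ℚ[i] (suc n) = trans (cong (RingOps._⊕_ ℚ[i]R (ℚ.1ℚ , ℚ.0ℚ)) (natR-ℚ[i] n)) (cong ι (suc/1 n))

  intR-ℚ[i] : ∀ z → intR ℚ[i]R z ≡ ι (z ℚ./ 1)
  intR-ℚ[i] (+ n)    = natR-ℚ[i] n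
  intR-ℚ[i] -[1+ n ] = cong (RingOps.⊖_ ℚ[i]R) (natR-ℚ[i] (suc n))

  natR-ℚ[j] : ∀ n → natR ℚ[j]R n ≡ ι ((+ n) ℚ./ 1)
  natR-ℚ[j] zero    = refl
  natR-ℚ[j] (suc n) = trans (cong (RingOps._⊕_ ℚ[j]R (ℚ.1ℚ , ℚ.0ℚ)) (natR-ℚ[j] n)) (cong ι (suc/1 n))

  intR-ℚ[j] : ∀ z → intR ℚ[j]R z ≡ ι (z ℚ./ 1)
  intR-ℚ[j] (+ n)    = natR-ℚ[j] n
  intR-ℚ[j] -[1+ n ] = cong (RingOps.⊖_ ℚ[j]R) (natR-ℚ[j] (suc n))

  ι-* : ∀ a b → gmul (ι a) (ι b) ≡ ι (a ℚ.* b)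
  ι-* a b = cong₂ _,_ (solve 2 (λ a b → a :* b :- con ℚ.0ℚ :* con ℚ.0ℚ := a :* b) refl a b)
                      (solve 2 (λ a b → a :* con ℚ.0ℚ :+ con ℚ.0ℚ :* b := con ℚ.0ℚ) refl a b)
    where open ℚSolver

  ι-*ʲ : ∀ a b → emul (ι a) (ι b) ≡ ι (a ℚ.* b)
  ι-*ʲ a b = cong₂ _,_ (solve 2 (λ a b → a :* b :- con ℚ.0ℚ :* con ℚ.0ℚ := a :* b) refl a b)
                       (solve 2 (λ a b → a :* con ℚ.0ℚ :+ con ℚ.0ℚ :* b :- con ℚ.0ℚ :* con ℚ.0ℚ := con ℚ.0ℚ) refl a b)
    where open ℚSolver

open Fractions

-- Evaluation at -1, j, i and -j

module AtMinusOne where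
  open IntegerImage ℚR ℚ-isCR using (⟦_⟧; ⟦*⟧; _*_; *-identityˡ; *-assoc; *-comm)
  open Evaluation ℚR ℚ-isCR (ℚ.- ℚ.1ℚ) (ℚ.- ℚ.1ℚ) refl
  open AtPoint (ℤ.- (+ 2)) refl
  open ≡-Reasoning

  pow-sgn : ∀ n → pow n ≡ ⟦ sgn n ⟧
  pow-sgn zero    = refl
  pow-sgn (suc n) = trans (cong ((ℚ.- ℚ.1ℚ) *_) (pow-sgn n))
    (trans (sym (⟦*⟧ (ℤ.- 1ℤ) (sgn n))) (cong ⟦_⟧ (ℤP.-1*i≡-i (sgn n))))

  sgn-cancel : ∀ n x → sgn n ℤ.* (sgn n ℤ.* x) ≡ x
  sgn-cancel n x = trans (sym (ℤP.*-assoc (sgn n) (sgn n) x))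
    (trans (cong (ℤ._* x) (sgn-square-1 n)) (ℤP.*-identityˡ x))

  Cat-−1 : ∀ n → Cat ℚR (ℚ.- ℚ.1ℚ) (ℚ.- ℚ.1ℚ) n ≡ (+ r n) ℚ./ 1
  Cat-−1 n = begin
    Cat ℚR (ℚ.- ℚ.1ℚ) (ℚ.- ℚ.1ℚ) n ≡⟨ Cat-value n ⟩
    pow n * ⟦ Coefficients.C (ℤ.- (+ 2)) n ⟧ ≡⟨ cong₂ _*_ (pow-sgn n)
      (cong ⟦_⟧ (trans (ProductExpansion.coeff-−2 n) (Representations.thetaSum-r n))) ⟩
    ⟦ sgn n ⟧ * ⟦ sgn n ℤ.* + r n ⟧ ≡⟨ sym (⟦*⟧ (sgn n) (sgn n ℤ.* + r n)) ⟩
    ⟦ sgn n ℤ.* (sgn n ℤ.* + r n) ⟧ ≡⟨ cong ⟦_⟧ (sgn-cancel n (+ r n)) ⟩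
    ⟦ + r n ⟧ ≡⟨ intR-ℚ (+ r n) ⟩
    (+ r n) ℚ./ 1 ∎

  Pat-−1 : ∀ n → Pat ℚR (ℚ.- ℚ.1ℚ) (ℚ.- ℚ.1ℚ) (suc n) ≡ (+ r (suc n)) ℚ./ 4
  Pat-−1 n = begin
    -- Here (q - 1)² = 4, and 1/4 · 4 computes to 1, so it can be inserted as the unit.
    P ≡⟨ sym (*-identityˡ P) ⟩
    (+ 1) ℚ./ 4 * ((+ 4) ℚ./ 1) * P ≡⟨ *-assoc ((+ 1) ℚ./ 4) ((+ 4) ℚ./ 1) P ⟩
    (+ 1) ℚ./ 4 * ((+ 4) ℚ./ 1 * P) ≡⟨ cong ((+ 1) ℚ./ 4 *_)
      (trans (Pat-value (suc n) (Divisibility.Cpoly-doubleRoot n)) (Cat-−1 (suc n))) ⟩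
    (+ 1) ℚ./ 4 * ((+ r (suc n)) ℚ./ 1) ≡⟨ trans (*-comm ((+ 1) ℚ./ 4) ((+ r (suc n)) ℚ./ 1))
      (sym (split-/ (+ r (suc n)) 3)) ⟩
    (+ r (suc n)) ℚ./ 4 ∎
    where P = Pat ℚR (ℚ.- ℚ.1ℚ) (ℚ.- ℚ.1ℚ) (suc n)

module ℚ[j]Ring = IntegerImage ℚ[j]R ℚ[j]-isCR
module ℚ[i]Ring = IntegerImage ℚ[i]R ℚ[i]-isCR

module AtJ where
  open ℚ[j]Ring using (⟦_⟧; ⟦*⟧; _*_; *-identityˡ; *-comm)
  open Evaluation ℚ[j]R ℚ[j]-isCR 𝐣 𝐣⁻¹ refl
  open AtPoint (ℤ.- 1ℤ) refl
  open ≡-Reasoning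
  open ℚ[j]Ring.RSolver using (solve; _:*_; _:=_)

  coeff-λ : ∀ λ′ → IsLambda λ′ → ∀ n → Coefficients.C (ℤ.- 1ℤ) (suc n) ≡ ℤ.- (+ 3) ℤ.* λ′ (suc n)
  coeff-λ λ′ isλ n = trans (LambdaSum.coeff-−1 n) (trans
    (z.solve 1 (λ x → z.con (+ 3) z.:* x z.:= z.con (ℤ.- (+ 3)) z.:* (z.:- x)) refl _)
    (cong (ℤ.- (+ 3) ℤ.*_) (trans (LambdaSum.χ+-E (suc n)) (sym (LambdaValues.λ-value λ′ isλ n)))))
    where module z = ℤSolver

  Cat-j : ∀ λ′ → IsLambda λ′ → ∀ n → Cat ℚ[j]R 𝐣 𝐣⁻¹ (suc n) ≡ ⟦ ℤ.- (+ 3) ℤ.* λ′ (suc n) ⟧ * pow (suc n)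
  Cat-j λ′ isλ n = trans (Cat-value (suc n)) (trans (*-comm (pow (suc n)) _)
    (cong (λ z → ⟦ z ⟧ * pow (suc n)) (coeff-λ λ′ isλ n)))

  -- (j - 1)² = -3 j
  Pat-j : ∀ λ′ → IsLambda λ′ → ∀ n → Pat ℚ[j]R 𝐣 𝐣⁻¹ (suc n) ≡ ⟦ λ′ (suc n) ⟧ * pow n
  Pat-j λ′ isλ n = begin
    P ≡⟨ sym (*-identityˡ P) ⟩
    u * ⟦ ℤ.- (+ 3) ⟧ * 𝐣 * P ≡⟨ solve 4 (λ u a j p → u :* a :* j :* p := u :* (a :* j :* p)) refl u ⟦ ℤ.- (+ 3) ⟧ 𝐣 P ⟩
    u * (⟦ ℤ.- (+ 3) ⟧ * 𝐣 * P) ≡⟨ cong (u *_) (trans (Pat-value (suc n) (Divisibility.Cpoly-doubleRoot n))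
      (Cat-j λ′ isλ n)) ⟩
    u * (⟦ ℤ.- (+ 3) ℤ.* λ′ (suc n) ⟧ * (𝐣 * pow n)) ≡⟨ cong (λ z → u * (z * (𝐣 * pow n)))
      (⟦*⟧ (ℤ.- (+ 3)) (λ′ (suc n))) ⟩
    u * (⟦ ℤ.- (+ 3) ⟧ * ⟦ λ′ (suc n) ⟧ * (𝐣 * pow n)) ≡⟨ solve 5
      (λ u a l j p → u :* (a :* l :* (j :* p)) := u :* a :* j :* (l :* p)) refl u ⟦ ℤ.- (+ 3) ⟧ ⟦ λ′ (suc n) ⟧ 𝐣
        (pow n) ⟩
    u * ⟦ ℤ.- (+ 3) ⟧ * 𝐣 * (⟦ λ′ (suc n) ⟧ * pow n) ≡⟨ *-identityˡ _ ⟩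
    ⟦ λ′ (suc n) ⟧ * pow n ∎
    where
    P = Pat ℚ[j]R 𝐣 𝐣⁻¹ (suc n)
    u : ℚ[j]
    -- The inverse of -3 j, which is (1 + j)/3 because j⁻¹ = -1 - j.
    u = (+ 1) ℚ./ 3 , (+ 1) ℚ./ 3

module AtI where
  open ℚ[i]Ring using (⟦_⟧; ⟦*⟧; _*_; *-identityˡ; *-assoc; *-comm)
  open Evaluation ℚ[i]R ℚ[i]-isCR 𝐢 𝐢⁻¹ refl
  open AtPoint 0ℤ refl
  open ≡-Reasoning
  open ℚ[i]Ring.RSolver using (solve; _:*_; _:=_)

  Cat-i : ∀ n → Cat ℚ[i]R 𝐢 𝐢⁻¹ n ≡ ⟦ -1ℤ ^ ⌊ n + 1 /2⌋ ℤ.* + r′ n ⟧ * pow n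
  Cat-i n = trans (Cat-value n) (trans (*-comm (pow n) _) (cong (λ z → ⟦ z ⟧ * pow n)
    (trans (ProductExpansion.coeff-0 n) (trans (Representations.thetaSum-r′ n)
      (cong (ℤ._* + r′ n) (sym (LambdaValues.sgn-^ ⌊ n + 1 /2⌋)))))))

  scaled-half : ∀ a z → ⟦ a ⟧ * (⟦ z ⟧ * ι ((+ 1) ℚ./ 2)) ≡ ι (a ℚ./ 1 ℚ.* (z ℚ./ 2))
  scaled-half a z = trans (cong₂ _*_ (intR-ℚ[i] a) (trans (cong (_* ι ((+ 1) ℚ./ 2)) (intR-ℚ[i] z))
      (trans (ι-* (z ℚ./ 1) ((+ 1) ℚ./ 2)) (cong ι (sym (split-/ z 1))))))
    (ι-* (a ℚ./ 1) (z ℚ./ 2))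

  -- (i - 1)² = -2 i
  Pat-i : ∀ n → Pat ℚ[i]R 𝐢 𝐢⁻¹ (suc n) ≡ ι ((-1ℤ ^ ⌊ n /2⌋) ℚ./ 1 ℚ.* ((+ r′ (suc n)) ℚ./ 2)) * pow n
  Pat-i n = begin
    P ≡⟨ sym (*-identityˡ P) ⟩
    ι ((+ 1) ℚ./ 2) * 𝐢 * (⟦ ℤ.- (+ 2) ⟧ * 𝐢) * P ≡⟨ *-assoc (ι ((+ 1) ℚ./ 2) * 𝐢) (⟦ ℤ.- (+ 2) ⟧ * 𝐢) P ⟩
    ι ((+ 1) ℚ./ 2) * 𝐢 * (⟦ ℤ.- (+ 2) ⟧ * 𝐢 * P)
      ≡⟨ cong (ι ((+ 1) ℚ./ 2) * 𝐢 *_) (trans (Pat-value (suc n) (Divisibility.Cpoly-doubleRoot n)) (Cat-i (suc n))) ⟩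
    ι ((+ 1) ℚ./ 2) * 𝐢 * (⟦ -1ℤ ^ ⌊ suc (n + 1) /2⌋ ℤ.* + r′ (suc n) ⟧ * (𝐢 * pow n))
      -- Passing from ⌊(n+2)/2⌋ to ⌊n/2⌋ leaves a factor -1, which is used up by i · (-1) · i = 1.
      ≡⟨ cong (λ z → ι ((+ 1) ℚ./ 2) * 𝐢 * (z * (𝐢 * pow n)))
           (trans (cong ⟦_⟧ (trans (cong (λ m → -1ℤ ^ ⌊ suc m /2⌋ ℤ.* + r′ (suc n)) (ℕP.+-comm n 1))
             (ℤP.*-assoc -1ℤ s (+ r′ (suc n)))))
           (trans (⟦*⟧ -1ℤ (s ℤ.* + r′ (suc n))) (cong (⟦ -1ℤ ⟧ *_) (⟦*⟧ s (+ r′ (suc n)))))) ⟩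
    ι ((+ 1) ℚ./ 2) * 𝐢 * (⟦ -1ℤ ⟧ * (⟦ s ⟧ * ⟦ + r′ (suc n) ⟧) * (𝐢 * pow n))
      ≡⟨ solve 6 (λ h i m s r p → h :* i :* (m :* (s :* r) :* (i :* p)) := i :* m :* i :* (s :* (r :* h) :* p)) refl
           (ι ((+ 1) ℚ./ 2)) 𝐢 ⟦ -1ℤ ⟧ ⟦ s ⟧ ⟦ + r′ (suc n) ⟧ (pow n) ⟩
    𝐢 * ⟦ -1ℤ ⟧ * 𝐢 * (⟦ s ⟧ * (⟦ + r′ (suc n) ⟧ * ι ((+ 1) ℚ./ 2)) * pow n) ≡⟨ *-identityˡ _ ⟩
    ⟦ s ⟧ * (⟦ + r′ (suc n) ⟧ * ι ((+ 1) ℚ./ 2)) * pow n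
      ≡⟨ cong (_* pow n) (scaled-half s (+ r′ (suc n))) ⟩
    ι (s ℚ./ 1 ℚ.* ((+ r′ (suc n)) ℚ./ 2)) * pow n ∎
    where
    P = Pat ℚ[i]R 𝐢 𝐢⁻¹ (suc n)
    s = -1ℤ ^ ⌊ n /2⌋

module AtMinusJ where
  open ℚ[j]Ring using (⟦_⟧; ⟦*⟧; ⟦neg⟧; _*_; -_; *-identityˡ; *-comm)
  open Evaluation ℚ[j]R ℚ[j]-isCR -𝐣 -𝐣⁻¹ refl
  open AtPoint 1ℤ refl
  open ≡-Reasoning
  open ℚ[j]Ring.RSolver using (solve; _:*_; :-_; _:=_)
  open Coefficients using (C)

  j^ : ℤ₃ → ℚ[j]
  j^ 𝟎 = ⟦ 1ℤ ⟧
  j^ 𝟏 = 𝐣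
  j^ 𝟐 = emul 𝐣 𝐣

  -- (-j)ⁿ (-1)ⁿ = jⁿ depends on n modulo 3 only; the sign is the one by which the coefficient at c
  -- = -2 differs from r(n).
  pow-sgn : ∀ n → pow n * ⟦ sgn n ⟧ ≡ j^ (res n)
  pow-sgn zero    = refl
  pow-sgn (suc n) = begin
    -𝐣 * pow n * ⟦ ℤ.- sgn n ⟧ ≡⟨ cong (-𝐣 * pow n *_) (trans (cong ⟦_⟧ (sym (ℤP.-1*i≡-i (sgn n)))) (⟦*⟧ -1ℤ (sgn n))) ⟩
    -𝐣 * pow n * (⟦ -1ℤ ⟧ * ⟦ sgn n ⟧) ≡⟨ solve 4 (λ j p m s → j :* p :* (m :* s) := j :* m :* (p :* s)) refl -𝐣
      (pow n) ⟦ -1ℤ ⟧ ⟦ sgn n ⟧ ⟩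
    𝐣 * (pow n * ⟦ sgn n ⟧) ≡⟨ cong (𝐣 *_) (pow-sgn n) ⟩
    𝐣 * j^ (res n) ≡⟨ step (res n) ⟩
    j^ (res (suc n)) ∎
    where
    step : ∀ a → 𝐣 * j^ a ≡ j^ (𝟏 ⊞ a)
    step = cases₁ refl refl refl

  res-%3 : ∀ n → res n ≡ res (n % 3)
  res-%3 n = trans (cong res (m≡m%n+[m/n]*n n 3)) (trans (res-+ (n % 3) (n ℕ./ 3 ℕ.* 3))
    (trans (cong (res (n % 3) ⊞_) (res-*3 (n ℕ./ 3))) (⊞-zeroʳ (res (n % 3)))))

  res-of : ∀ {n k} → n % 3 ≡ k → res n ≡ res k
  res-of {n} e = trans (res-%3 n) (cong res e)

  coeff-r : ∀ n → C (ℤ.- (+ 2)) n ≡ sgn n ℤ.* + r n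
  coeff-r n = trans (ProductExpansion.coeff-−2 n) (Representations.thetaSum-r n)

  -- Treats the three residue classes alike: `m` is the factor 1, 4 or 2 between the coefficients at
  -- c = 1 and c = -2, `u` its inverse, and `a` is r(n) up to sign.
  scaled : ∀ n m a u → m ℤ.* C 1ℤ n ≡ sgn n ℤ.* a → u * ⟦ m ⟧ ≡ ⟦ 1ℤ ⟧ → Cat ℚ[j]R -𝐣 -𝐣⁻¹ n ≡ ⟦ a ⟧ * u * j^ (res n)
  scaled n m a u e um = begin
    Cat ℚ[j]R -𝐣 -𝐣⁻¹ n ≡⟨ Cat-value n ⟩
    pow n * ⟦ C 1ℤ n ⟧ ≡⟨ sym (*-identityˡ _) ⟩
    ⟦ 1ℤ ⟧ * (pow n * ⟦ C 1ℤ n ⟧) ≡⟨ cong (_* (pow n * ⟦ C 1ℤ n ⟧)) (sym um) ⟩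
    u * ⟦ m ⟧ * (pow n * ⟦ C 1ℤ n ⟧) ≡⟨ solve 4 (λ u m p c → u :* m :* (p :* c) := u :* p :* (m :* c)) refl u ⟦ m ⟧
      (pow n) ⟦ C 1ℤ n ⟧ ⟩
    u * pow n * (⟦ m ⟧ * ⟦ C 1ℤ n ⟧) ≡⟨ cong (u * pow n *_)
      (trans (sym (⟦*⟧ m (C 1ℤ n))) (trans (cong ⟦_⟧ e) (⟦*⟧ (sgn n) a))) ⟩
    u * pow n * (⟦ sgn n ⟧ * ⟦ a ⟧) ≡⟨ solve 4 (λ u p s a → u :* p :* (s :* a) := a :* u :* (p :* s)) refl u (pow n) ⟦
      sgn n ⟧ ⟦ a ⟧ ⟩
    ⟦ a ⟧ * u * (pow n * ⟦ sgn n ⟧) ≡⟨ cong (⟦ a ⟧ * u *_) (pow-sgn n) ⟩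
    ⟦ a ⟧ * u * j^ (res n) ∎

  fraction : ∀ z d → ⟦ z ⟧ * ι ((+ 1) ℚ./ suc d) ≡ ι (z ℚ./ suc d)
  fraction z d = trans (cong (_* ι ((+ 1) ℚ./ suc d)) (intR-ℚ[j] z))
    (trans (ι-*ʲ (z ℚ./ 1) ((+ 1) ℚ./ suc d)) (cong ι (sym (split-/ z d))))

  neg-fraction : ∀ z d → ⟦ ℤ.- z ⟧ * ι ((+ 1) ℚ./ suc d) ≡ ι (ℚ.- (z ℚ./ suc d))
  neg-fraction z d = trans (cong (_* ι ((+ 1) ℚ./ suc d)) (⟦neg⟧ z))
    (trans (neg-* ⟦ z ⟧ (ι ((+ 1) ℚ./ suc d))) (cong (RingOps.⊖_ ℚ[j]R) (fraction z d)))
    where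
    neg-* : ∀ a b → (- a) * b ≡ - (a * b)
    neg-* = solve 2 (λ a b → (:- a) :* b := :- (a :* b)) refl

  Cat-0 : ∀ n → suc n % 3 ≡ 0 → Cat ℚ[j]R -𝐣 -𝐣⁻¹ (suc n) ≡ ι ((+ r (suc n)) ℚ./ 1)
  Cat-0 n e = begin
    Cat ℚ[j]R -𝐣 -𝐣⁻¹ (suc n) ≡⟨ scaled (suc n) 1ℤ (+ r (suc n)) ⟦ 1ℤ ⟧
      (trans (ℤP.*-identityˡ _) (trans (SixthRoot.coeff-1-class0 n ρ0) (coeff-r (suc n)))) refl ⟩
    ⟦ + r (suc n) ⟧ * ⟦ 1ℤ ⟧ * j^ (res (suc n)) ≡⟨ cong (λ a → ⟦ + r (suc n) ⟧ * ⟦ 1ℤ ⟧ * j^ a) ρ0 ⟩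
    ⟦ + r (suc n) ⟧ * ⟦ 1ℤ ⟧ * ⟦ 1ℤ ⟧ ≡⟨ trans (*-comm (⟦ + r (suc n) ⟧ * ⟦ 1ℤ ⟧) ⟦ 1ℤ ⟧)
      (trans (*-identityˡ _) (trans (*-comm ⟦ + r (suc n) ⟧ ⟦ 1ℤ ⟧) (*-identityˡ _))) ⟩
    ⟦ + r (suc n) ⟧ ≡⟨ intR-ℚ[j] (+ r (suc n)) ⟩
    ι ((+ r (suc n)) ℚ./ 1) ∎
    where
    ρ0 : res (suc n) ≡ 𝟎
    ρ0 = res-of {suc n} e

  Cat-1 : ∀ n → suc n % 3 ≡ 1 → Cat ℚ[j]R -𝐣 -𝐣⁻¹ (suc n) ≡ emul (ι ((+ r (suc n)) ℚ./ 4)) 𝐣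
  Cat-1 n e = trans (scaled (suc n) (+ 4) (+ r (suc n)) (ι ((+ 1) ℚ./ 4))
    (trans (SixthRoot.coeff-1-class1 n ρ1) (coeff-r (suc n))) refl)
    (cong₂ _*_ (fraction (+ r (suc n)) 3) (cong j^ ρ1))
    where
    ρ1 : res (suc n) ≡ 𝟏
    ρ1 = res-of {suc n} e

  Cat-2 : ∀ n → suc n % 3 ≡ 2 → Cat ℚ[j]R -𝐣 -𝐣⁻¹ (suc n) ≡ emul (ι (ℚ.- ((+ r (suc n)) ℚ./ 2))) (emul 𝐣 𝐣)
  Cat-2 n e = trans (scaled (suc n) (+ 2) (ℤ.- + r (suc n)) (ι ((+ 1) ℚ./ 2))
      (trans (SixthRoot.coeff-1-class2 n ρ2) (trans (cong ℤ.-_ (coeff-r (suc n)))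
        (ℤP.neg-distribʳ-* (sgn (suc n)) (+ r (suc n))))) refl)
    (cong₂ _*_ (neg-fraction (+ r (suc n)) 1) (cong j^ ρ2))
    where
    ρ2 : res (suc n) ≡ 𝟐
    ρ2 = res-of {suc n} e

  -- (-j - 1)² = j
  Pat*j : ∀ n → emul (Pat ℚ[j]R -𝐣 -𝐣⁻¹ (suc n)) 𝐣 ≡ Cat ℚ[j]R -𝐣 -𝐣⁻¹ (suc n)
  Pat*j n = trans (*-comm (Pat ℚ[j]R -𝐣 -𝐣⁻¹ (suc n)) 𝐣) (Pat-value (suc n) (Divisibility.Cpoly-doubleRoot n))

  Pat-Cat : ∀ n → Pat ℚ[j]R -𝐣 -𝐣⁻¹ (suc n) ≡ emul (Cat ℚ[j]R -𝐣 -𝐣⁻¹ (suc n)) (emul 𝐣 𝐣)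
  Pat-Cat n = begin
    P ≡⟨ sym (*-identityˡ P) ⟩
    𝐣 * (𝐣 * 𝐣) * P ≡⟨ solve 2 (λ j p → j :* (j :* j) :* p := p :* j :* (j :* j)) refl 𝐣 P ⟩
    P * 𝐣 * (𝐣 * 𝐣) ≡⟨ cong (_* (𝐣 * 𝐣)) (Pat*j n) ⟩
    Cat ℚ[j]R -𝐣 -𝐣⁻¹ (suc n) * (𝐣 * 𝐣) ∎
    where P = Pat ℚ[j]R -𝐣 -𝐣⁻¹ (suc n)

theorem1p5 : (λ′ : ℕ → ℤ) → IsLambda λ′ → (n : ℕ) → 1 ≤ n →
    -- (a)  q = -1
    ( (Cat ℚR (ℚ.- ℚ.1ℚ) (ℚ.- ℚ.1ℚ) n ≡ (+ r n) ℚ./ 1)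
    × (Pat ℚR (ℚ.- ℚ.1ℚ) (ℚ.- ℚ.1ℚ) n ≡ (+ r n) ℚ./ 4) )
    -- (b)  q = j = e^{2πi/3}
    × ( (Cat ℚ[j]R 𝐣 𝐣⁻¹ n ≡ emul (ι ((ℤ.- (+ 3 ℤ.* λ′ n)) ℚ./ 1)) (powR ℚ[j]R 𝐣 n))
    × (Pat ℚ[j]R 𝐣 𝐣⁻¹ n ≡ emul (ι (λ′ n ℚ./ 1)) (powR ℚ[j]R 𝐣 (n ∸ 1))) )
    -- (c)  q = i
    × ( (Cat ℚ[i]R 𝐢 𝐢⁻¹ n
          ≡ gmul (ι ((-1ℤ ^ ⌊ n + 1 /2⌋ ℤ.* + r′ n) ℚ./ 1)) (powR ℚ[i]R 𝐢 n))
    × (Pat ℚ[i]R 𝐢 𝐢⁻¹ n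
          ≡ gmul (ι ((-1ℤ ^ ⌊ n ∸ 1 /2⌋) ℚ./ 1 ℚ.* ((+ r′ n) ℚ./ 2))) (powR ℚ[i]R 𝐢 (n ∸ 1))) )
    -- (d)  q = -j = e^{πi/3}
    × ( (n % 3 ≡ 0 → Cat ℚ[j]R -𝐣 -𝐣⁻¹ n ≡ ι ((+ r n) ℚ./ 1))
    × (n % 3 ≡ 1 → Cat ℚ[j]R -𝐣 -𝐣⁻¹ n ≡ emul (ι ((+ r n) ℚ./ 4)) 𝐣)
    × (n % 3 ≡ 2 → Cat ℚ[j]R -𝐣 -𝐣⁻¹ n
                     ≡ emul (ι (ℚ.- ((+ r n) ℚ./ 2))) (emul 𝐣 𝐣))
    × (emul (Pat ℚ[j]R -𝐣 -𝐣⁻¹ n) 𝐣 ≡ Cat ℚ[j]R -𝐣 -𝐣⁻¹ n)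
    × (Pat ℚ[j]R -𝐣 -𝐣⁻¹ n ≡ emul (Cat ℚ[j]R -𝐣 -𝐣⁻¹ n) (emul 𝐣 𝐣)) )
theorem1p5 λ′ isλ (suc n) (s≤s z≤n) =
    (AtMinusOne.Cat-−1 (suc n) , AtMinusOne.Pat-−1 n)
  , ( trans (AtJ.Cat-j λ′ isλ n) (cong (λ z → emul z (powR ℚ[j]R 𝐣 (suc n)))
        (trans (intR-ℚ[j] (ℤ.- (+ 3) ℤ.* λ′ (suc n))) (cong (λ z → ι (z ℚ./ 1))
          (sym (ℤP.neg-distribˡ-* (+ 3) (λ′ (suc n)))))))
    , trans (AtJ.Pat-j λ′ isλ n) (cong (λ z → emul z (powR ℚ[j]R 𝐣 n)) (intR-ℚ[j] (λ′ (suc n)))))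
  , ( trans (AtI.Cat-i (suc n)) (cong (λ z → gmul z (powR ℚ[i]R 𝐢 (suc n)))
    (intR-ℚ[i] (-1ℤ ^ ⌊ suc n + 1 /2⌋ ℤ.* + r′ (suc n))))
    , AtI.Pat-i n)
  , (AtMinusJ.Cat-0 n , AtMinusJ.Cat-1 n , AtMinusJ.Cat-2 n , AtMinusJ.Pat*j n , AtMinusJ.Pat-Cat n)
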